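{- Let $n\in\mathbb{N}$, $d\in\mathbb{N}_0$, $\boldsymbol{c}=(c_1,\ldots,c_d)\in(\mathbb{N}\setminus\{2\})^d$ and $\boldsymbol{z}=(z_0,\ldots,z_d)\in\mathbb{C}^{d+1}$ with $|z_j|<1$ for $j=0,\ldots,d$. Put $c_0=1$, $c_{d+1}=0$, $\delta_i=\delta(c_i)+\delta(c_{i+1})$ for $0\le i\le d$, and $k_{ -1}=0$. Then $$G_n(\boldsymbol{c};\boldsymbol{z})=\frac{n\binom{2n}{n}}{2^{4n-2}}\sum_{n\geq k_0\geq k_1\geq\cdots\geq k_d\geq1}\binom{2n-1}{n-k_0}\prod_{i=0}^{d}\frac{(-1)^{k_i\delta_i}(2k_i-1)^{\delta_i-1}}{(2k_i-1)^2-z_i^2}V_{k_{i-1},k_i}^{\#}(\{1\}^{c_i-3}).$$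
   Context: For an index (finite sequence of positive integers) $\boldsymbol{s}=(s_1,\ldots,s_r)$ and $n\in\mathbb{N}$, the multiple $t$-harmonic star sum is $t^{\star}_n(\boldsymbol{s})=\sum_{n\geq k_1\geq\cdots\geq k_r\geq1}\prod_{j=1}^r(2k_j-1)^{ -s_j}$, with $t^\star_n(\emptyset)=1$. $\{s\}^a$ denotes $s$ repeated $a$ times; for $a\le 0$, $\{1\}^{a}$ is the empty index. The generating function is $G_n(\boldsymbol{c};\boldsymbol{z})=\sum_{a_0,\ldots,a_d\geq0}t^{\star}_n(\{2\}^{a_0},c_1,\{2\}^{a_1},\ldots,c_d,\{2\}^{a_d})z_0^{2a_0}\cdots z_d^{2a_d}$. For $k,m\in\mathbb{N}_0$ let $\triangle(k,m)=0$ if $k=m$ and $1$ otherwise. For an index $\boldsymbol{s}=(s_1,\ldots,s_r)$: if $\boldsymbol{s}\ne\emptyset$ and $k\ge m$, $V^{\#}_{k,m}(\boldsymbol{s})=\frac{2k-1}{2m-1}\sum_{k\geq l_1\geq\cdots\geq l_r\geq m}\frac{2^{\triangle(k,l_1)+\triangle(l_1,l_2)+\cdots+\triangle(l_r,m)}}{(2l_1-1)^{s_1}\cdots(2l_r-1)^{s_r}}$; otherwise $V^{\#}_{k,m}(\boldsymbol{s})=\left(2\cdot\frac{2k-1}{2m-1}\right)^{\triangle(k,m)}$. For $c\in\mathbb{N}_0$, $\delta(c)=2$ if $c=0$, $\delta(c)=1$ if $c=1$, $\delta(c)=0$ if $c\ge3$. -}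

module Defs where

open import Algebra.Bundles.Raw using (RawSemiring)
import Algebra.Definitions.RawSemiring as RawSemiringDefinitions
import Algebra.Properties.Monoid.Mult as MonoidMult
import Algebra.Properties.Semiring.Mult as SemiringMult
open import Algebra.Bundles using (CommutativeRing)
open import Data.Bool.Base using (if_then_else_)
open import Data.Integer.Base as ℤ using (ℤ; +_; -[1+_]; 1ℤ)
import Data.Integer.Properties as ℤ
open import Data.List.Base as List using (List; []; _∷_; _++_; length)
open import Data.List.Membership.Propositional using (_∈_)
open import Data.List.Relation.Unary.Unique.Propositional using (Unique)
open import Data.Nat.Base as ℕ using (ℕ; zero; suc)
import Data.Nat.Properties as ℕ
open import Data.Nat.Coprimality as Coprimality using (1-coprimeTo)
open import Data.Product.Base using (∃; _×_; _,_; proj₁; proj₂)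
open import Data.Rational.Base as ℚ using (ℚ; mkℚ; 0ℚ; 1ℚ; ½; _+_; _*_; _-_; -_; _/_; 1/_; ∣_∣; _≤_; _<_; *≤*; *<*)
open import Data.Rational.Properties
open import Data.Rational.Solver using (module +-*-Solver)
open import Data.Sum.Base using (_⊎_; inj₁; inj₂)
open import Data.Vec.Base as Vec using (Vec; []; _∷_)
open import Level using (0ℓ)
open import Relation.Binary.PropositionalEquality
open import Relation.Nullary.Decidable.Core using (does; yes; no)
open import Relation.Nullary.Negation.Core using (contradiction)

open RawSemiringDefinitions ℚ.+-*-rawSemiring public
  using () renaming (_^_ to _^ℚ_; product to ∏ℚ)
open RawSemiringDefinitions ℚ.+-*-rawSemiring
  using () renaming (_×_ to _·_)

infix 9 _⁻¹
infixr 8 _^ᶻ_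

-- Total, with 0⁻¹ = 0.

_⁻¹ : ℚ → ℚ
q ⁻¹ with q ≟ 0ℚ
... | yes _   = 0ℚ
... | no  q≢0 = 1/_ q {{ℚ.≢-nonZero q≢0}}

_^ᶻ_ : ℚ → ℤ → ℚ
q ^ᶻ (+ n)    = q ^ℚ n
q ^ᶻ -[1+ n ] = (q ⁻¹) ^ℚ suc n

∑ℚ : {A : Set} → List A → (A → ℚ) → ℚ
∑ℚ xs f = List.foldr (λ x s → f x + s) 0ℚ xs

-- 1/(n+1)

mesh : ℕ → ℚ
mesh n = mkℚ (+ 1) n (1-coprimeTo (suc n))

module ℚ-Lemmas where
  ⁻¹-inverse : ∀ q → 0ℚ < q → q * q ⁻¹ ≡ 1ℚ
  ⁻¹-inverse q 0<q with q ≟ 0ℚ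
  ... | yes refl = contradiction 0<q (<-irrefl refl)
  ... | no  q≢0  = *-inverseʳ q {{ℚ.≢-nonZero q≢0}}

  ≤-by : ∀ {a b} c → 0ℚ ≤ c → b ≡ a + c → a ≤ b
  ≤-by {a} c 0≤c refl = subst (_≤ a + c) (+-identityʳ a) (+-monoʳ-≤ a 0≤c)

  <-by : ∀ {a b} c → 0ℚ < c → b ≡ a + c → a < b
  <-by {a} c 0<c refl = subst (_< a + c) (+-identityʳ a) (+-monoʳ-< a 0<c)

  0≤b-a : ∀ {a b} → a ≤ b → 0ℚ ≤ b - a
  0≤b-a {a} {b} a≤b = subst (_≤ b - a) (+-inverseʳ a) (+-monoˡ-≤ (- a) a≤b)

  0<b-a : ∀ {a b} → a < b → 0ℚ < b - a
  0<b-a {a} {b} a<b = subst (_< b - a) (+-inverseʳ a) (+-monoˡ-< (- a) a<b)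

  0≤* : ∀ {a b} → 0ℚ ≤ a → 0ℚ ≤ b → 0ℚ ≤ a * b
  0≤* {a} {b} 0≤a 0≤b =
    subst (_≤ a * b) (*-zeroʳ a) (*-monoˡ-≤-nonNeg a {{ℚ.nonNegative 0≤a}} 0≤b)

  0<* : ∀ {a b} → 0ℚ < a → 0ℚ < b → 0ℚ < a * b
  0<* {a} {b} 0<a 0<b =
    subst (_< a * b) (*-zeroʳ a) (*-monoʳ-<-pos a {{ℚ.positive 0<a}} 0<b)

  0≤+ : ∀ {a b} → 0ℚ ≤ a → 0ℚ ≤ b → 0ℚ ≤ a + b
  0≤+ 0≤a 0≤b = +-mono-≤ 0≤a 0≤b

  *-mono : ∀ {a b c d} → 0ℚ ≤ a → a ≤ b → 0ℚ ≤ c → c ≤ d → a * c ≤ b * d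
  *-mono {a} {b} {c} {d} 0≤a a≤b 0≤c c≤d = ≤-trans
    (*-monoˡ-≤-nonNeg a {{ℚ.nonNegative 0≤a}} c≤d)
    (*-monoʳ-≤-nonNeg d {{ℚ.nonNegative (≤-trans 0≤c c≤d)}} a≤b)

  p≤∣p∣ : ∀ p → p ≤ ∣ p ∣
  p≤∣p∣ p with ∣p∣≡p∨∣p∣≡-p p
  ... | inj₁ eq = ≤-reflexive (sym eq)
  ... | inj₂ eq = ≤-trans
    (subst₂ _≤_ (neg-involutive p) refl (neg-antimono-≤ (subst (0ℚ ≤_) eq (0≤∣p∣ p))))
    (0≤∣p∣ p)
    where
    neg-involutive : ∀ p → - (- p) ≡ p
    neg-involutive = solve 1 (λ p → :- (:- p) := p) refl
      where open +-*-Solver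

  ∣-∣<-intro : ∀ {p ε} → p < ε → - p < ε → ∣ p ∣ < ε
  ∣-∣<-intro {p} {ε} p<ε -p<ε with ∣p∣≡p∨∣p∣≡-p p
  ... | inj₁ eq = subst (_< ε) (sym eq) p<ε
  ... | inj₂ eq = subst (_< ε) (sym eq) -p<ε

  0≤p*p : ∀ p → 0ℚ ≤ p * p
  0≤p*p p with ∣p∣≡p∨∣p∣≡-p p
  ... | inj₁ eq = 0≤* 0≤p 0≤p
    where 0≤p = subst (0ℚ ≤_) eq (0≤∣p∣ p)
  ... | inj₂ eq = subst (0ℚ ≤_) (lemma p) (0≤* 0≤-p 0≤-p)
    where
    0≤-p = subst (0ℚ ≤_) eq (0≤∣p∣ p)
    open +-*-Solver
    lemma : ∀ p → (- p) * (- p) ≡ p * p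
    lemma = solve 1 (λ p → (:- p) :* (:- p) := p :* p) refl

  0<½ : 0ℚ < ½
  0<½ = positive⁻¹ ½

  0<1 : 0ℚ < 1ℚ
  0<1 = positive⁻¹ 1ℚ

  half : ∀ ε → ½ * ε + ½ * ε ≡ ε
  half ε = trans (sym (*-distribʳ-+ ε ½ ½)) (*-identityˡ ε)

  0<⁻¹ : ∀ {q} → 0ℚ < q → 0ℚ < q ⁻¹
  0<⁻¹ {q} 0<q with q ≟ 0ℚ
  ... | yes refl = contradiction 0<q (<-irrefl refl)
  ... | no  q≢0  = positive⁻¹ (1/_ q {{_}}) {{1/pos⇒pos q {{ℚ.positive 0<q}}}}

  fromℕ : ℕ → ℚ
  fromℕ n = mkℚ (+ n) 0 (Coprimality.sym (1-coprimeTo n))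

  fromℕ-· : ∀ n → n · 1ℚ ≡ fromℕ n
  fromℕ-· zero    = refl
  fromℕ-· (suc n) = trans (cong (λ x → 1ℚ + x) (fromℕ-· n))
    (trans (/-cong {q₁ = 1} {q₂ = 1} (cong₂ ℤ._+_ {x = + 1} refl (ℤ.*-identityʳ (+ n))) refl)
           (fromℚᵘ-toℚᵘ (fromℕ (suc n))))

  0<mesh : ∀ n → 0ℚ < mesh n
  0<mesh n = positive⁻¹ (mesh n)

  mesh-small : ∀ ε → 0ℚ < ε → ∃ λ N → ∀ {n} → N ℕ.≤ n → mesh n ≤ ε
  mesh-small (mkℚ (+ suc p) d _) _ = d , λ {n} d≤n → *≤* (ℤ.+≤+
    (ℕ.*-mono-≤ {1} {suc p} {suc d} {suc n} (ℕ.s≤s ℕ.z≤n) (ℕ.s≤s d≤n)))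
  mesh-small (mkℚ (+ 0) d _)    (*<* (ℤ.+<+ ()))
  mesh-small (mkℚ -[1+ p ] d _) (*<* ())

open ℚ-Lemmas

-- Reals are Cauchy sequences of rationals, with null differences as the equality _≃ʳ_.

record ℝ : Set where
  constructor mkℝ
  field
    seq    : ℕ → ℚ
    cauchy : ∀ ε → 0ℚ < ε → ∃ λ N → ∀ {m n} → N ℕ.≤ m → N ℕ.≤ n → ∣ seq m - seq n ∣ < ε

open ℝ public

infix 4 _≃ʳ_ _<ʳ_
infixl 6 _+ʳ_
infixl 7 _*ʳ_
infix 8 -ʳ_

_≃ʳ_ : ℝ → ℝ → Set
x ≃ʳ y = ∀ ε → 0ℚ < ε → ∃ λ N → ∀ {n} → N ℕ.≤ n → ∣ seq x n - seq y n ∣ < ε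

_<ʳ_ : ℝ → ℝ → Set
x <ʳ y = ∃ λ δ → 0ℚ < δ × ∃ λ N → ∀ {n} → N ℕ.≤ n → seq x n + δ ≤ seq y n

ℚ⇒ℝ : ℚ → ℝ
ℚ⇒ℝ q = mkℝ (λ _ → q) λ ε 0<ε → 0 , λ _ _ → subst (λ p → ∣ p ∣ < ε) (sym (+-inverseʳ q)) 0<ε

0ʳ 1ʳ : ℝ
0ʳ = ℚ⇒ℝ 0ℚ
1ʳ = ℚ⇒ℝ 1ℚ

_+ʳ_ : ℝ → ℝ → ℝ
x +ʳ y = mkℝ (λ n → seq x n + seq y n) λ ε 0<ε →
  let N , p = cauchy x (½ * ε) (0<* 0<½ 0<ε)
      M , q = cauchy y (½ * ε) (0<* 0<½ 0<ε)
  in  N ℕ.⊔ M , λ {m} {n} ≤m ≤n → begin-strict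
    ∣ (seq x m + seq y m) - (seq x n + seq y n) ∣
      ≡⟨ cong ∣_∣ (lemma (seq x m) (seq y m) (seq x n) (seq y n)) ⟩
    ∣ (seq x m - seq x n) + (seq y m - seq y n) ∣
      ≤⟨ ∣p+q∣≤∣p∣+∣q∣ (seq x m - seq x n) (seq y m - seq y n) ⟩
    ∣ seq x m - seq x n ∣ + ∣ seq y m - seq y n ∣
      <⟨ +-mono-< (p (ℕ.m⊔n≤o⇒m≤o N M ≤m) (ℕ.m⊔n≤o⇒m≤o N M ≤n))
                  (q (ℕ.m⊔n≤o⇒n≤o N M ≤m) (ℕ.m⊔n≤o⇒n≤o N M ≤n)) ⟩
    ½ * ε + ½ * ε
      ≡⟨ half ε ⟩
    ε ∎
  where
  open ≤-Reasoning
  open +-*-Solver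
  lemma : ∀ a b c d → (a + b) - (c + d) ≡ (a - c) + (b - d)
  lemma = solve 4 (λ a b c d → (a :+ b) :- (c :+ d) := (a :- c) :+ (b :- d)) refl

-ʳ_ : ℝ → ℝ
-ʳ x = mkℝ (λ n → - seq x n) λ ε 0<ε →
  let N , p = cauchy x ε 0<ε
  in  N , λ {m} {n} ≤m ≤n → subst (λ q → ∣ q ∣ < ε) (lemma (seq x m) (seq x n)) (p ≤n ≤m)
  where
  open +-*-Solver
  lemma : ∀ a b → b - a ≡ (- a) - (- b)
  lemma = solve 2 (λ a b → b :- a := (:- a) :- (:- b)) refl

module Boundedness where
  eventually-bounded : ∀ x → ∃ λ B → 0ℚ < B × ∃ λ N → ∀ {n} → N ℕ.≤ n → ∣ seq x n ∣ ≤ B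
  eventually-bounded x with cauchy x 1ℚ 0<1
  ... | N , p = B , +-mono-≤-< (0≤∣p∣ (seq x N)) 0<1 , N , λ {n} ≤n → begin
    ∣ seq x n ∣                          ≡⟨ cong ∣_∣ (lemma (seq x N) (seq x n)) ⟩
    ∣ seq x N + (seq x n - seq x N) ∣     ≤⟨ ∣p+q∣≤∣p∣+∣q∣ (seq x N) (seq x n - seq x N) ⟩
    ∣ seq x N ∣ + ∣ seq x n - seq x N ∣    ≤⟨ +-monoʳ-≤ ∣ seq x N ∣ (<⇒≤ (p ≤n ℕ.≤-refl)) ⟩
    B                                    ∎
    where
    open ≤-Reasoning
    open +-*-Solver
    B = ∣ seq x N ∣ + 1ℚ
    lemma : ∀ a b → b ≡ a + (b - a)
    lemma = solve 2 (λ a b → b := a :+ (b :- a)) refl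

open Boundedness

_*ʳ_ : ℝ → ℝ → ℝ
x *ʳ y = mkℝ (λ n → seq x n * seq y n) *-cauchy
  where
  open ≤-Reasoning
  open +-*-Solver
  lemma : ∀ a b c d → a * b - c * d ≡ a * (b - d) + (a - c) * d
  lemma = solve 4 (λ a b c d → a :* b :- c :* d := a :* (b :- d) :+ (a :- c) :* d) refl

  lemma₂ : ∀ b i e → b * (½ * e * i) + (½ * e * i) * b ≡ (½ * e + ½ * e) * (b * i)
  lemma₂ = solve 3 (λ b i e → b :* (con ½ :* e :* i) :+ (con ½ :* e :* i) :* b
                             := (con ½ :* e :+ con ½ :* e) :* (b :* i)) refl

  *-cauchy : ∀ ε → 0ℚ < ε → ∃ λ N → ∀ {m n} → N ℕ.≤ m → N ℕ.≤ n →
             ∣ seq x m * seq y m - seq x n * seq y n ∣ < ε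
  *-cauchy ε 0<ε = K ℕ.⊔ (L ℕ.⊔ (M ℕ.⊔ N)) , bound
    where
    bx = eventually-bounded x
    by = eventually-bounded y
    B = proj₁ bx + proj₁ by
    0<B : 0ℚ < B
    0<B = +-mono-< (proj₁ (proj₂ bx)) (proj₁ (proj₂ by))
    ε′ = ½ * ε * B ⁻¹
    0<ε′ : 0ℚ < ε′
    0<ε′ = 0<* (0<* 0<½ 0<ε) (0<⁻¹ 0<B)
    K = proj₁ (proj₂ (proj₂ bx))
    L = proj₁ (proj₂ (proj₂ by))
    M = proj₁ (cauchy x ε′ 0<ε′)
    N = proj₁ (cauchy y ε′ 0<ε′)

    bound : ∀ {m n} → K ℕ.⊔ (L ℕ.⊔ (M ℕ.⊔ N)) ℕ.≤ m → K ℕ.⊔ (L ℕ.⊔ (M ℕ.⊔ N)) ℕ.≤ n →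
            ∣ seq x m * seq y m - seq x n * seq y n ∣ < ε
    bound {m} {n} ≤m ≤n = begin-strict
      ∣ seq x m * seq y m - seq x n * seq y n ∣
        ≡⟨ cong ∣_∣ (lemma (seq x m) (seq y m) (seq x n) (seq y n)) ⟩
      ∣ seq x m * Δy + Δx * seq y n ∣
        ≤⟨ ∣p+q∣≤∣p∣+∣q∣ (seq x m * Δy) (Δx * seq y n) ⟩
      ∣ seq x m * Δy ∣ + ∣ Δx * seq y n ∣
        ≡⟨ cong₂ _+_ (∣p*q∣≡∣p∣*∣q∣ (seq x m) Δy) (∣p*q∣≡∣p∣*∣q∣ Δx (seq y n)) ⟩
      ∣ seq x m ∣ * ∣ Δy ∣ + ∣ Δx ∣ * ∣ seq y n ∣
        ≤⟨ +-mono-≤ (*-mono (0≤∣p∣ (seq x m)) xm≤B (0≤∣p∣ Δy) ≤-refl)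
                    (*-mono (0≤∣p∣ Δx) ≤-refl (0≤∣p∣ (seq y n)) yn≤B) ⟩
      B * ∣ Δy ∣ + ∣ Δx ∣ * B
        <⟨ +-mono-< (*-monoʳ-<-pos B {{ℚ.positive 0<B}} Δy<ε′)
                    (*-monoˡ-<-pos B {{ℚ.positive 0<B}} Δx<ε′) ⟩
      B * ε′ + ε′ * B
        ≡⟨ lemma₂ B (B ⁻¹) ε ⟩
      (½ * ε + ½ * ε) * (B * B ⁻¹)
        ≡⟨ cong₂ _*_ (half ε) (⁻¹-inverse B 0<B) ⟩
      ε * 1ℚ
        ≡⟨ *-identityʳ ε ⟩
      ε ∎
      where
      Δx = seq x m - seq x n
      Δy = seq y m - seq y n
      LMN = L ℕ.⊔ (M ℕ.⊔ N)
      MN = M ℕ.⊔ N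
      xm≤B : ∣ seq x m ∣ ≤ B
      xm≤B = ≤-trans (proj₂ (proj₂ (proj₂ bx)) (ℕ.m⊔n≤o⇒m≤o K LMN ≤m))
                     (≤-by (proj₁ by) (<⇒≤ (proj₁ (proj₂ by))) refl)
      yn≤B : ∣ seq y n ∣ ≤ B
      yn≤B = ≤-trans (proj₂ (proj₂ (proj₂ by)) (ℕ.m⊔n≤o⇒m≤o L MN (ℕ.m⊔n≤o⇒n≤o K LMN ≤n)))
                     (≤-by (proj₁ bx) (<⇒≤ (proj₁ (proj₂ bx))) (+-comm (proj₁ bx) (proj₁ by)))
      ≤MN : ∀ {k} → K ℕ.⊔ LMN ℕ.≤ k → MN ℕ.≤ k
      ≤MN ≤k = ℕ.m⊔n≤o⇒n≤o L MN (ℕ.m⊔n≤o⇒n≤o K LMN ≤k)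
      Δx<ε′ : ∣ Δx ∣ < ε′
      Δx<ε′ = proj₂ (cauchy x ε′ 0<ε′) (ℕ.m⊔n≤o⇒m≤o M N (≤MN ≤m)) (ℕ.m⊔n≤o⇒m≤o M N (≤MN ≤n))
      Δy<ε′ : ∣ Δy ∣ < ε′
      Δy<ε′ = proj₂ (cauchy y ε′ 0<ε′) (ℕ.m⊔n≤o⇒n≤o M N (≤MN ≤m)) (ℕ.m⊔n≤o⇒n≤o M N (≤MN ≤n))

recipʳ : (x : ℝ) → 0ʳ <ʳ x → ℝ
recipʳ x (δ , 0<δ , K , δ≤) = mkℝ (λ n → seq x n ⁻¹) λ ε 0<ε →
  let ε′    = δ * δ * ε
      0<ε′  = 0<* (0<* 0<δ 0<δ) 0<ε
      N , p = cauchy x ε′ 0<ε′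
  in  K ℕ.⊔ N , λ {m} {n} ≤m ≤n →
      let a = seq x m
          b = seq x n
          δ≤a = δ≤x (ℕ.m⊔n≤o⇒m≤o K N ≤m)
          δ≤b = δ≤x (ℕ.m⊔n≤o⇒m≤o K N ≤n)
          0<a = <-≤-trans 0<δ δ≤a
          0<b = <-≤-trans 0<δ δ≤b
          0≤a⁻¹ = <⇒≤ (0<⁻¹ 0<a)
          0≤b⁻¹ = <⇒≤ (0<⁻¹ 0<b)
          0≤a⁻¹b⁻¹ = 0≤* 0≤a⁻¹ 0≤b⁻¹
      in begin-strict
        ∣ a ⁻¹ - b ⁻¹ ∣
          ≡⟨ cong ∣_∣ (difference 0<a 0<b) ⟩
        ∣ (a ⁻¹ * b ⁻¹) * (b - a) ∣
          ≡⟨ ∣p*q∣≡∣p∣*∣q∣ (a ⁻¹ * b ⁻¹) (b - a) ⟩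
        ∣ a ⁻¹ * b ⁻¹ ∣ * ∣ b - a ∣
          ≡⟨ cong (_* ∣ b - a ∣) (0≤p⇒∣p∣≡p 0≤a⁻¹b⁻¹) ⟩
        (a ⁻¹ * b ⁻¹) * ∣ b - a ∣
          ≤⟨ *-mono 0≤a⁻¹b⁻¹ (*-mono 0≤a⁻¹ (antitone δ≤a) 0≤b⁻¹ (antitone δ≤b)) (0≤∣p∣ (b - a)) ≤-refl ⟩
        (δ ⁻¹ * δ ⁻¹) * ∣ b - a ∣
          <⟨ *-monoʳ-<-pos (δ ⁻¹ * δ ⁻¹) {{ℚ.positive (0<* (0<⁻¹ 0<δ) (0<⁻¹ 0<δ))}}
               (p (ℕ.m⊔n≤o⇒n≤o K N ≤n) (ℕ.m⊔n≤o⇒n≤o K N ≤m)) ⟩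
        (δ ⁻¹ * δ ⁻¹) * (δ * δ * ε)
          ≡⟨ regroup δ (δ ⁻¹) ε ⟩
        (δ * δ ⁻¹) * (δ * δ ⁻¹) * ε
          ≡⟨ cong (λ u → u * u * ε) (⁻¹-inverse δ 0<δ) ⟩
        1ℚ * 1ℚ * ε
          ≡⟨ *-identityˡ ε ⟩
        ε ∎
  where
  open ≤-Reasoning
  open +-*-Solver
  δ≤x : ∀ {n} → K ℕ.≤ n → δ ≤ seq x n
  δ≤x {n} ≤n = subst (_≤ seq x n) (+-identityˡ δ) (δ≤ ≤n)

  regroup : ∀ d i e → (i * i) * (d * d * e) ≡ (d * i) * (d * i) * e
  regroup = solve 3 (λ d i e → (i :* i) :* (d :* d :* e) := (d :* i) :* (d :* i) :* e) refl

  swap₁ : ∀ a i j → (i * j) * a ≡ j * (a * i)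
  swap₁ = solve 3 (λ a i j → (i :* j) :* a := j :* (a :* i)) refl

  swap₂ : ∀ b i j → (i * j) * b ≡ i * (b * j)
  swap₂ = solve 3 (λ b i j → (i :* j) :* b := i :* (b :* j)) refl

  distrib : ∀ a b c → c * (b - a) ≡ c * b - c * a
  distrib = solve 3 (λ a b c → c :* (b :- a) := c :* b :- c :* a) refl

  difference : ∀ {a b} → 0ℚ < a → 0ℚ < b → a ⁻¹ - b ⁻¹ ≡ (a ⁻¹ * b ⁻¹) * (b - a)
  difference {a} {b} 0<a 0<b = sym (trans (distrib a b (a ⁻¹ * b ⁻¹)) (cong₂ _-_
    (trans (swap₂ b (a ⁻¹) (b ⁻¹)) (trans (cong (a ⁻¹ *_) (⁻¹-inverse b 0<b)) (*-identityʳ (a ⁻¹))))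
    (trans (swap₁ a (a ⁻¹) (b ⁻¹)) (trans (cong (b ⁻¹ *_) (⁻¹-inverse a 0<a)) (*-identityʳ (b ⁻¹))))))

  antitone : ∀ {a} → δ ≤ a → a ⁻¹ ≤ δ ⁻¹
  antitone {a} δ≤a = ≤-by ((δ ⁻¹ * a ⁻¹) * (a - δ))
    (0≤* (0≤* (<⇒≤ (0<⁻¹ 0<δ)) (<⇒≤ (0<⁻¹ 0<a))) (0≤b-a δ≤a))
    (trans (rearrange (a ⁻¹) (δ ⁻¹)) (cong (λ u → a ⁻¹ + u) (difference 0<δ 0<a)))
    where
    0<a = <-≤-trans 0<δ δ≤a
    rearrange : ∀ u v → v ≡ u + (v - u)
    rearrange = solve 2 (λ u v → v := u :+ (v :- u)) refl

-- The largest multiple of h among 0, h, …, j h whose square is at most q (0 if there is none).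

rootBelow : ℚ → ℚ → ℕ → ℚ
rootBelow q h zero    = 0ℚ
rootBelow q h (suc j) with (suc j · h) * (suc j · h) ≤? q
... | yes _ = suc j · h
... | no  _ = rootBelow q h j

-- The largest j/(n+1) with (j/(n+1))² ≤ q (0 if q < 0); such a j is at most (∣numerator q∣ + 1)(n+1).

sqrtApprox : ℚ → ℕ → ℚ
sqrtApprox q n = rootBelow q (mesh n) (suc ℤ.∣ ℚ.numerator q ∣ ℕ.* suc n)

module SqrtLemmas where
  0≤·h : ∀ {h} → 0ℚ ≤ h → ∀ j → 0ℚ ≤ j · h
  0≤·h 0≤h zero    = ≤-refl
  0≤·h 0≤h (suc j) = 0≤+ 0≤h (0≤·h 0≤h j)

  0≤rootBelow : ∀ q {h} → 0ℚ ≤ h → ∀ j → 0ℚ ≤ rootBelow q h j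
  0≤rootBelow q     0≤h zero    = ≤-refl
  0≤rootBelow q {h} 0≤h (suc j) with (suc j · h) * (suc j · h) ≤? q
  ... | yes _ = 0≤·h 0≤h (suc j)
  ... | no  _ = 0≤rootBelow q 0≤h j

  rootBelow² : ∀ q h j → rootBelow q h j ≡ 0ℚ ⊎ rootBelow q h j * rootBelow q h j ≤ q
  rootBelow² q h zero    = inj₁ refl
  rootBelow² q h (suc j) with (suc j · h) * (suc j · h) ≤? q
  ... | yes s = inj₂ s
  ... | no  _ = rootBelow² q h j

  rootBelow-max : ∀ q h j → q < (suc j · h) * (suc j · h) →
                  q < (rootBelow q h j + h) * (rootBelow q h j + h)
  rootBelow-max q h zero    q< = subst (λ u → q < u * u) (+-comm h 0ℚ) q<
  rootBelow-max q h (suc j) q< with (suc j · h) * (suc j · h) ≤? q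
  ... | yes _ = subst (λ u → q < u * u) (+-comm h (suc j · h)) q<
  ... | no  r = rootBelow-max q h j (≰⇒> r)

  q<fromℕ : ∀ q → q < fromℕ (suc ℤ.∣ ℚ.numerator q ∣)
  q<fromℕ (mkℚ (+ n) d _) = *<* (subst₂ ℤ._<_ (sym (ℤ.*-identityʳ (+ n)))
    (ℤ.pos-* (suc n) (suc d)) (ℤ.+<+ (ℕ.m≤m*n (suc n) (suc d))))
  q<fromℕ (mkℚ -[1+ n ] d _) = *<* ℤ.-<+

  q<[top]² : ∀ q n → let t = (suc ℤ.∣ ℚ.numerator q ∣ ℕ.* suc n) · mesh n in q < t * t
  q<[top]² q n = <-≤-trans (q<fromℕ q) (subst (λ u → fromℕ K ≤ u * u) (sym top≡)
    (subst (_≤ fromℕ K * fromℕ K) (*-identityʳ (fromℕ K))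
      (*-mono 0≤K ≤-refl (<⇒≤ 0<1) 1≤K)))
    where
    open CommutativeRing +-*-commutativeRing using (+-monoid; semiring)
    K = suc ℤ.∣ ℚ.numerator q ∣
    1≤K : 1ℚ ≤ fromℕ K
    1≤K = *≤* (ℤ.+≤+ (ℕ.s≤s ℕ.z≤n))
    0≤K : 0ℚ ≤ fromℕ K
    0≤K = ≤-trans (<⇒≤ 0<1) 1≤K
    one : suc n · mesh n ≡ 1ℚ
    one = begin
      suc n · mesh n           ≡⟨ cong (suc n ·_) (*-identityˡ (mesh n)) ⟨
      suc n · (1ℚ * mesh n)    ≡⟨ SemiringMult.×-assoc-* semiring (suc n) 1ℚ (mesh n) ⟨
      (suc n · 1ℚ) * mesh n    ≡⟨ cong (_* mesh n) (fromℕ-· (suc n)) ⟩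
      fromℕ (suc n) * mesh n   ≡⟨ *-inverseʳ (fromℕ (suc n)) ⟩
      1ℚ ∎
      where open ≡-Reasoning
    top≡ : (K ℕ.* suc n) · mesh n ≡ fromℕ K
    top≡ = begin
      (K ℕ.* suc n) · mesh n   ≡⟨ MonoidMult.×-assocˡ +-monoid (mesh n) K (suc n) ⟨
      K · (suc n · mesh n)     ≡⟨ cong (K ·_) one ⟩
      K · 1ℚ                   ≡⟨ fromℕ-· K ⟩
      fromℕ K ∎
      where open ≡-Reasoning

  0≤sqrtApprox : ∀ q n → 0ℚ ≤ sqrtApprox q n
  0≤sqrtApprox q n = 0≤rootBelow q (<⇒≤ (0<mesh n)) (suc ℤ.∣ ℚ.numerator q ∣ ℕ.* suc n)

  sqrtApprox² : ∀ q n → sqrtApprox q n ≡ 0ℚ ⊎ sqrtApprox q n * sqrtApprox q n ≤ q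
  sqrtApprox² q n = rootBelow² q (mesh n) (suc ℤ.∣ ℚ.numerator q ∣ ℕ.* suc n)

  q<[sqrtApprox+mesh]² : ∀ q n → q < (sqrtApprox q n + mesh n) * (sqrtApprox q n + mesh n)
  q<[sqrtApprox+mesh]² q n = rootBelow-max q (mesh n) top (<-≤-trans (q<[top]² q n)
    (*-mono 0≤t t≤h+t 0≤t t≤h+t))
    where
    top = suc ℤ.∣ ℚ.numerator q ∣ ℕ.* suc n
    0≤t = 0≤·h (<⇒≤ (0<mesh n)) top
    t≤h+t : top · mesh n ≤ mesh n + top · mesh n
    t≤h+t = ≤-by (mesh n) (<⇒≤ (0<mesh n)) (+-comm (mesh n) (top · mesh n))

  sqrt-close : ∀ {p q a b h ε} → 0ℚ < ε → 0ℚ ≤ b → 0ℚ ≤ h → h ≤ ½ * ε →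
               a ≡ 0ℚ ⊎ a * a ≤ p → q < (b + h) * (b + h) →
               p - q ≤ (½ * ε) * (½ * ε) → a - b < ε
  sqrt-close {p} {q} {a} {b} {h} {ε} 0<ε 0≤b 0≤h h≤η a² q< p-q≤ with ε ≤? a - b
  ... | no  ε≰ = ≰⇒> ε≰
  ... | yes ε≤ = contradiction (helper a²) (<-irrefl refl)
    where
    open ≤-Reasoning
    open +-*-Solver
    η = ½ * ε
    0<η : 0ℚ < η
    0<η = 0<* 0<½ 0<ε
    0≤η = <⇒≤ 0<η
    b+2η≤a : (b + η) + η ≤ a
    b+2η≤a = ≤-by ((a - b) - ε) (0≤b-a ε≤) (trans (e₁ a b ε)
      (cong (_+ ((a - b) - ε)) (trans (cong (λ u → b + u) (sym (half ε))) (sym (+-assoc b η η)))))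
      where
      e₁ : ∀ a b ε → a ≡ (b + ε) + ((a - b) - ε)
      e₁ = solve 3 (λ a b ε → a := (b :+ ε) :+ ((a :- b) :- ε)) refl
    0<b+2η : 0ℚ < (b + η) + η
    0<b+2η = +-mono-≤-< (0≤+ 0≤b 0≤η) 0<η
    e₂ : ∀ b η → ((b + η) + η) * ((b + η) + η) ≡ ((b + η) * (b + η) + η * η) + ((b + η) * η + (b + η) * η)
    e₂ = solve 2 (λ b η → ((b :+ η) :+ η) :* ((b :+ η) :+ η)
           := ((b :+ η) :* (b :+ η) :+ η :* η) :+ ((b :+ η) :* η :+ (b :+ η) :* η)) refl
    e₃ : ∀ p q → q + (p - q) ≡ p
    e₃ = solve 2 (λ p q → q :+ (p :- q) := p) refl
    helper : a ≡ 0ℚ ⊎ a * a ≤ p → a < a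
    helper (inj₁ a≡0) = subst (_< a) (sym a≡0) (<-≤-trans 0<b+2η b+2η≤a)
    helper (inj₂ a²≤p) = contradiction (begin-strict
      p                                         ≡⟨ e₃ p q ⟨
      q + (p - q)                               <⟨ +-mono-<-≤ q< p-q≤ ⟩
      (b + h) * (b + h) + η * η                 ≤⟨ +-monoˡ-≤ (η * η) (*-mono (0≤+ 0≤b 0≤h) (+-monoʳ-≤ b h≤η) (0≤+ 0≤b 0≤h) (+-monoʳ-≤ b h≤η)) ⟩
      (b + η) * (b + η) + η * η                 ≤⟨ ≤-by _ (0≤+ (0≤* (0≤+ 0≤b 0≤η) 0≤η) (0≤* (0≤+ 0≤b 0≤η) 0≤η)) (e₂ b η) ⟩
      ((b + η) + η) * ((b + η) + η)             ≤⟨ *-mono (<⇒≤ 0<b+2η) b+2η≤a (<⇒≤ 0<b+2η) b+2η≤a ⟩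
      a * a                                     ≤⟨ a²≤p ⟩
      p                                         ∎) (<-irrefl refl)

open SqrtLemmas

-- Square root of a real (of its positive part, if it is negative).

sqrtʳ : ℝ → ℝ
sqrtʳ x = mkℝ (λ n → sqrtApprox (seq x n) n) λ ε 0<ε →
  let η   = ½ * ε
      0<η = 0<* 0<½ 0<ε
      N , p = cauchy x (η * η) (0<* 0<η 0<η)
      M , q = mesh-small η 0<η
      close : ∀ {m n} → N ℕ.⊔ M ℕ.≤ m → N ℕ.⊔ M ℕ.≤ n →
              sqrtApprox (seq x m) m - sqrtApprox (seq x n) n < ε
      close = λ {m} {n} ≤m ≤n → sqrt-close {seq x m} {seq x n} 0<ε (0≤sqrtApprox (seq x n) n) (<⇒≤ (0<mesh n))
                (q (ℕ.m⊔n≤o⇒n≤o N M ≤n)) (sqrtApprox² (seq x m) m) (q<[sqrtApprox+mesh]² (seq x n) n)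
                (≤-trans (p≤∣p∣ _) (<⇒≤ (p (ℕ.m⊔n≤o⇒m≤o N M ≤m) (ℕ.m⊔n≤o⇒m≤o N M ≤n))))
  in  N ℕ.⊔ M , λ {m} {n} ≤m ≤n → ∣-∣<-intro (close ≤m ≤n)
        (subst (_< ε) (swap (sqrtApprox (seq x m) m) (sqrtApprox (seq x n) n)) (close ≤n ≤m))
  where
  open +-*-Solver
  swap : ∀ a b → b - a ≡ - (a - b)
  swap = solve 2 (λ a b → b :- a := :- (a :- b)) refl

record ℂ : Set where
  constructor _+i_
  field
    re im : ℝ

open ℂ public

infix 4 _≃ᶜ_
infixl 6 _+ᶜ_ _-ᶜ_
infixl 7 _*ᶜ_

_≃ᶜ_ : ℂ → ℂ → Set
w ≃ᶜ z = re w ≃ʳ re z × im w ≃ʳ im z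

_+ᶜ_ _-ᶜ_ _*ᶜ_ : ℂ → ℂ → ℂ
w +ᶜ z = (re w +ʳ re z) +i (im w +ʳ im z)
w -ᶜ z = (re w +ʳ -ʳ re z) +i (im w +ʳ -ʳ im z)
w *ᶜ z = (re w *ʳ re z +ʳ -ʳ (im w *ʳ im z)) +i (re w *ʳ im z +ʳ im w *ʳ re z)

ℚ⇒ℂ : ℚ → ℂ
ℚ⇒ℂ q = ℚ⇒ℝ q +i 0ʳ

0ᶜ 1ᶜ : ℂ
0ᶜ = ℚ⇒ℂ 0ℚ
1ᶜ = ℚ⇒ℂ 1ℚ

ℂ-rawSemiring : RawSemiring 0ℓ 0ℓ
ℂ-rawSemiring = record
  { Carrier = ℂ ; _≈_ = _≃ᶜ_ ; _+_ = _+ᶜ_ ; _*_ = _*ᶜ_ ; 0# = 0ᶜ ; 1# = 1ᶜ }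

open RawSemiringDefinitions ℂ-rawSemiring public
  using () renaming (_^_ to _^ᶜ_; product to ∏ᶜ)

∑ᶜ : {A : Set} → List A → (A → ℂ) → ℂ
∑ᶜ xs f = List.foldr (λ x s → f x +ᶜ s) 0ᶜ xs

normSq : ℂ → ℝ
normSq z = re z *ʳ re z +ʳ im z *ʳ im z

∣_∣ᶜ : ℂ → ℝ
∣ z ∣ᶜ = sqrtʳ (normSq z)

-- The reciprocal is defined at z apart from 0, and is z̄ / ∣z∣².

_#0 : ℂ → Set
z #0 = 0ʳ <ʳ normSq z

recipᶜ : (z : ℂ) → z #0 → ℂ
recipᶜ z z#0 = (re z *ʳ r) +i (-ʳ (im z) *ʳ r)
  where r = recipʳ (normSq z) z#0

-- Unconditional (unordered) summation: the net of finite partial sums converges to s.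

HasSum : {I : Set} → (I → ℂ) → ℂ → Set
HasSum {I} f s = ∀ ε → 0ʳ <ʳ ε →
  ∃ λ (F₀ : List I) → ∀ (F : List I) → Unique F → (∀ {i} → i ∈ F₀ → i ∈ F) →
  ∣ ∑ᶜ F f -ᶜ s ∣ᶜ <ʳ ε

-- 2k - 1, which is -1 for k = 0.

odd : ℕ → ℚ
odd k = (+ (2 ℕ.* k) ℤ.- 1ℤ) / 1

-- All (l₁, …, l_r) with k ≥ l₁ ≥ … ≥ l_r ≥ m, each once.

chains : (k m r : ℕ) → List (Vec ℕ r)
chains k m zero    = [] ∷ []
chains k m (suc r) =
  List.concatMap (λ l → List.map (l ∷_) (chains l m r)) (List.map (m ℕ.+_) (List.upTo (suc k ℕ.∸ m)))

Index : Set
Index = List ℕ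

-- ∏ⱼ (2lⱼ - 1)^(-sⱼ)

oddPowers : (s : Index) → Vec ℕ (length s) → ℚ
oddPowers s l = ∏ℚ λ j → odd (Vec.lookup l j) ^ᶻ (ℤ.- (+ List.lookup s j))

t⋆ : ℕ → Index → ℚ
t⋆ n s = ∑ℚ (chains n 1 (length s)) (oddPowers s)

-- ({2}^a₀, c₁, {2}^a₁, …, c_d, {2}^a_d)

interleave2 : ∀ {d} → Vec ℕ d → Vec ℕ (suc d) → Index
interleave2 []       (a ∷ []) = List.replicate a 2
interleave2 (c ∷ cs) (a ∷ as) = List.replicate a 2 ++ c ∷ interleave2 cs as

G-term : ∀ {d} → ℕ → Vec ℕ d → Vec ℂ (suc d) → Vec ℕ (suc d) → ℂ
G-term n c z a =
  ℚ⇒ℂ (t⋆ n (interleave2 c a)) *ᶜ ∏ᶜ (λ j → Vec.lookup z j ^ᶜ (2 ℕ.* Vec.lookup a j))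

-- G_n(c; z) is given by a convergent series, so "G_n(c; z) = s" means that the series sums to s.

G[_,_,_]≡_ : ∀ {d} → ℕ → Vec ℕ d → Vec ℂ (suc d) → ℂ → Set
G[ n , c , z ]≡ s = HasSum (G-term n c z) s

△ : ℕ → ℕ → ℕ
△ k m = if does (k ℕ.≟ m) then 0 else 1

-- △(k, l₁) + △(l₁, l₂) + … + △(l_r, m)

△-sum : ∀ {r} → ℕ → Vec ℕ r → ℕ → ℕ
△-sum k []       m = △ k m
△-sum k (l ∷ ls) m = △ k l ℕ.+ △-sum l ls m

V# : ℕ → ℕ → Index → ℚ
V# k m [] = (+ 2 / 1 * (odd k * odd m ⁻¹)) ^ℚ △ k m
V# k m s@(_ ∷ _) with m ℕ.≤? k
... | yes _ = odd k * odd m ⁻¹ *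
              ∑ℚ (chains k m (length s)) (λ l → (+ 2 / 1) ^ℚ △-sum k l m * oddPowers s l)
... | no  _ = (+ 2 / 1 * (odd k * odd m ⁻¹)) ^ℚ △ k m

-- Only used for c ≠ 2; the value at 2 is arbitrary.

δ : ℕ → ℕ
δ 0 = 2
δ 1 = 1
δ _ = 0

-- The denominators (2k - 1)² - z² do not vanish for ∣z∣ < 1.

module OddLemmas where
  1≤odd² : ∀ k → 1ℚ ≤ odd k ^ℚ 2
  1≤odd² zero    = ≤-refl
  1≤odd² (suc k) = subst (λ u → 1ℚ ≤ odd (suc k) * u) (sym (*-identityʳ (odd (suc k))))
    (*-mono (<⇒≤ 0<1) 1≤odd (<⇒≤ 0<1) 1≤odd)
    where
    fromℕ≡ : ∀ n → + n / 1 ≡ fromℕ n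
    fromℕ≡ n = fromℚᵘ-toℚᵘ (fromℕ n)
    1≤odd : 1ℚ ≤ odd (suc k)
    1≤odd = subst (1ℚ ≤_) (sym (fromℕ≡ (k ℕ.+ suc (k ℕ.+ 0))))
      (*≤* (subst₂ ℤ._≤_ refl (sym (ℤ.*-identityʳ _)) (ℤ.+≤+
        (ℕ.≤-trans (ℕ.s≤s ℕ.z≤n) (ℕ.m≤n+m (suc (k ℕ.+ 0)) k)))))

open OddLemmas

odd²-z²#0 : ∀ k z → ∣ z ∣ᶜ <ʳ 1ʳ → (ℚ⇒ℂ (odd k ^ℚ 2) -ᶜ z ^ᶜ 2) #0
odd²-z²#0 k z (ε , 0<ε , N , r+ε≤1) =
  η * η , 0<* 0<η 0<η , N ℕ.⊔ M , λ {n} ≤n →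
    bound n (r+ε≤1 (ℕ.m⊔n≤o⇒m≤o N M ≤n)) (mesh≤η (ℕ.m⊔n≤o⇒n≤o N M ≤n))
  where
  open ≤-Reasoning
  open +-*-Solver
  η = ½ * ε
  0<η = 0<* 0<½ 0<ε
  M = proj₁ (mesh-small η 0<η)
  mesh≤η : ∀ {n} → M ℕ.≤ n → mesh n ≤ η
  mesh≤η = proj₂ (mesh-small η 0<η)
  w = ℚ⇒ℂ (odd k ^ℚ 2) -ᶜ z ^ᶜ 2

  bound : ∀ n → seq ∣ z ∣ᶜ n + ε ≤ 1ℚ → mesh n ≤ η → 0ℚ + η * η ≤ seq (normSq w) n
  bound n r+ε≤1 h≤η = begin
    0ℚ + η * η                                         ≡⟨ +-identityˡ (η * η) ⟩
    η * η                                              ≤⟨ *-mono 0≤η η≤u 0≤η η≤u ⟩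
    u * u                                              ≤⟨ ≤-by (v * v) (0≤p*p v) refl ⟩
    u * u + v * v                                      ∎
    where
    x = seq (re z) n
    y = seq (im z) n
    u = seq (re w) n
    v = seq (im w) n
    s = seq ∣ z ∣ᶜ n + mesh n
    A = odd k ^ℚ 2
    0≤η = <⇒≤ 0<η
    0≤s : 0ℚ ≤ s
    0≤s = 0≤+ (0≤sqrtApprox (seq (normSq z) n) n) (<⇒≤ (0<mesh n))
    s+η≤1 : s + η ≤ 1ℚ
    s+η≤1 = begin
      s + η                         ≤⟨ +-monoˡ-≤ η (+-monoʳ-≤ (seq ∣ z ∣ᶜ n) h≤η) ⟩
      (seq ∣ z ∣ᶜ n + η) + η         ≡⟨ trans (+-assoc (seq ∣ z ∣ᶜ n) η η) (cong (λ t → seq ∣ z ∣ᶜ n + t) (half ε)) ⟩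
      seq ∣ z ∣ᶜ n + ε               ≤⟨ r+ε≤1 ⟩
      1ℚ                            ∎
    s≤1 : s ≤ 1ℚ
    s≤1 = ≤-trans (≤-by η 0≤η refl) s+η≤1
    ∣z∣²+η≤1 : (x * x + y * y) + η ≤ 1ℚ
    ∣z∣²+η≤1 = begin
      (x * x + y * y) + η           ≤⟨ +-monoˡ-≤ η (<⇒≤ (q<[sqrtApprox+mesh]² (x * x + y * y) n)) ⟩
      s * s + η                     ≤⟨ +-monoˡ-≤ η (*-mono 0≤s ≤-refl 0≤s s≤1) ⟩
      s * 1ℚ + η                    ≡⟨ cong (_+ η) (*-identityʳ s) ⟩
      s + η                         ≤⟨ s+η≤1 ⟩
      1ℚ                            ∎
    e : ∀ A x y η → A + - (x * (x * 1ℚ + - (y * 0ℚ)) + - (y * (x * 0ℚ + y * 1ℚ)))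
                    ≡ η + ((A - 1ℚ) + ((1ℚ - ((x * x + y * y) + η)) + (y * y + y * y)))
    e = solve 4 (λ A x y η →
          A :+ :- (x :* (x :* con 1ℚ :+ :- (y :* con 0ℚ)) :+ :- (y :* (x :* con 0ℚ :+ y :* con 1ℚ)))
          := η :+ ((A :- con 1ℚ) :+ ((con 1ℚ :- ((x :* x :+ y :* y) :+ η)) :+ (y :* y :+ y :* y)))) refl
    η≤u : η ≤ u
    η≤u = ≤-by _ (0≤+ (0≤b-a (1≤odd² k)) (0≤+ (0≤b-a ∣z∣²+η≤1) (0≤+ (0≤p*p y) (0≤p*p y)))) (e A x y η)

{-# OPTIONS --safe #-}
module Submission where

-- Write o = 2n-1. Splitting off the largest summation variable gives
--   (o² - z₀²) Gₙ(c; z) = o² Gₙ₋₁(c; z) + o^(2-c₁) Gₙ(c₂, …; z₁, …),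
-- and the right-hand side of the theorem obeys the same recursion: o² - z₀² is
-- (o² - (2k₀-1)²) + ((2k₀-1)² - z₀²), where the first part lowers n in the binomial
-- coefficient and the second cancels the denominator, after which the sum over k₀ telescopes.
-- For the convergence, the partial sums over the boxes a₀, …, a_d < M obey the recursion up to
-- an error that is geometrically small in M, uniformly on a polydisc. Since the real numbers
-- are sequences of rationals with pointwise operations, all of this takes place over ℚ(i), at
-- each index of these sequences.

open import Defs
open import Algebra.Bundles using (CommutativeRing)
open import Algebra.Bundles.Raw using (RawSemiring)
open import Algebra.Core using (Op₁; Op₂)
import Algebra.Definitions.RawSemiring as RawSemiringDefinitions
import Algebra.Properties.Semiring.Exp as Exp
import Algebra.Solver.Ring.AlmostCommutativeRing as AlmostCommutativeRing
import Algebra.Solver.Ring.Simple as SimpleSolver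
open import Algebra.Structures using (IsCommutativeRing)
open import Data.Bool using (if_then_else_)
open import Data.Fin using (Fin; zero; suc; inject₁)
open import Data.Integer using (+_; 1ℤ) renaming (_-_ to _-ℤ_)
import Data.Integer as ℤ
import Data.Integer.Properties as ℤ
open import Data.List as List using (List; replicate; []; _∷_; _++_; upTo)
open import Data.List.Membership.Propositional using (_∈_)
open import Data.List.Membership.Propositional.Properties using (∈-cartesianProductWith⁺; ∈-upTo⁺; ∈-∃++; ∈-++⁻; ∈-++⁺ˡ; ∈-++⁺ʳ)
import Data.List.Properties as List
open import Data.List.Relation.Binary.Permutation.Propositional using (_↭_; refl; prep; swap; ↭-refl; ↭-trans; ↭⇒↭ₛ) renaming (trans to ↭-step)
open import Data.List.Relation.Binary.Permutation.Propositional.Properties using (shift)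
import Data.List.Relation.Binary.Permutation.Setoid.Properties as Permutationₛ
open import Data.List.Relation.Unary.All as All using ()
open import Data.List.Relation.Unary.AllPairs using ([]; _∷_)
open import Data.List.Relation.Unary.Any using (here; there)
open import Data.List.Relation.Unary.Unique.Propositional using (Unique)
open import Data.List.Relation.Unary.Unique.Propositional.Properties using (cartesianProductWith⁺; upTo⁺)
open import Data.Nat using (ℕ; zero; suc; _+_; _*_; _∸_; _≤_; _<_; _⊔_; s≤s; z≤n)
open import Data.Nat.Combinatorics using (_C_; nCk+nC[k+1]≡[n+1]C[k+1]; k>n⇒nCk≡0)
import Data.Nat.Coprimality as Coprimality
import Data.Nat.Properties as ℕ
import Data.Nat.Solver as ℕ
open import Data.Product using (_×_; _,_; proj₁; proj₂; ∃)
open import Data.Rational using (ℚ; mkℚ; 0ℚ; ½; _/_; 1ℚ) renaming (_+_ to _+ℚ_; _*_ to _*ℚ_; -_ to -ℚ_; _-_ to _-ℚ_; _≤_ to _≤ℚ_; _<_ to _<ℚ_)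
import Data.Rational as ℚ
import Data.Rational.Properties as ℚ
import Data.Rational.Solver as ℚ
open import Data.Sum using (_⊎_; inj₁; inj₂)
open import Data.Vec using (Vec; lookup; []; _∷_; _∷ʳ_)
import Data.Vec as Vec
open import Data.Vec.Properties using (lookup-map; ∷-injective)
open import Function using (_∘_)
open import Level using (0ℓ)
open import Relation.Binary.Definitions using (DecidableEquality)
open import Relation.Binary.PropositionalEquality using (_≡_; _≢_; refl; sym; trans; cong; cong₂; subst; subst₂; module ≡-Reasoning)
import Relation.Binary.PropositionalEquality as ≡
open import Relation.Nullary.Decidable using (Dec; yes; no; dec-true; dec-false)
open import Relation.Nullary.Negation using (¬_; contradiction)

open ℚ-Lemmas

-- The weights of the theorem are tuned to one telescoping mechanism. Once the denominator in k₀ is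
-- gone, k₀ occurs only in the binomial coefficient, in its own weight and in V#, where 2^△ counts
-- equal neighbours once and unequal ones twice. Neighbouring coefficients C(2n-1, n-k) have the
-- ratio (n+k)/(n-k), so suitable multiples f and g of them satisfy g(k) - g(k+1) = f(k) + f(k+1),
-- and adding up such pairs produces just the weights 1, 2, 2, .... The uniformity of the
-- convergence is forced by the reals: at index N of the sequences the series is evaluated at the
-- N-th approximation of z, whereas the finite set in `HasSum` has to be chosen before N. A bound
-- that depends on the point would be useless. Approximations of small index may moreover lie
-- outside the disc, even at a pole, so estimates are claimed only from some index on.

box : ℕ → (d : ℕ) → List (Vec ℕ d)
box M zero    = [] ∷ []
box M (suc d) = List.cartesianProductWith _∷_ (upTo M) (box M d)

-- Finite sums

module Sums {A : Set} {_⊕_ _⊗_ : Op₂ A} {⊖_ : Op₁ A} {𝟘 𝟙 : A}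
            (isCommutativeRing : IsCommutativeRing _≡_ _⊕_ _⊗_ ⊖_ 𝟘 𝟙) where
  open IsCommutativeRing isCommutativeRing
    using (+-assoc; +-comm; +-identityˡ; +-identityʳ; distribˡ; distribʳ; zeroˡ; zeroʳ)
  open ≡-Reasoning

  ∑ : {I : Set} → List I → (I → A) → A
  ∑ xs f = List.foldr (λ x s → f x ⊕ s) 𝟘 xs

  ∑-cong : {I : Set} (xs : List I) {f g : I → A} → (∀ x → f x ≡ g x) → ∑ xs f ≡ ∑ xs g
  ∑-cong []       eq = refl
  ∑-cong (x ∷ xs) eq = cong₂ _⊕_ (eq x) (∑-cong xs eq)

  ∑-++ : {I : Set} (xs ys : List I) (f : I → A) → ∑ (xs ++ ys) f ≡ ∑ xs f ⊕ ∑ ys f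
  ∑-++ []       ys f = sym (+-identityˡ _)
  ∑-++ (x ∷ xs) ys f = trans (cong (f x ⊕_) (∑-++ xs ys f)) (sym (+-assoc _ _ _))

  ∑-map : {I J : Set} (h : I → J) (xs : List I) (f : J → A) → ∑ (List.map h xs) f ≡ ∑ xs (f ∘ h)
  ∑-map h []       f = refl
  ∑-map h (x ∷ xs) f = cong (f (h x) ⊕_) (∑-map h xs f)

  ∑-concatMap : {I J : Set} (h : I → List J) (xs : List I) (f : J → A) →
                ∑ (List.concatMap h xs) f ≡ ∑ xs λ x → ∑ (h x) f
  ∑-concatMap h []       f = refl
  ∑-concatMap h (x ∷ xs) f = trans (∑-++ (h x) _ f) (cong (∑ (h x) f ⊕_) (∑-concatMap h xs f))

  interchange : ∀ a b c d → (a ⊕ b) ⊕ (c ⊕ d) ≡ (a ⊕ c) ⊕ (b ⊕ d)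
  interchange a b c d = begin
    (a ⊕ b) ⊕ (c ⊕ d)  ≡⟨ +-assoc a b _ ⟩
    a ⊕ (b ⊕ (c ⊕ d))  ≡⟨ cong (a ⊕_) (sym (+-assoc b c d)) ⟩
    a ⊕ ((b ⊕ c) ⊕ d)  ≡⟨ cong (λ t → a ⊕ (t ⊕ d)) (+-comm b c) ⟩
    a ⊕ ((c ⊕ b) ⊕ d)  ≡⟨ cong (a ⊕_) (+-assoc c b d) ⟩
    a ⊕ (c ⊕ (b ⊕ d))  ≡⟨ sym (+-assoc a c _) ⟩
    (a ⊕ c) ⊕ (b ⊕ d)  ∎

  ∑-+ : {I : Set} (xs : List I) (f g : I → A) → ∑ xs (λ x → f x ⊕ g x) ≡ ∑ xs f ⊕ ∑ xs g
  ∑-+ []       f g = sym (+-identityˡ 𝟘)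
  ∑-+ (x ∷ xs) f g = trans (cong ((f x ⊕ g x) ⊕_) (∑-+ xs f g)) (interchange _ _ _ _)

  ∑-*ˡ : {I : Set} (xs : List I) (a : A) (f : I → A) → ∑ xs (λ x → a ⊗ f x) ≡ a ⊗ ∑ xs f
  ∑-*ˡ []       a f = sym (zeroʳ a)
  ∑-*ˡ (x ∷ xs) a f = trans (cong ((a ⊗ f x) ⊕_) (∑-*ˡ xs a f)) (sym (distribˡ a _ _))

  ∑-*ʳ : {I : Set} (xs : List I) (a : A) (f : I → A) → ∑ xs (λ x → f x ⊗ a) ≡ ∑ xs f ⊗ a
  ∑-*ʳ []       a f = sym (zeroˡ a)
  ∑-*ʳ (x ∷ xs) a f = trans (cong ((f x ⊗ a) ⊕_) (∑-*ʳ xs a f)) (sym (distribʳ a _ _))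

  ∑-zero : {I : Set} (xs : List I) {f : I → A} → (∀ x → f x ≡ 𝟘) → ∑ xs f ≡ 𝟘
  ∑-zero []       eq = refl
  ∑-zero (x ∷ xs) eq = trans (cong₂ _⊕_ (eq x) (∑-zero xs eq)) (+-identityˡ 𝟘)

  ∑-↭ : {I : Set} {xs ys : List I} (f : I → A) → xs ↭ ys → ∑ xs f ≡ ∑ ys f
  ∑-↭ f refl = refl
  ∑-↭ f (prep x p) = cong (f x ⊕_) (∑-↭ f p)
  ∑-↭ f (swap {xs} {ys} x y p) = begin
    f x ⊕ (f y ⊕ ∑ xs f)  ≡⟨ sym (+-assoc _ _ _) ⟩
    (f x ⊕ f y) ⊕ ∑ xs f  ≡⟨ cong₂ _⊕_ (+-comm _ _) (∑-↭ f p) ⟩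
    (f y ⊕ f x) ⊕ ∑ ys f  ≡⟨ +-assoc _ _ _ ⟩
    f y ⊕ (f x ⊕ ∑ ys f)  ∎
  ∑-↭ f (↭-step p q) = trans (∑-↭ f p) (∑-↭ f q)

  ∑-upTo-last : ∀ n (f : ℕ → A) → ∑ (upTo (suc n)) f ≡ ∑ (upTo n) f ⊕ f n
  ∑-upTo-last n f = begin
    ∑ (upTo (suc n)) f         ≡⟨ cong (λ xs → ∑ xs f) (sym (List.upTo-∷ʳ n)) ⟩
    ∑ (upTo n ++ n ∷ []) f     ≡⟨ ∑-++ (upTo n) (n ∷ []) f ⟩
    ∑ (upTo n) f ⊕ (f n ⊕ 𝟘)   ≡⟨ cong (∑ (upTo n) f ⊕_) (+-identityʳ (f n)) ⟩
    ∑ (upTo n) f ⊕ f n         ∎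

  ∑-upTo-first : ∀ n (f : ℕ → A) → ∑ (upTo (suc n)) f ≡ f 0 ⊕ ∑ (upTo n) (f ∘ suc)
  ∑-upTo-first n f = cong (f 0 ⊕_) (trans (cong (λ xs → ∑ xs f) (sym (List.map-upTo suc n))) (∑-map suc (upTo n) f))

  ∑-upTo-cong : ∀ n {f g : ℕ → A} → (∀ i → i < n → f i ≡ g i) → ∑ (upTo n) f ≡ ∑ (upTo n) g
  ∑-upTo-cong zero    eq = refl
  ∑-upTo-cong (suc n) {f} {g} eq = begin
    ∑ (upTo (suc n)) f   ≡⟨ ∑-upTo-last n f ⟩
    ∑ (upTo n) f ⊕ f n   ≡⟨ cong₂ _⊕_ (∑-upTo-cong n λ i i<n → eq i (ℕ.m≤n⇒m≤1+n i<n)) (eq n ℕ.≤-refl) ⟩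
    ∑ (upTo n) g ⊕ g n   ≡⟨ sym (∑-upTo-last n g) ⟩
    ∑ (upTo (suc n)) g   ∎

  -- Exchanges the order of summation over l ≤ k < n. The inner index is the offset i = k - l
  -- because the binomial sums below all start at k = l.
  ∑-triangle : ∀ n (f : ℕ → ℕ → A) →
    ∑ (upTo n) (λ k → ∑ (upTo (suc k)) (f k)) ≡ ∑ (upTo n) (λ l → ∑ (upTo (n ∸ l)) λ i → f (l + i) l)
  ∑-triangle zero    f = refl
  ∑-triangle (suc n) f = begin
    ∑ (upTo (suc n)) (λ k → ∑ (upTo (suc k)) (f k))
      ≡⟨ ∑-upTo-last n _ ⟩
    ∑ (upTo n) (λ k → ∑ (upTo (suc k)) (f k)) ⊕ ∑ (upTo (suc n)) (f n)
      ≡⟨ cong₂ _⊕_ (∑-triangle n f) (∑-upTo-last n (f n)) ⟩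
    ∑ (upTo n) (λ l → column n l) ⊕ (∑ (upTo n) (f n) ⊕ f n n)
      ≡⟨ sym (+-assoc _ _ _) ⟩
    (∑ (upTo n) (λ l → column n l) ⊕ ∑ (upTo n) (f n)) ⊕ f n n
      ≡⟨ cong₂ _⊕_ (sym (∑-+ (upTo n) _ _)) (sym corner) ⟩
    ∑ (upTo n) (λ l → column n l ⊕ f n l) ⊕ column (suc n) n
      ≡⟨ cong (_⊕ column (suc n) n) (∑-upTo-cong n λ l l<n → sym (extend l (ℕ.<⇒≤ l<n))) ⟩
    ∑ (upTo n) (λ l → column (suc n) l) ⊕ column (suc n) n
      ≡⟨ sym (∑-upTo-last n _) ⟩
    ∑ (upTo (suc n)) (λ l → column (suc n) l) ∎
    where
    column : ℕ → ℕ → A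
    column n l = ∑ (upTo (n ∸ l)) λ i → f (l + i) l
    extend : ∀ l → l ≤ n → column (suc n) l ≡ column n l ⊕ f n l
    extend l l≤n = begin
      ∑ (upTo (suc n ∸ l)) (λ i → f (l + i) l)
        ≡⟨ cong (λ m → ∑ (upTo m) λ i → f (l + i) l) (ℕ.+-∸-assoc 1 l≤n) ⟩
      ∑ (upTo (suc (n ∸ l))) (λ i → f (l + i) l)
        ≡⟨ ∑-upTo-last (n ∸ l) _ ⟩
      column n l ⊕ f (l + (n ∸ l)) l
        ≡⟨ cong (λ m → column n l ⊕ f m l) (ℕ.m+[n∸m]≡n l≤n) ⟩
      column n l ⊕ f n l ∎
    corner : column (suc n) n ≡ f n n
    corner = begin
      column (suc n) n    ≡⟨ extend n ℕ.≤-refl ⟩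
      column n n ⊕ f n n  ≡⟨ cong (λ m → ∑ (upTo m) (λ i → f (n + i) n) ⊕ f n n) (ℕ.n∸n≡0 n) ⟩
      𝟘 ⊕ f n n           ≡⟨ +-identityˡ _ ⟩
      f n n               ∎

  ∑-chains : ∀ k m r (f : Vec ℕ (suc r) → A) →
    ∑ (chains k m (suc r)) f ≡ ∑ (upTo (suc k ∸ m)) λ i → ∑ (chains (m + i) m r) λ l → f (m + i ∷ l)
  ∑-chains k m r f = begin
    ∑ (chains k m (suc r)) f
      ≡⟨ ∑-concatMap (λ l → List.map (l ∷_) (chains l m r)) (List.map (λ i → m + i) (upTo (suc k ∸ m))) f ⟩
    ∑ (List.map (λ i → m + i) (upTo (suc k ∸ m))) (λ l → ∑ (List.map (l ∷_) (chains l m r)) f)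
      ≡⟨ ∑-map (λ i → m + i) (upTo (suc k ∸ m)) _ ⟩
    ∑ (upTo (suc k ∸ m)) (λ i → ∑ (List.map (m + i ∷_) (chains (m + i) m r)) f)
      ≡⟨ ∑-cong (upTo (suc k ∸ m)) (λ i → ∑-map (m + i ∷_) (chains (m + i) m r) f) ⟩
    ∑ (upTo (suc k ∸ m)) (λ i → ∑ (chains (m + i) m r) λ l → f (m + i ∷ l)) ∎

  ∑-box : ∀ M d (f : Vec ℕ (suc d) → A) → ∑ (box M (suc d)) f ≡ ∑ (upTo M) λ a → ∑ (box M d) λ as → f (a ∷ as)
  ∑-box M d f = outer (upTo M)
    where
    outer : ∀ xs → ∑ (List.cartesianProductWith _∷_ xs (box M d)) f ≡ ∑ xs λ a → ∑ (box M d) λ as → f (a ∷ as)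
    outer []       = refl
    outer (x ∷ xs) = trans (∑-++ (List.map (x ∷_) (box M d)) _ f) (cong₂ _⊕_ (∑-map (x ∷_) (box M d) f) (outer xs))

-- Gaussian rationals

record ℚ[i] : Set where
  constructor _+i*_
  field
    ℜ ℑ : ℚ

open ℚ[i]

infixl 6 _+ᵍ_ _-ᵍ_
infixl 7 _*ᵍ_
infix  8 -ᵍ_

_+ᵍ_ _*ᵍ_ : ℚ[i] → ℚ[i] → ℚ[i]
w +ᵍ z = (ℜ w +ℚ ℜ z) +i* (ℑ w +ℚ ℑ z)
w *ᵍ z = (ℜ w *ℚ ℜ z +ℚ -ℚ (ℑ w *ℚ ℑ z)) +i* (ℜ w *ℚ ℑ z +ℚ ℑ w *ℚ ℜ z)

-ᵍ_ : ℚ[i] → ℚ[i]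
-ᵍ w = (-ℚ ℜ w) +i* (-ℚ ℑ w)

_-ᵍ_ : ℚ[i] → ℚ[i] → ℚ[i]
w -ᵍ z = w +ᵍ -ᵍ z

fromℚ : ℚ → ℚ[i]
fromℚ q = q +i* 0ℚ

0ᵍ 1ᵍ : ℚ[i]
0ᵍ = fromℚ 0ℚ
1ᵍ = fromℚ 1ℚ

module GaussianLaws where
  open ℚ.+-*-Solver

  +ᵍ-assoc : ∀ u v w → (u +ᵍ v) +ᵍ w ≡ u +ᵍ (v +ᵍ w)
  +ᵍ-assoc (a +i* b) (c +i* d) (e +i* f) = cong₂ _+i*_ (ℚ.+-assoc a c e) (ℚ.+-assoc b d f)

  +ᵍ-comm : ∀ u v → u +ᵍ v ≡ v +ᵍ u
  +ᵍ-comm (a +i* b) (c +i* d) = cong₂ _+i*_ (ℚ.+-comm a c) (ℚ.+-comm b d)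

  +ᵍ-identityˡ : ∀ u → 0ᵍ +ᵍ u ≡ u
  +ᵍ-identityˡ (a +i* b) = cong₂ _+i*_ (ℚ.+-identityˡ a) (ℚ.+-identityˡ b)

  +ᵍ-inverseˡ : ∀ u → -ᵍ u +ᵍ u ≡ 0ᵍ
  +ᵍ-inverseˡ (a +i* b) = cong₂ _+i*_ (ℚ.+-inverseˡ a) (ℚ.+-inverseˡ b)

  *ᵍ-assoc : ∀ u v w → (u *ᵍ v) *ᵍ w ≡ u *ᵍ (v *ᵍ w)
  *ᵍ-assoc (a +i* b) (c +i* d) (e +i* f) = cong₂ _+i*_
    (solve 6 (λ a b c d e f → (a :* c :+ :- (b :* d)) :* e :+ :- ((a :* d :+ b :* c) :* f)
       := a :* (c :* e :+ :- (d :* f)) :+ :- (b :* (c :* f :+ d :* e))) refl a b c d e f)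
    (solve 6 (λ a b c d e f → (a :* c :+ :- (b :* d)) :* f :+ (a :* d :+ b :* c) :* e
       := a :* (c :* f :+ d :* e) :+ b :* (c :* e :+ :- (d :* f))) refl a b c d e f)

  *ᵍ-comm : ∀ u v → u *ᵍ v ≡ v *ᵍ u
  *ᵍ-comm (a +i* b) (c +i* d) = cong₂ _+i*_
    (solve 4 (λ a b c d → a :* c :+ :- (b :* d) := c :* a :+ :- (d :* b)) refl a b c d)
    (solve 4 (λ a b c d → a :* d :+ b :* c := c :* b :+ d :* a) refl a b c d)

  *ᵍ-identityˡ : ∀ u → 1ᵍ *ᵍ u ≡ u
  *ᵍ-identityˡ (a +i* b) = cong₂ _+i*_
    (solve 2 (λ a b → con 1ℚ :* a :+ :- (con 0ℚ :* b) := a) refl a b)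
    (solve 2 (λ a b → con 1ℚ :* b :+ con 0ℚ :* a := b) refl a b)

  distribʳ : ∀ u v w → (v +ᵍ w) *ᵍ u ≡ v *ᵍ u +ᵍ w *ᵍ u
  distribʳ (a +i* b) (c +i* d) (e +i* f) = cong₂ _+i*_
    (solve 6 (λ a b c d e f → (c :+ e) :* a :+ :- ((d :+ f) :* b)
       := (c :* a :+ :- (d :* b)) :+ (e :* a :+ :- (f :* b))) refl a b c d e f)
    (solve 6 (λ a b c d e f → (c :+ e) :* b :+ (d :+ f) :* a
       := (c :* b :+ d :* a) :+ (e :* b :+ f :* a)) refl a b c d e f)

open GaussianLaws

ᵍ-isCommutativeRing : IsCommutativeRing _≡_ _+ᵍ_ _*ᵍ_ (λ u → -ᵍ u) 0ᵍ 1ᵍ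
ᵍ-isCommutativeRing = record
  { isRing = record
    { +-isAbelianGroup = record
      { isGroup = record
        { isMonoid = record
          { isSemigroup = record
            { isMagma = ≡.isMagma _+ᵍ_
            ; assoc   = +ᵍ-assoc
            }
          ; identity = +ᵍ-identityˡ , λ u → trans (+ᵍ-comm u 0ᵍ) (+ᵍ-identityˡ u)
          }
        ; inverse = +ᵍ-inverseˡ , λ u → trans (+ᵍ-comm u (-ᵍ u)) (+ᵍ-inverseˡ u)
        ; ⁻¹-cong = cong (λ u → -ᵍ u)
        }
      ; comm = +ᵍ-comm
      }
    ; *-cong     = cong₂ _*ᵍ_
    ; *-assoc    = *ᵍ-assoc
    ; *-identity = *ᵍ-identityˡ , λ u → trans (*ᵍ-comm u 1ᵍ) (*ᵍ-identityˡ u)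
    ; distrib    = (λ u v w → trans (*ᵍ-comm u (v +ᵍ w))
                      (trans (distribʳ u v w) (cong₂ _+ᵍ_ (*ᵍ-comm v u) (*ᵍ-comm w u)))) , distribʳ
    }
  ; *-comm = *ᵍ-comm
  }

ᵍ-commutativeRing : CommutativeRing 0ℓ 0ℓ
ᵍ-commutativeRing = record { isCommutativeRing = ᵍ-isCommutativeRing }

infix 4 _≟ᵍ_

_≟ᵍ_ : DecidableEquality ℚ[i]
(a +i* b) ≟ᵍ (c +i* d) with a ℚ.≟ c | b ℚ.≟ d
... | yes refl | yes refl = yes refl
... | no a≢c   | _        = no λ { refl → a≢c refl }
... | _        | no b≢d   = no λ { refl → b≢d refl }

module ᵍ-Solver = SimpleSolver (AlmostCommutativeRing.fromCommutativeRing ᵍ-commutativeRing) _≟ᵍ_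

module ∑ℚ = Sums ℚ.+-*-isCommutativeRing
module ∑ᵍ = Sums ᵍ-isCommutativeRing
open ∑ᵍ using () renaming (∑ to ∑ᵍ)

ᵍ-rawSemiring : RawSemiring 0ℓ 0ℓ
ᵍ-rawSemiring = record
  { Carrier = ℚ[i] ; _≈_ = _≡_ ; _+_ = _+ᵍ_ ; _*_ = _*ᵍ_ ; 0# = 0ᵍ ; 1# = 1ᵍ }

open RawSemiringDefinitions ᵍ-rawSemiring using () renaming (_^_ to _^ᵍ_; product to ∏ᵍ)

fromℚ-+ : ∀ p q → fromℚ (p +ℚ q) ≡ fromℚ p +ᵍ fromℚ q
fromℚ-+ p q = cong ((p +ℚ q) +i*_) (sym (ℚ.+-identityˡ 0ℚ))

fromℚ-* : ∀ p q → fromℚ (p *ℚ q) ≡ fromℚ p *ᵍ fromℚ q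
fromℚ-* p q = cong₂ _+i*_
  (solve 2 (λ p q → p :* q := p :* q :+ :- (con 0ℚ :* con 0ℚ)) refl p q)
  (solve 2 (λ p q → con 0ℚ := p :* con 0ℚ :+ con 0ℚ :* q) refl p q)
  where open ℚ.+-*-Solver

fromℚ-∑ : {I : Set} (xs : List I) (f : I → ℚ) → fromℚ (∑ℚ xs f) ≡ ∑ᵍ xs (λ x → fromℚ (f x))
fromℚ-∑ []       f = refl
fromℚ-∑ (x ∷ xs) f = trans (fromℚ-+ (f x) (∑ℚ xs f)) (cong (fromℚ (f x) +ᵍ_) (fromℚ-∑ xs f))

norm² : ℚ[i] → ℚ
norm² w = ℜ w *ℚ ℜ w +ℚ ℑ w *ℚ ℑ w

-- Total, because `⁻¹` sends 0 to 0. This is what `recipᶜ` computes at each index, whichever proof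
-- of apartness it is given.
conj/norm² : ℚ[i] → ℚ[i]
conj/norm² w = (ℜ w *ℚ norm² w ⁻¹) +i* ((-ℚ ℑ w) *ℚ norm² w ⁻¹)

*-conj/norm² : ∀ w → 0ℚ <ℚ norm² w → w *ᵍ conj/norm² w ≡ 1ᵍ
*-conj/norm² w@(x +i* y) 0<N = cong₂ _+i*_
  (trans (solve 3 (λ x y i → x :* (x :* i) :+ :- (y :* (:- y :* i)) := (x :* x :+ y :* y) :* i) refl x y (norm² w ⁻¹))
         (⁻¹-inverse (norm² w) 0<N))
  (solve 3 (λ x y i → x :* (:- y :* i) :+ y :* (x :* i) := con 0ℚ) refl x y (norm² w ⁻¹))
  where open ℚ.+-*-Solver

-- Natural numbers and odd numbers as rationals

module ℚ-Exp = Exp (CommutativeRing.semiring ℚ.+-*-commutativeRing)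

⟪_⟫ : ℕ → ℚ
⟪ n ⟫ = + n / 1

/1≡ : ∀ i → i / 1 ≡ mkℚ i 0 (Coprimality.sym (Coprimality.1-coprimeTo ℤ.∣ i ∣))
/1≡ i = ℚ.fromℚᵘ-toℚᵘ (mkℚ i 0 (Coprimality.sym (Coprimality.1-coprimeTo ℤ.∣ i ∣)))

/1-+ : ∀ i j → (i ℤ.+ j) / 1 ≡ i / 1 +ℚ j / 1
/1-+ i j = sym (trans (cong₂ _+ℚ_ (/1≡ i) (/1≡ j))
  (cong (_/ 1) (cong₂ ℤ._+_ (ℤ.*-identityʳ i) (ℤ.*-identityʳ j))))

/1-* : ∀ i j → (i ℤ.* j) / 1 ≡ (i / 1) *ℚ (j / 1)
/1-* i j = sym (cong₂ _*ℚ_ (/1≡ i) (/1≡ j))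

⟪⟫-+ : ∀ m n → ⟪ m + n ⟫ ≡ ⟪ m ⟫ +ℚ ⟪ n ⟫
⟪⟫-+ m n = /1-+ (+ m) (+ n)

⟪⟫-* : ∀ m n → ⟪ m * n ⟫ ≡ ⟪ m ⟫ *ℚ ⟪ n ⟫
⟪⟫-* m n = trans (cong (_/ 1) (ℤ.pos-* m n)) (/1-* (+ m) (+ n))

⟪suc⟫ : ∀ n → ⟪ suc n ⟫ ≡ 1ℚ +ℚ ⟪ n ⟫
⟪suc⟫ n = ⟪⟫-+ 1 n

odd≡ : ∀ k → odd k ≡ ⟪ 2 ⟫ *ℚ ⟪ k ⟫ -ℚ 1ℚ
odd≡ k = trans (/1-+ (+ (2 * k)) (ℤ.- 1ℤ)) (cong (_+ℚ -ℚ 1ℚ) (⟪⟫-* 2 k))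

0≤⟪⟫ : ∀ n → 0ℚ ≤ℚ ⟪ n ⟫
0≤⟪⟫ n = subst (0ℚ ≤ℚ_) (sym (/1≡ (+ n))) (ℚ.nonNegative⁻¹ _)

0<⟪suc⟫ : ∀ n → 0ℚ <ℚ ⟪ suc n ⟫
0<⟪suc⟫ n = subst (0ℚ <ℚ_) (sym (/1≡ (+ suc n))) (ℚ.positive⁻¹ _)

odd-suc : ∀ k → odd (suc k) ≡ 1ℚ +ℚ ⟪ 2 ⟫ *ℚ ⟪ k ⟫
odd-suc k = trans (odd≡ (suc k)) (trans (cong (λ u → ⟪ 2 ⟫ *ℚ u -ℚ 1ℚ) (⟪suc⟫ k))
  (solve 1 (λ k → con ⟪ 2 ⟫ :* (con 1ℚ :+ k) :- con 1ℚ := con 1ℚ :+ con ⟪ 2 ⟫ :* k) refl ⟪ k ⟫))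
  where open ℚ.+-*-Solver

1≤odd : ∀ k → 1ℚ ≤ℚ odd (suc k)
1≤odd k = ≤-by (⟪ 2 ⟫ *ℚ ⟪ k ⟫) (0≤* (0≤⟪⟫ 2) (0≤⟪⟫ k)) (odd-suc k)

0<odd : ∀ k → 0ℚ <ℚ odd (suc k)
0<odd k = ℚ.<-≤-trans 0<1 (1≤odd k)

odd-inverse : ∀ k → odd (suc k) *ℚ odd (suc k) ⁻¹ ≡ 1ℚ
odd-inverse k = ⁻¹-inverse (odd (suc k)) (0<odd k)

-- For deriving an equation as a linear combination of others.

drop-null : ∀ {l r} x c → l ≡ r → x +ℚ c *ℚ (l -ℚ r) ≡ x
drop-null {l} x c refl = solve 3 (λ x c l → x :+ c :* (l :- l) := x) refl x c l
  where open ℚ.+-*-Solver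

*ℚ-cancelˡ : ∀ {x y} c → 0ℚ <ℚ c → c *ℚ x ≡ c *ℚ y → x ≡ y
*ℚ-cancelˡ {x} {y} c 0<c eq = begin
  x                    ≡⟨ isolate x ⟩
  c ⁻¹ *ℚ (c *ℚ x)     ≡⟨ cong (c ⁻¹ *ℚ_) eq ⟩
  c ⁻¹ *ℚ (c *ℚ y)     ≡⟨ sym (isolate y) ⟩
  y                    ∎
  where
  open ≡-Reasoning
  open ℚ.+-*-Solver
  isolate : ∀ x → x ≡ c ⁻¹ *ℚ (c *ℚ x)
  isolate x = sym (begin
    c ⁻¹ *ℚ (c *ℚ x)   ≡⟨ solve 3 (λ c i x → i :* (c :* x) := (c :* i) :* x) refl c (c ⁻¹) x ⟩
    (c *ℚ c ⁻¹) *ℚ x   ≡⟨ cong (_*ℚ x) (⁻¹-inverse c 0<c) ⟩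
    1ℚ *ℚ x            ≡⟨ ℚ.*-identityˡ x ⟩
    x                  ∎)

-- Binomial coefficients

C-absorb : ∀ n k → suc k * (suc n C suc k) ≡ suc n * (n C k)
C-absorb zero    zero    = refl
C-absorb zero    (suc k) = trans (cong (suc (suc k) *_) (k>n⇒nCk≡0 {1} {suc (suc k)} (s≤s (s≤s z≤n))))
                             (trans (ℕ.*-zeroʳ (suc (suc k))) (sym (cong (1 *_) (k>n⇒nCk≡0 {0} {suc k} (s≤s z≤n)))))
C-absorb (suc n) zero    = begin
  1 * (suc (suc n) C 1)                ≡⟨ cong (1 *_) (sym (nCk+nC[k+1]≡[n+1]C[k+1] (suc n) 0)) ⟩
  1 * ((suc n C 0) + (suc n C 1))      ≡⟨ cong (λ t → 1 * ((suc n C 0) + t)) (trans (sym (ℕ.*-identityˡ (suc n C 1))) (C-absorb n 0)) ⟩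
  1 * (1 + suc n * 1)                  ≡⟨ solve 1 (λ n → con 1 :* (con 1 :+ n :* con 1) := (con 1 :+ n) :* con 1) refl (suc n) ⟩
  suc (suc n) * 1                      ∎
  where
  open ≡-Reasoning
  open ℕ.+-*-Solver
C-absorb (suc n) (suc k) = begin
  suc (suc k) * (suc (suc n) C suc (suc k))
    ≡⟨ cong (suc (suc k) *_) (sym (nCk+nC[k+1]≡[n+1]C[k+1] (suc n) (suc k))) ⟩
  suc (suc k) * (a + b)
    ≡⟨ solve 3 (λ k a b → (con 1 :+ k) :* (a :+ b) := a :+ k :* a :+ (con 1 :+ k) :* b) refl (suc k) a b ⟩
  a + suc k * a + suc (suc k) * b
    ≡⟨ cong₂ (λ s t → a + s + t) (C-absorb n k) (C-absorb n (suc k)) ⟩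
  a + suc n * (n C k) + suc n * (n C suc k)
    ≡⟨ solve 4 (λ n a c d → a :+ n :* c :+ n :* d := a :+ n :* (c :+ d)) refl (suc n) a (n C k) (n C suc k) ⟩
  a + suc n * ((n C k) + (n C suc k))
    ≡⟨ cong (λ t → a + suc n * t) (nCk+nC[k+1]≡[n+1]C[k+1] n k) ⟩
  suc (suc n) * a ∎
  where
  open ≡-Reasoning
  open ℕ.+-*-Solver
  a = suc n C suc k
  b = suc n C suc (suc k)

-- The ratio (n-k)/(k+1) of neighbouring coefficients, in an additive form that avoids truncated
-- subtraction. Adding C(n, k) to both sides turns it into Pascal's rule followed by absorption.
C-ratio : ∀ n k → suc k * (n C suc k) + k * (n C k) ≡ n * (n C k)
C-ratio n k = ℕ.+-cancelˡ-≡ (n C k) _ _ (begin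
  (n C k) + (suc k * (n C suc k) + k * (n C k))
    ≡⟨ solve 3 (λ k a b → a :+ ((con 1 :+ k) :* b :+ k :* a) := (con 1 :+ k) :* (a :+ b)) refl k (n C k) (n C suc k) ⟩
  suc k * ((n C k) + (n C suc k))
    ≡⟨ cong (suc k *_) (nCk+nC[k+1]≡[n+1]C[k+1] n k) ⟩
  suc k * (suc n C suc k)
    ≡⟨ C-absorb n k ⟩
  (n C k) + n * (n C k) ∎)
  where
  open ≡-Reasoning
  open ℕ.+-*-Solver

C-absorbℚ : ∀ n k → (1ℚ +ℚ ⟪ k ⟫) *ℚ ⟪ suc n C suc k ⟫ ≡ (1ℚ +ℚ ⟪ n ⟫) *ℚ ⟪ n C k ⟫
C-absorbℚ n k = begin
  (1ℚ +ℚ ⟪ k ⟫) *ℚ ⟪ suc n C suc k ⟫  ≡⟨ cong (_*ℚ ⟪ suc n C suc k ⟫) (sym (⟪suc⟫ k)) ⟩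
  ⟪ suc k ⟫ *ℚ ⟪ suc n C suc k ⟫      ≡⟨ sym (⟪⟫-* (suc k) (suc n C suc k)) ⟩
  ⟪ suc k * (suc n C suc k) ⟫         ≡⟨ cong ⟪_⟫ (C-absorb n k) ⟩
  ⟪ suc n * (n C k) ⟫                 ≡⟨ ⟪⟫-* (suc n) (n C k) ⟩
  ⟪ suc n ⟫ *ℚ ⟪ n C k ⟫              ≡⟨ cong (_*ℚ ⟪ n C k ⟫) (⟪suc⟫ n) ⟩
  (1ℚ +ℚ ⟪ n ⟫) *ℚ ⟪ n C k ⟫          ∎
  where open ≡-Reasoning

C-ratioℚ : ∀ n k → (1ℚ +ℚ ⟪ k ⟫) *ℚ ⟪ n C suc k ⟫ ≡ (⟪ n ⟫ -ℚ ⟪ k ⟫) *ℚ ⟪ n C k ⟫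
C-ratioℚ n k = begin
  (1ℚ +ℚ ⟪ k ⟫) *ℚ ⟪ n C suc k ⟫
    ≡⟨ solve 4 (λ k a b n → (con 1ℚ :+ k) :* b := (n :- k) :* a :+ con 1ℚ :* (((con 1ℚ :+ k) :* b :+ k :* a) :- n :* a))
         refl ⟪ k ⟫ ⟪ n C k ⟫ ⟪ n C suc k ⟫ ⟪ n ⟫ ⟩
  (⟪ n ⟫ -ℚ ⟪ k ⟫) *ℚ ⟪ n C k ⟫ +ℚ 1ℚ *ℚ (((1ℚ +ℚ ⟪ k ⟫) *ℚ ⟪ n C suc k ⟫ +ℚ ⟪ k ⟫ *ℚ ⟪ n C k ⟫) -ℚ ⟪ n ⟫ *ℚ ⟪ n C k ⟫)
    ≡⟨ drop-null ((⟪ n ⟫ -ℚ ⟪ k ⟫) *ℚ ⟪ n C k ⟫) 1ℚ ratio ⟩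
  (⟪ n ⟫ -ℚ ⟪ k ⟫) *ℚ ⟪ n C k ⟫ ∎
  where
  open ≡-Reasoning
  open ℚ.+-*-Solver
  ratio : (1ℚ +ℚ ⟪ k ⟫) *ℚ ⟪ n C suc k ⟫ +ℚ ⟪ k ⟫ *ℚ ⟪ n C k ⟫ ≡ ⟪ n ⟫ *ℚ ⟪ n C k ⟫
  ratio = begin
    (1ℚ +ℚ ⟪ k ⟫) *ℚ ⟪ n C suc k ⟫ +ℚ ⟪ k ⟫ *ℚ ⟪ n C k ⟫
      ≡⟨ cong₂ _+ℚ_ (trans (cong (_*ℚ ⟪ n C suc k ⟫) (sym (⟪suc⟫ k))) (sym (⟪⟫-* (suc k) (n C suc k)))) (sym (⟪⟫-* k (n C k))) ⟩
    ⟪ suc k * (n C suc k) ⟫ +ℚ ⟪ k * (n C k) ⟫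
      ≡⟨ sym (⟪⟫-+ (suc k * (n C suc k)) (k * (n C k))) ⟩
    ⟪ suc k * (n C suc k) + k * (n C k) ⟫
      ≡⟨ cong ⟪_⟫ (C-ratio n k) ⟩
    ⟪ n * (n C k) ⟫
      ≡⟨ ⟪⟫-* n (n C k) ⟩
    ⟪ n ⟫ *ℚ ⟪ n C k ⟫ ∎

bin : ℕ → ℕ → ℚ
bin n k = ⟪ (2 * n ∸ 1) C (n ∸ k) ⟫

⟪2*suc∸1⟫ : ∀ n → ⟪ 2 * suc n ∸ 1 ⟫ ≡ 1ℚ +ℚ ⟪ 2 ⟫ *ℚ ⟪ n ⟫
⟪2*suc∸1⟫ n = trans (cong ⟪_⟫ (solve 1 (λ n → n :+ (con 1 :+ (n :+ con 0)) := con 1 :+ con 2 :* n) refl n))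
                   (trans (⟪suc⟫ (2 * n)) (cong (1ℚ +ℚ_) (⟪⟫-* 2 n)))
  where open ℕ.+-*-Solver

C-step : ∀ n k j → n ≡ suc (k + j) →
  (⟪ n ⟫ -ℚ ⟪ k ⟫) *ℚ ⟪ (2 * n ∸ 1) C suc j ⟫ ≡ (⟪ n ⟫ +ℚ ⟪ k ⟫) *ℚ ⟪ (2 * n ∸ 1) C j ⟫
C-step n k j n≡1+k+j = begin
  (⟪ n ⟫ -ℚ ⟪ k ⟫) *ℚ ⟪ N C suc j ⟫
    ≡⟨ cong (_*ℚ ⟪ N C suc j ⟫) (trans (cong (_-ℚ ⟪ k ⟫) n≡) (solve 2 (λ k j → (con 1ℚ :+ (k :+ j)) :- k := con 1ℚ :+ j) refl ⟪ k ⟫ ⟪ j ⟫)) ⟩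
  (1ℚ +ℚ ⟪ j ⟫) *ℚ ⟪ N C suc j ⟫
    ≡⟨ C-ratioℚ N j ⟩
  (⟪ N ⟫ -ℚ ⟪ j ⟫) *ℚ ⟪ N C j ⟫
    ≡⟨ cong (_*ℚ ⟪ N C j ⟫) factor ⟩
  (⟪ n ⟫ +ℚ ⟪ k ⟫) *ℚ ⟪ N C j ⟫ ∎
  where
  open ≡-Reasoning
  open ℚ.+-*-Solver
  N = 2 * n ∸ 1
  n≡ : ⟪ n ⟫ ≡ 1ℚ +ℚ (⟪ k ⟫ +ℚ ⟪ j ⟫)
  n≡ = trans (trans (cong ⟪_⟫ n≡1+k+j) (⟪suc⟫ (k + j))) (cong (1ℚ +ℚ_) (⟪⟫-+ k j))
  factor : ⟪ N ⟫ -ℚ ⟪ j ⟫ ≡ ⟪ n ⟫ +ℚ ⟪ k ⟫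
  factor = begin
    ⟪ N ⟫ -ℚ ⟪ j ⟫
      ≡⟨ cong (_-ℚ ⟪ j ⟫) (trans (trans (cong (λ t → ⟪ 2 * t ∸ 1 ⟫) n≡1+k+j) (⟪2*suc∸1⟫ (k + j))) (cong (λ t → 1ℚ +ℚ ⟪ 2 ⟫ *ℚ t) (⟪⟫-+ k j))) ⟩
    (1ℚ +ℚ ⟪ 2 ⟫ *ℚ (⟪ k ⟫ +ℚ ⟪ j ⟫)) -ℚ ⟪ j ⟫
      ≡⟨ solve 2 (λ k j → (con 1ℚ :+ con ⟪ 2 ⟫ :* (k :+ j)) :- j := (con 1ℚ :+ (k :+ j)) :+ k) refl ⟪ k ⟫ ⟪ j ⟫ ⟩
    (1ℚ +ℚ (⟪ k ⟫ +ℚ ⟪ j ⟫)) +ℚ ⟪ k ⟫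
      ≡⟨ cong (_+ℚ ⟪ k ⟫) (sym n≡) ⟩
    ⟪ n ⟫ +ℚ ⟪ k ⟫ ∎

-- This ratio is what makes the binomial sums below telescope.
bin-step : ∀ n k → k < n → (⟪ n ⟫ -ℚ ⟪ k ⟫) *ℚ bin n k ≡ (⟪ n ⟫ +ℚ ⟪ k ⟫) *ℚ bin n (suc k)
bin-step n k k<n = subst (λ i → (⟪ n ⟫ -ℚ ⟪ k ⟫) *ℚ ⟪ (2 * n ∸ 1) C i ⟫ ≡ (⟪ n ⟫ +ℚ ⟪ k ⟫) *ℚ bin n (suc k))
  (sym (ℕ.+-∸-assoc 1 k<n)) (C-step n k (n ∸ suc k) (sym (ℕ.m+[n∸m]≡n k<n)))

prefactor : ℕ → ℚ
prefactor n = ⟪ n * ((2 * n) C n) ⟫ *ℚ (⟪ 2 ⟫ ^ℚ (4 * n ∸ 2)) ⁻¹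

-- The lower index and its complement both grow by one. This is what happens to C(2n-1, n-k) for
-- fixed k, and to the central coefficient C(2n, n), when n grows by one.
C-double-step : ∀ M j →
  ((⟪ M ⟫ +ℚ 1ℚ) -ℚ ⟪ j ⟫) *ℚ ((1ℚ +ℚ ⟪ j ⟫) *ℚ ⟪ suc (suc M) C suc j ⟫)
    ≡ (⟪ M ⟫ +ℚ ⟪ 2 ⟫) *ℚ ((⟪ M ⟫ +ℚ 1ℚ) *ℚ ⟪ M C j ⟫)
C-double-step M j = begin
  (μ +ℚ 1ℚ -ℚ ι) *ℚ ((1ℚ +ℚ ι) *ℚ ⟪ suc (suc M) C suc j ⟫)
    ≡⟨ cong ((μ +ℚ 1ℚ -ℚ ι) *ℚ_) (trans (C-absorbℚ (suc M) j) (cong (λ t → (1ℚ +ℚ t) *ℚ b) (⟪suc⟫ M))) ⟩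
  (μ +ℚ 1ℚ -ℚ ι) *ℚ ((1ℚ +ℚ (1ℚ +ℚ μ)) *ℚ b)
    ≡⟨ solve 3 (λ μ ι b → (μ :+ con 1ℚ :- ι) :* ((con 1ℚ :+ (con 1ℚ :+ μ)) :* b)
         := (μ :+ con ⟪ 2 ⟫) :* (((con 1ℚ :+ μ) :- ι) :* b)) refl μ ι b ⟩
  (μ +ℚ ⟪ 2 ⟫) *ℚ (((1ℚ +ℚ μ) -ℚ ι) *ℚ b)
    ≡⟨ cong ((μ +ℚ ⟪ 2 ⟫) *ℚ_) (begin
         ((1ℚ +ℚ μ) -ℚ ι) *ℚ b                   ≡⟨ cong (λ t → (t -ℚ ι) *ℚ b) (sym (⟪suc⟫ M)) ⟩
         (⟪ suc M ⟫ -ℚ ι) *ℚ b                   ≡⟨ sym (C-ratioℚ (suc M) j) ⟩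
         (1ℚ +ℚ ι) *ℚ ⟪ suc M C suc j ⟫          ≡⟨ C-absorbℚ M j ⟩
         (1ℚ +ℚ μ) *ℚ ⟪ M C j ⟫                  ≡⟨ cong (_*ℚ ⟪ M C j ⟫) (ℚ.+-comm 1ℚ μ) ⟩
         (μ +ℚ 1ℚ) *ℚ ⟪ M C j ⟫                  ∎) ⟩
  (μ +ℚ ⟪ 2 ⟫) *ℚ ((μ +ℚ 1ℚ) *ℚ ⟪ M C j ⟫) ∎
  where
  open ≡-Reasoning
  open ℚ.+-*-Solver
  μ = ⟪ M ⟫
  ι = ⟪ j ⟫
  b = ⟪ suc M C j ⟫

odd² : ℕ → ℚ
odd² k = odd k *ℚ odd k

-- With n = `suc N`, the difference of squares is (2n+1)² - (2k-1)² = 4 (n+k) (n+1-k), and these are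
-- the factors that `C-double-step` absorbs.
bin-rec : ∀ N k → k ≤ suc N →
  (odd² (suc (suc N)) -ℚ odd² k) *ℚ bin (suc (suc N)) k ≡ ⟪ 8 ⟫ *ℚ ⟪ suc N ⟫ *ℚ odd (suc (suc N)) *ℚ bin (suc N) k
bin-rec N k k≤ = begin
  (odd² (suc (suc N)) -ℚ odd² k) *ℚ bin (suc (suc N)) k
    ≡⟨ cong₂ _*ℚ_ (cong₂ (λ s t → s *ℚ s -ℚ t *ℚ t) odd≡₂ (trans (odd≡ k) (cong (λ t → ⟪ 2 ⟫ *ℚ t -ℚ 1ℚ) κ≡)))
         (cong₂ (λ s t → ⟪ s C t ⟫) 2n∸1 (ℕ.+-∸-assoc 1 k≤)) ⟩
  (o *ℚ o -ℚ κ′ *ℚ κ′) *ℚ x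
    ≡⟨ solve 3 (λ ν ι x →
         let o = con 1ℚ :+ con ⟪ 2 ⟫ :* (con 1ℚ :+ ν)
             κ = con ⟪ 2 ⟫ :* ((con 1ℚ :+ ν) :- ι) :- con 1ℚ
             μ = con 1ℚ :+ con ⟪ 2 ⟫ :* ν
         in (o :* o :- κ :* κ) :* x := con ⟪ 4 ⟫ :* (((μ :+ con 1ℚ) :- ι) :* ((con 1ℚ :+ ι) :* x))) refl ν ι x ⟩
  ⟪ 4 ⟫ *ℚ ((((1ℚ +ℚ ⟪ 2 ⟫ *ℚ ν) +ℚ 1ℚ) -ℚ ι) *ℚ ((1ℚ +ℚ ι) *ℚ x))
    ≡⟨ cong (λ t → ⟪ 4 ⟫ *ℚ (((t +ℚ 1ℚ) -ℚ ι) *ℚ ((1ℚ +ℚ ι) *ℚ x))) (sym (⟪2*suc∸1⟫ N)) ⟩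
  ⟪ 4 ⟫ *ℚ (((⟪ M ⟫ +ℚ 1ℚ) -ℚ ι) *ℚ ((1ℚ +ℚ ι) *ℚ x))
    ≡⟨ cong (⟪ 4 ⟫ *ℚ_) (C-double-step M j) ⟩
  ⟪ 4 ⟫ *ℚ ((⟪ M ⟫ +ℚ ⟪ 2 ⟫) *ℚ ((⟪ M ⟫ +ℚ 1ℚ) *ℚ y))
    ≡⟨ cong (λ t → ⟪ 4 ⟫ *ℚ ((t +ℚ ⟪ 2 ⟫) *ℚ ((t +ℚ 1ℚ) *ℚ y))) (⟪2*suc∸1⟫ N) ⟩
  ⟪ 4 ⟫ *ℚ (((1ℚ +ℚ ⟪ 2 ⟫ *ℚ ν) +ℚ ⟪ 2 ⟫) *ℚ (((1ℚ +ℚ ⟪ 2 ⟫ *ℚ ν) +ℚ 1ℚ) *ℚ y))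
    ≡⟨ solve 2 (λ ν y → con ⟪ 4 ⟫ :* (((con 1ℚ :+ con ⟪ 2 ⟫ :* ν) :+ con ⟪ 2 ⟫) :* (((con 1ℚ :+ con ⟪ 2 ⟫ :* ν) :+ con 1ℚ) :* y))
         := con ⟪ 8 ⟫ :* (con 1ℚ :+ ν) :* (con 1ℚ :+ con ⟪ 2 ⟫ :* (con 1ℚ :+ ν)) :* y) refl ν y ⟩
  ⟪ 8 ⟫ *ℚ (1ℚ +ℚ ν) *ℚ o *ℚ y
    ≡⟨ cong₂ (λ s t → ⟪ 8 ⟫ *ℚ s *ℚ t *ℚ y) (sym (⟪suc⟫ N)) (sym odd≡₂) ⟩
  ⟪ 8 ⟫ *ℚ ⟪ suc N ⟫ *ℚ odd (suc (suc N)) *ℚ bin (suc N) k ∎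
  where
  open ≡-Reasoning
  open ℚ.+-*-Solver
  M = 2 * suc N ∸ 1
  j = suc N ∸ k
  ν = ⟪ N ⟫
  ι = ⟪ j ⟫
  x = ⟪ suc (suc M) C suc j ⟫
  y = ⟪ M C j ⟫
  o = 1ℚ +ℚ ⟪ 2 ⟫ *ℚ (1ℚ +ℚ ν)
  κ′ = ⟪ 2 ⟫ *ℚ ((1ℚ +ℚ ν) -ℚ ι) -ℚ 1ℚ
  odd≡₂ : odd (suc (suc N)) ≡ o
  odd≡₂ = trans (odd-suc (suc N)) (cong (λ t → 1ℚ +ℚ ⟪ 2 ⟫ *ℚ t) (⟪suc⟫ N))
  κ≡ : ⟪ k ⟫ ≡ (1ℚ +ℚ ν) -ℚ ι
  κ≡ = begin
    ⟪ k ⟫                  ≡⟨ solve 2 (λ k i → k := (k :+ i) :- i) refl ⟪ k ⟫ ι ⟩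
    (⟪ k ⟫ +ℚ ι) -ℚ ι      ≡⟨ cong (_-ℚ ι) (sym (⟪⟫-+ k j)) ⟩
    ⟪ k + j ⟫ -ℚ ι         ≡⟨ cong (λ t → ⟪ t ⟫ -ℚ ι) (ℕ.m+[n∸m]≡n k≤) ⟩
    ⟪ suc N ⟫ -ℚ ι         ≡⟨ cong (_-ℚ ι) (⟪suc⟫ N) ⟩
    (1ℚ +ℚ ν) -ℚ ι         ∎
  2n∸1 : 2 * suc (suc N) ∸ 1 ≡ suc (suc M)
  2n∸1 = cong suc (ℕ.+-suc N (suc (N + 0)))

C-central-step : ∀ N → ⟪ suc N ⟫ *ℚ ⟪ (2 * suc N) C suc N ⟫ ≡ ⟪ 2 ⟫ *ℚ (odd (suc N) *ℚ ⟪ (2 * N) C N ⟫)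
C-central-step N = *ℚ-cancelˡ ⟪ suc N ⟫ (0<⟪suc⟫ N) (begin
  ⟪ suc N ⟫ *ℚ (⟪ suc N ⟫ *ℚ ⟪ (2 * suc N) C suc N ⟫)
    ≡⟨ cong₂ (λ s t → s *ℚ (s *ℚ ⟪ t C suc N ⟫)) (⟪suc⟫ N) (cong suc (ℕ.+-suc N (N + 0))) ⟩
  (1ℚ +ℚ ν) *ℚ ((1ℚ +ℚ ν) *ℚ x)
    ≡⟨ solve 2 (λ ν x → (con 1ℚ :+ ν) :* ((con 1ℚ :+ ν) :* x)
         := ((con ⟪ 2 ⟫ :* ν :+ con 1ℚ) :- ν) :* ((con 1ℚ :+ ν) :* x)) refl ν x ⟩
  ((⟪ 2 ⟫ *ℚ ν +ℚ 1ℚ) -ℚ ν) *ℚ ((1ℚ +ℚ ν) *ℚ x)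
    ≡⟨ cong (λ t → ((t +ℚ 1ℚ) -ℚ ν) *ℚ ((1ℚ +ℚ ν) *ℚ x)) (sym (⟪⟫-* 2 N)) ⟩
  ((⟪ 2 * N ⟫ +ℚ 1ℚ) -ℚ ν) *ℚ ((1ℚ +ℚ ν) *ℚ x)
    ≡⟨ C-double-step (2 * N) N ⟩
  (⟪ 2 * N ⟫ +ℚ ⟪ 2 ⟫) *ℚ ((⟪ 2 * N ⟫ +ℚ 1ℚ) *ℚ y)
    ≡⟨ cong (λ t → (t +ℚ ⟪ 2 ⟫) *ℚ ((t +ℚ 1ℚ) *ℚ y)) (⟪⟫-* 2 N) ⟩
  (⟪ 2 ⟫ *ℚ ν +ℚ ⟪ 2 ⟫) *ℚ ((⟪ 2 ⟫ *ℚ ν +ℚ 1ℚ) *ℚ y)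
    ≡⟨ solve 2 (λ ν y → (con ⟪ 2 ⟫ :* ν :+ con ⟪ 2 ⟫) :* ((con ⟪ 2 ⟫ :* ν :+ con 1ℚ) :* y)
         := (con 1ℚ :+ ν) :* (con ⟪ 2 ⟫ :* ((con 1ℚ :+ con ⟪ 2 ⟫ :* ν) :* y))) refl ν y ⟩
  (1ℚ +ℚ ν) *ℚ (⟪ 2 ⟫ *ℚ ((1ℚ +ℚ ⟪ 2 ⟫ *ℚ ν) *ℚ y))
    ≡⟨ cong₂ (λ s t → s *ℚ (⟪ 2 ⟫ *ℚ (t *ℚ y))) (sym (⟪suc⟫ N)) (sym (odd-suc N)) ⟩
  ⟪ suc N ⟫ *ℚ (⟪ 2 ⟫ *ℚ (odd (suc N) *ℚ y)) ∎)
  where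
  open ≡-Reasoning
  open ℚ.+-*-Solver
  ν = ⟪ N ⟫
  x = ⟪ suc (suc (2 * N)) C suc N ⟫
  y = ⟪ (2 * N) C N ⟫

0<^ : ∀ {q} → 0ℚ <ℚ q → ∀ n → 0ℚ <ℚ q ^ℚ n
0<^ 0<q zero    = 0<1
0<^ 0<q (suc n) = 0<* 0<q (0<^ 0<q n)

⁻¹-* : ∀ {p q} → 0ℚ <ℚ p → 0ℚ <ℚ q → p *ℚ (p *ℚ q) ⁻¹ ≡ q ⁻¹
⁻¹-* {p} {q} 0<p 0<q = *ℚ-cancelˡ q 0<q (begin
  q *ℚ (p *ℚ (p *ℚ q) ⁻¹)     ≡⟨ solve 3 (λ p q i → q :* (p :* i) := (p :* q) :* i) refl p q ((p *ℚ q) ⁻¹) ⟩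
  (p *ℚ q) *ℚ (p *ℚ q) ⁻¹     ≡⟨ ⁻¹-inverse (p *ℚ q) (0<* 0<p 0<q) ⟩
  1ℚ                          ≡⟨ sym (⁻¹-inverse q 0<q) ⟩
  q *ℚ q ⁻¹                   ∎)
  where
  open ≡-Reasoning
  open ℚ.+-*-Solver

prefactor-rec : ∀ N → ⟪ 8 ⟫ *ℚ ⟪ suc N ⟫ *ℚ prefactor (suc (suc N)) ≡ odd (suc (suc N)) *ℚ prefactor (suc N)
prefactor-rec N = begin
  ⟪ 8 ⟫ *ℚ ν *ℚ prefactor (suc (suc N))
    ≡⟨ cong₂ (λ s t → ⟪ 8 ⟫ *ℚ ν *ℚ (s *ℚ t ⁻¹))
         (trans (⟪⟫-* (suc (suc N)) ((2 * suc (suc N)) C suc (suc N))) (C-central-step (suc N))) power ⟩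
  ⟪ 8 ⟫ *ℚ ν *ℚ ((⟪ 2 ⟫ *ℚ (o *ℚ c)) *ℚ (⟪ 16 ⟫ *ℚ p) ⁻¹)
    ≡⟨ solve 4 (λ ν o c i → con ⟪ 8 ⟫ :* ν :* ((con ⟪ 2 ⟫ :* (o :* c)) :* i) := o :* ((ν :* c) :* (con ⟪ 16 ⟫ :* i)))
         refl ν o c ((⟪ 16 ⟫ *ℚ p) ⁻¹) ⟩
  o *ℚ ((ν *ℚ c) *ℚ (⟪ 16 ⟫ *ℚ (⟪ 16 ⟫ *ℚ p) ⁻¹))
    ≡⟨ cong₂ (λ s t → o *ℚ (s *ℚ t)) (sym (⟪⟫-* (suc N) ((2 * suc N) C suc N))) (⁻¹-* (0<⟪suc⟫ 15) (0<^ (0<⟪suc⟫ 1) (4 * suc N ∸ 2))) ⟩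
  o *ℚ prefactor (suc N) ∎
  where
  open ≡-Reasoning
  open ℚ.+-*-Solver
  ν = ⟪ suc N ⟫
  o = odd (suc (suc N))
  c = ⟪ (2 * suc N) C suc N ⟫
  p = ⟪ 2 ⟫ ^ℚ (4 * suc N ∸ 2)
  4n∸2 : ∀ N → 4 * suc N ∸ 2 ≡ 2 + 4 * N
  4n∸2 N = cong (_∸ 2) (S.solve 1 (λ N → S.con 4 S.:* (S.con 1 S.:+ N) S.:= S.con 4 S.:+ S.con 4 S.:* N) refl N)
    where module S = ℕ.+-*-Solver
  power : ⟪ 2 ⟫ ^ℚ (4 * suc (suc N) ∸ 2) ≡ ⟪ 16 ⟫ *ℚ p
  power = begin
    ⟪ 2 ⟫ ^ℚ (4 * suc (suc N) ∸ 2)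
      ≡⟨ cong (⟪ 2 ⟫ ^ℚ_) (trans (4n∸2 (suc N)) (trans (cong (λ t → 2 + t) (exponent N)) (cong (λ t → 4 + t) (sym (4n∸2 N))))) ⟩
    ⟪ 2 ⟫ ^ℚ (4 + (4 * suc N ∸ 2))
      ≡⟨ ℚ-Exp.^-homo-* ⟪ 2 ⟫ 4 (4 * suc N ∸ 2) ⟩
    ⟪ 16 ⟫ *ℚ p ∎
    where
    exponent : ∀ N → 4 * suc N ≡ 2 + (2 + 4 * N)
    exponent N = S.solve 1 (λ N → S.con 4 S.:* (S.con 1 S.:+ N) S.:= S.con 2 S.:+ (S.con 2 S.:+ S.con 4 S.:* N)) refl N
      where module S = ℕ.+-*-Solver

-- The origin of the prefactor: with n = `suc N` its growth ratio (2n+1)/(8n) turns the factor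
-- 8n(2n+1) of `bin-rec` into (2n+1)², the coefficient in the recursion of the generating function.
prefactor-bin-rec : ∀ N k → k ≤ suc N →
  prefactor (suc (suc N)) *ℚ ((odd² (suc (suc N)) -ℚ odd² k) *ℚ bin (suc (suc N)) k)
    ≡ odd² (suc (suc N)) *ℚ (prefactor (suc N) *ℚ bin (suc N) k)
prefactor-bin-rec N k k≤ = begin
  w′ *ℚ ((odd² (suc (suc N)) -ℚ odd² k) *ℚ bin (suc (suc N)) k)
    ≡⟨ cong (w′ *ℚ_) (bin-rec N k k≤) ⟩
  w′ *ℚ (⟪ 8 ⟫ *ℚ ν *ℚ o *ℚ b)
    ≡⟨ solve 4 (λ w ν o b → w :* (con ⟪ 8 ⟫ :* ν :* o :* b) := (con ⟪ 8 ⟫ :* ν :* w) :* (o :* b)) refl w′ ν o b ⟩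
  (⟪ 8 ⟫ *ℚ ν *ℚ w′) *ℚ (o *ℚ b)
    ≡⟨ cong (_*ℚ (o *ℚ b)) (prefactor-rec N) ⟩
  (o *ℚ prefactor (suc N)) *ℚ (o *ℚ b)
    ≡⟨ solve 3 (λ o w b → (o :* w) :* (o :* b) := (o :* o) :* (w :* b)) refl o (prefactor (suc N)) b ⟩
  odd² (suc (suc N)) *ℚ (prefactor (suc N) *ℚ b) ∎
  where
  open ≡-Reasoning
  open ℚ.+-*-Solver
  w′ = prefactor (suc (suc N))
  ν = ⟪ suc N ⟫
  o = odd (suc (suc N))
  b = bin (suc N) k

-- Alternating and doubled binomial sums

-- Every step of g releases two neighbouring terms of f, so interior terms come twice and f 0 once.
-- The boundary condition g j = f j supplies the second copy of the last term.
doubled-telescope₀ : ∀ j (f g : ℕ → ℚ) → (∀ i → i < j → g i ≡ g (suc i) +ℚ (f i +ℚ f (suc i))) → g j ≡ f j →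
  f 0 +ℚ ⟪ 2 ⟫ *ℚ ∑ℚ (upTo j) (f ∘ suc) ≡ g 0
doubled-telescope₀ zero    f g step end = trans (trans (cong (f 0 +ℚ_) (ℚ.*-zeroʳ ⟪ 2 ⟫)) (ℚ.+-identityʳ (f 0))) (sym end)
doubled-telescope₀ (suc j) f g step end = begin
  f 0 +ℚ ⟪ 2 ⟫ *ℚ ∑ℚ (upTo (suc j)) (f ∘ suc)
    ≡⟨ cong (λ t → f 0 +ℚ ⟪ 2 ⟫ *ℚ t) (∑ℚ.∑-upTo-first j (f ∘ suc)) ⟩
  f 0 +ℚ ⟪ 2 ⟫ *ℚ (f 1 +ℚ s)
    ≡⟨ solve 3 (λ a b s → a :+ con ⟪ 2 ⟫ :* (b :+ s) := (b :+ con ⟪ 2 ⟫ :* s) :+ (a :+ b)) refl (f 0) (f 1) s ⟩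
  (f 1 +ℚ ⟪ 2 ⟫ *ℚ s) +ℚ (f 0 +ℚ f 1)
    ≡⟨ cong (_+ℚ (f 0 +ℚ f 1)) (doubled-telescope₀ j (f ∘ suc) (g ∘ suc) (λ i i<j → step (suc i) (s≤s i<j)) end) ⟩
  g 1 +ℚ (f 0 +ℚ f 1)
    ≡⟨ sym (step 0 (s≤s z≤n)) ⟩
  g 0 ∎
  where
  open ≡-Reasoning
  open ℚ.+-*-Solver
  s = ∑ℚ (upTo j) (λ i → f (suc (suc i)))

△-refl : ∀ {k m} → k ≡ m → △ k m ≡ 0
△-refl {k} {m} k≡m = cong (λ b → if b then 0 else 1) (dec-true (k ℕ.≟ m) k≡m)

△-≢ : ∀ {k m} → k ≢ m → △ k m ≡ 1
△-≢ {k} {m} k≢m = cong (λ b → if b then 0 else 1) (dec-false (k ℕ.≟ m) k≢m)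

doubled-telescope : ∀ m j (F G : ℕ → ℚ) → (∀ k → k < m + j → G k ≡ G (suc k) +ℚ (F k +ℚ F (suc k))) →
  G (m + j) ≡ F (m + j) → ∑ℚ (upTo (suc j)) (λ i → ⟪ 2 ⟫ ^ℚ △ (m + i) m *ℚ F (m + i)) ≡ G m
doubled-telescope m j F G step end = begin
  ∑ℚ (upTo (suc j)) (λ i → ⟪ 2 ⟫ ^ℚ △ (m + i) m *ℚ F (m + i))
    ≡⟨ ∑ℚ.∑-upTo-first j (λ i → ⟪ 2 ⟫ ^ℚ △ (m + i) m *ℚ F (m + i)) ⟩
  ⟪ 2 ⟫ ^ℚ △ (m + 0) m *ℚ F (m + 0) +ℚ ∑ℚ (upTo j) (λ i → ⟪ 2 ⟫ ^ℚ △ (m + suc i) m *ℚ F (m + suc i))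
    ≡⟨ cong₂ _+ℚ_
         (trans (cong (λ t → ⟪ 2 ⟫ ^ℚ t *ℚ F (m + 0)) (△-refl (ℕ.+-identityʳ m))) (ℚ.*-identityˡ (F (m + 0))))
         (trans (∑ℚ.∑-cong (upTo j) λ i → cong (λ t → ⟪ 2 ⟫ ^ℚ t *ℚ F (m + suc i)) (△-≢ (ℕ.m+1+n≢m m)))
                (∑ℚ.∑-*ˡ (upTo j) ⟪ 2 ⟫ λ i → F (m + suc i))) ⟩
  F (m + 0) +ℚ ⟪ 2 ⟫ *ℚ ∑ℚ (upTo j) (λ i → F (m + suc i))
    ≡⟨ doubled-telescope₀ j (λ i → F (m + i)) (λ i → G (m + i))
         (λ i i<j → subst (λ k → G (m + i) ≡ G k +ℚ (F (m + i) +ℚ F k)) (sym (ℕ.+-suc m i)) (step (m + i) (ℕ.+-monoʳ-< m i<j))) end ⟩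
  G (m + 0)
    ≡⟨ cong G (ℕ.+-identityʳ m) ⟩
  G m ∎
  where open ≡-Reasoning

sign : ℕ → ℚ
sign k = (-ℚ 1ℚ) ^ℚ k

-- Collecting the terms in each coefficient leaves the factors 2(n-k) and 2(n+k): this is twice
-- `bin-step`.
odd-bin-telescope : ∀ n k → k < n →
  odd n *ℚ bin n k ≡ odd n *ℚ bin n (suc k) +ℚ (odd k *ℚ bin n k +ℚ odd (suc k) *ℚ bin n (suc k))
odd-bin-telescope n k k<n = begin
  odd n *ℚ b
    ≡⟨ cong (_*ℚ b) (odd≡ n) ⟩
  (⟪ 2 ⟫ *ℚ ν -ℚ 1ℚ) *ℚ b
    ≡⟨ solve 4 (λ ν κ b b′ →
         (con ⟪ 2 ⟫ :* ν :- con 1ℚ) :* b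
           := ((con ⟪ 2 ⟫ :* ν :- con 1ℚ) :* b′ :+ ((con ⟪ 2 ⟫ :* κ :- con 1ℚ) :* b :+ (con 1ℚ :+ con ⟪ 2 ⟫ :* κ) :* b′))
              :+ con ⟪ 2 ⟫ :* ((ν :- κ) :* b :- (ν :+ κ) :* b′)) refl ν κ b b′ ⟩
  ((⟪ 2 ⟫ *ℚ ν -ℚ 1ℚ) *ℚ b′ +ℚ ((⟪ 2 ⟫ *ℚ κ -ℚ 1ℚ) *ℚ b +ℚ (1ℚ +ℚ ⟪ 2 ⟫ *ℚ κ) *ℚ b′))
    +ℚ ⟪ 2 ⟫ *ℚ ((ν -ℚ κ) *ℚ b -ℚ (ν +ℚ κ) *ℚ b′)
    ≡⟨ drop-null ((⟪ 2 ⟫ *ℚ ν -ℚ 1ℚ) *ℚ b′ +ℚ ((⟪ 2 ⟫ *ℚ κ -ℚ 1ℚ) *ℚ b +ℚ (1ℚ +ℚ ⟪ 2 ⟫ *ℚ κ) *ℚ b′)) ⟪ 2 ⟫ (bin-step n k k<n) ⟩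
  (⟪ 2 ⟫ *ℚ ν -ℚ 1ℚ) *ℚ b′ +ℚ ((⟪ 2 ⟫ *ℚ κ -ℚ 1ℚ) *ℚ b +ℚ (1ℚ +ℚ ⟪ 2 ⟫ *ℚ κ) *ℚ b′)
    ≡⟨ cong₂ (λ s t → s *ℚ b′ +ℚ t) (sym (odd≡ n)) (cong₂ (λ s t → s *ℚ b +ℚ t *ℚ b′) (sym (odd≡ k)) (sym (odd-suc k))) ⟩
  odd n *ℚ b′ +ℚ (odd k *ℚ b +ℚ odd (suc k) *ℚ b′) ∎
  where
  open ≡-Reasoning
  open ℚ.+-*-Solver
  ν = ⟪ n ⟫
  κ = ⟪ k ⟫
  b = bin n k
  b′ = bin n (suc k)

doubled-odd-bin-sum : ∀ n m j → n ≡ m + j →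
  ∑ℚ (upTo (suc j)) (λ i → ⟪ 2 ⟫ ^ℚ △ (m + i) m *ℚ (odd (m + i) *ℚ bin n (m + i))) ≡ odd n *ℚ bin n m
doubled-odd-bin-sum n m j n≡m+j = doubled-telescope m j (λ k → odd k *ℚ bin n k) (λ k → odd n *ℚ bin n k)
  (λ k k<m+j → odd-bin-telescope n k (subst (k <_) (sym n≡m+j) k<m+j))
  (cong (λ t → odd t *ℚ bin n (m + j)) n≡m+j)

-- `odd-bin-telescope` multiplied by (-1)^k, with the roles exchanged: now the multiple by 2k-1 is
-- the one that telescopes and the multiple by 2n-1 is the one that is summed.
doubled-sign-bin-sum : ∀ n m j → n ≡ m + j →
  ∑ℚ (upTo (suc j)) (λ i → ⟪ 2 ⟫ ^ℚ △ (m + i) m *ℚ (odd n *ℚ (sign (m + i) *ℚ bin n (m + i)))) ≡ sign m *ℚ (odd m *ℚ bin n m)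
doubled-sign-bin-sum n m j n≡m+j = doubled-telescope m j (λ k → odd n *ℚ (sign k *ℚ bin n k)) (λ k → sign k *ℚ (odd k *ℚ bin n k))
  (λ k k<m+j → step k (subst (k <_) (sym n≡m+j) k<m+j))
  (trans (cong (λ t → sign (m + j) *ℚ (odd t *ℚ bin n (m + j))) (sym n≡m+j))
         (solve 3 (λ s o b → s :* (o :* b) := o :* (s :* b)) refl (sign (m + j)) (odd n) (bin n (m + j))))
  where
  open ≡-Reasoning
  open ℚ.+-*-Solver
  step : ∀ k → k < n → sign k *ℚ (odd k *ℚ bin n k)
    ≡ sign (suc k) *ℚ (odd (suc k) *ℚ bin n (suc k)) +ℚ (odd n *ℚ (sign k *ℚ bin n k) +ℚ odd n *ℚ (sign (suc k) *ℚ bin n (suc k)))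
  step k k<n = begin
    s *ℚ (odd k *ℚ b)
      ≡⟨ solve 6 (λ s x y o b b′ → s :* (x :* b)
           := ((con (-ℚ 1ℚ) :* s) :* (y :* b′) :+ (o :* (s :* b) :+ o :* ((con (-ℚ 1ℚ) :* s) :* b′)))
              :+ (:- s) :* (o :* b :- (o :* b′ :+ (x :* b :+ y :* b′)))) refl s (odd k) (odd (suc k)) (odd n) b b′ ⟩
    rhs +ℚ (-ℚ s) *ℚ (odd n *ℚ b -ℚ (odd n *ℚ b′ +ℚ (odd k *ℚ b +ℚ odd (suc k) *ℚ b′)))
      ≡⟨ drop-null rhs (-ℚ s) (odd-bin-telescope n k k<n) ⟩
    rhs ∎
    where
    s = sign k
    b = bin n k
    b′ = bin n (suc k)
    rhs = (-ℚ 1ℚ *ℚ s) *ℚ (odd (suc k) *ℚ b′) +ℚ (odd n *ℚ (s *ℚ b) +ℚ odd n *ℚ ((-ℚ 1ℚ *ℚ s) *ℚ b′))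

telescope : ∀ n (f y : ℕ → ℚ) → (∀ i → i < n → f i ≡ y i -ℚ y (suc i)) → ∑ℚ (upTo n) f ≡ y 0 -ℚ y n
telescope zero    f y eq = sym (ℚ.+-inverseʳ (y 0))
telescope (suc n) f y eq = begin
  ∑ℚ (upTo (suc n)) f                        ≡⟨ ∑ℚ.∑-upTo-last n f ⟩
  ∑ℚ (upTo n) f +ℚ f n                       ≡⟨ cong₂ _+ℚ_ (telescope n f y λ i i<n → eq i (ℕ.m≤n⇒m≤1+n i<n)) (eq n ℕ.≤-refl) ⟩
  (y 0 -ℚ y n) +ℚ (y n -ℚ y (suc n))         ≡⟨ solve 3 (λ a b c → (a :- b) :+ (b :- c) := a :- c) refl (y 0) (y n) (y (suc n)) ⟩
  y 0 -ℚ y (suc n)                           ∎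
  where
  open ≡-Reasoning
  open ℚ.+-*-Solver

-- After multiplication by n-1 each term is a difference of consecutive values of `y`. The
-- multiplier can be cancelled because n = N+2; for n = 1 the sum would be -1.
alternating-odd-bin-sum : ∀ N → ∑ℚ (upTo (suc (suc N))) (λ i → sign (suc i) *ℚ (odd (suc i) *ℚ bin (suc (suc N)) (suc i))) ≡ 0ℚ
alternating-odd-bin-sum N = *ℚ-cancelˡ ⟪ suc N ⟫ (0<⟪suc⟫ N) (begin
  ⟪ suc N ⟫ *ℚ ∑ℚ (upTo n) (λ i → sign (suc i) *ℚ (odd (suc i) *ℚ bin n (suc i)))
    ≡⟨ sym (∑ℚ.∑-*ˡ (upTo n) ⟪ suc N ⟫ λ i → sign (suc i) *ℚ (odd (suc i) *ℚ bin n (suc i))) ⟩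
  ∑ℚ (upTo n) (λ i → ⟪ suc N ⟫ *ℚ (sign (suc i) *ℚ (odd (suc i) *ℚ bin n (suc i))))
    ≡⟨ telescope n (λ i → ⟪ suc N ⟫ *ℚ (sign (suc i) *ℚ (odd (suc i) *ℚ bin n (suc i)))) y difference ⟩
  y 0 -ℚ y n
    ≡⟨ solve 5 (λ s t ν b c → s :* (con 0ℚ :* ((ν :- con 0ℚ) :* b)) :- t :* (ν :* ((ν :- ν) :* c)) := con 0ℚ)
         refl (sign 1) (sign (suc n)) ⟪ n ⟫ (bin n 0) (bin n n) ⟩
  0ℚ
    ≡⟨ sym (ℚ.*-zeroʳ ⟪ suc N ⟫) ⟩
  ⟪ suc N ⟫ *ℚ 0ℚ ∎)
  where
  open ≡-Reasoning
  open ℚ.+-*-Solver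
  n = suc (suc N)
  -- The factors i and n-i make `y` vanish at both ends of the range.
  y : ℕ → ℚ
  y i = sign (suc i) *ℚ (⟪ i ⟫ *ℚ ((⟪ n ⟫ -ℚ ⟪ i ⟫) *ℚ bin n i))
  difference : ∀ i → i < n → ⟪ suc N ⟫ *ℚ (sign (suc i) *ℚ (odd (suc i) *ℚ bin n (suc i))) ≡ y i -ℚ y (suc i)
  difference i i<n = begin
    ⟪ suc N ⟫ *ℚ (s *ℚ (odd (suc i) *ℚ b′))
      ≡⟨ cong (λ t → ⟪ suc N ⟫ *ℚ (s *ℚ (t *ℚ b′))) (odd-suc i) ⟩
    ⟪ suc N ⟫ *ℚ (s *ℚ ((1ℚ +ℚ ⟪ 2 ⟫ *ℚ ι) *ℚ b′))
      ≡⟨ solve 5 (λ ν ι s b b′ → ν :* (s :* ((con 1ℚ :+ con ⟪ 2 ⟫ :* ι) :* b′))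
           := (s :* (ι :* (((con 1ℚ :+ ν) :- ι) :* b)) :- (con (-ℚ 1ℚ) :* s) :* ((con 1ℚ :+ ι) :* (((con 1ℚ :+ ν) :- (con 1ℚ :+ ι)) :* b′)))
              :+ (:- (s :* ι)) :* (((con 1ℚ :+ ν) :- ι) :* b :- ((con 1ℚ :+ ν) :+ ι) :* b′)) refl ⟪ suc N ⟫ ι s b b′ ⟩
    rhs (1ℚ +ℚ ⟪ suc N ⟫) (1ℚ +ℚ ι) +ℚ (-ℚ (s *ℚ ι)) *ℚ (((1ℚ +ℚ ⟪ suc N ⟫) -ℚ ι) *ℚ b -ℚ ((1ℚ +ℚ ⟪ suc N ⟫) +ℚ ι) *ℚ b′)
      ≡⟨ cong₂ (λ ν σ → rhs ν σ +ℚ (-ℚ (s *ℚ ι)) *ℚ ((ν -ℚ ι) *ℚ b -ℚ (ν +ℚ ι) *ℚ b′)) (sym (⟪suc⟫ (suc N))) (sym (⟪suc⟫ i)) ⟩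
    rhs ⟪ n ⟫ ⟪ suc i ⟫ +ℚ (-ℚ (s *ℚ ι)) *ℚ ((⟪ n ⟫ -ℚ ι) *ℚ b -ℚ (⟪ n ⟫ +ℚ ι) *ℚ b′)
      ≡⟨ drop-null (rhs ⟪ n ⟫ ⟪ suc i ⟫) (-ℚ (s *ℚ ι)) (bin-step n i i<n) ⟩
    y i -ℚ y (suc i) ∎
    where
    ι = ⟪ i ⟫
    s = sign (suc i)
    b = bin n i
    b′ = bin n (suc i)
    rhs : ℚ → ℚ → ℚ
    rhs ν σ = s *ℚ (ι *ℚ ((ν -ℚ ι) *ℚ b)) -ℚ (-ℚ 1ℚ *ℚ s) *ℚ (σ *ℚ ((ν -ℚ σ) *ℚ b′))

-- The kernel V#

-- V#ₖ,ₘ(s) without the factor (2k-1)/(2m-1).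

W : ℕ → ℕ → Index → ℚ
W k m s = ∑ℚ (chains k m (List.length s)) (λ l → ⟪ 2 ⟫ ^ℚ △-sum k l m *ℚ oddPowers s l)

W-[] : ∀ k m → W k m [] ≡ ⟪ 2 ⟫ ^ℚ △ k m
W-[] k m = trans (ℚ.+-identityʳ (⟪ 2 ⟫ ^ℚ △ k m *ℚ 1ℚ)) (ℚ.*-identityʳ (⟪ 2 ⟫ ^ℚ △ k m))

-- The empty index has a formula of its own, with the ratio inside the power. It agrees with the
-- general one because the ratio is 1 when k = m.
V#≡W : ∀ m i s → let k = suc m + i in V# k (suc m) s ≡ odd k *ℚ odd (suc m) ⁻¹ *ℚ W k (suc m) s
V#≡W m i (s ∷ ss) with suc m ℕ.≤? suc m + i
... | yes _ = refl
... | no m≰ = contradiction (ℕ.m≤m+n (suc m) i) m≰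
V#≡W m i [] = trans (power (ℕ._≟_ k (suc m))) (cong (odd k *ℚ odd (suc m) ⁻¹ *ℚ_) (sym (W-[] k (suc m))))
  where
  open ≡-Reasoning
  open ℚ.+-*-Solver
  k = suc m + i
  x = odd k *ℚ odd (suc m) ⁻¹
  power : Dec (k ≡ suc m) → (⟪ 2 ⟫ *ℚ x) ^ℚ △ k (suc m) ≡ x *ℚ ⟪ 2 ⟫ ^ℚ △ k (suc m)
  power (yes k≡) = begin
    (⟪ 2 ⟫ *ℚ x) ^ℚ △ k (suc m)    ≡⟨ cong ((⟪ 2 ⟫ *ℚ x) ^ℚ_) (△-refl k≡) ⟩
    1ℚ                             ≡⟨ sym (odd-inverse m) ⟩
    odd (suc m) *ℚ odd (suc m) ⁻¹  ≡⟨ cong (λ t → odd t *ℚ odd (suc m) ⁻¹) (sym k≡) ⟩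
    x                              ≡⟨ sym (ℚ.*-identityʳ x) ⟩
    x *ℚ 1ℚ                        ≡⟨ cong (λ t → x *ℚ ⟪ 2 ⟫ ^ℚ t) (sym (△-refl k≡)) ⟩
    x *ℚ ⟪ 2 ⟫ ^ℚ △ k (suc m)      ∎
  power (no k≢) = begin
    (⟪ 2 ⟫ *ℚ x) ^ℚ △ k (suc m)    ≡⟨ cong ((⟪ 2 ⟫ *ℚ x) ^ℚ_) (△-≢ k≢) ⟩
    ⟪ 2 ⟫ *ℚ x *ℚ 1ℚ               ≡⟨ solve 1 (λ x → con ⟪ 2 ⟫ :* x :* con 1ℚ := x :* con (⟪ 2 ⟫ ^ℚ 1)) refl x ⟩
    x *ℚ ⟪ 2 ⟫ ^ℚ 1                ≡⟨ cong (λ t → x *ℚ ⟪ 2 ⟫ ^ℚ t) (sym (△-≢ k≢)) ⟩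
    x *ℚ ⟪ 2 ⟫ ^ℚ △ k (suc m)      ∎

W-∷ : ∀ m i s ss → W (m + i) m (s ∷ ss)
  ≡ ∑ℚ (upTo (suc i)) (λ l → ⟪ 2 ⟫ ^ℚ △ (m + i) (m + l) *ℚ odd (m + l) ^ᶻ (ℤ.- (+ s)) *ℚ W (m + l) m ss)
W-∷ m i s ss = begin
  W (m + i) m (s ∷ ss)
    ≡⟨ ∑ℚ.∑-chains (m + i) m (List.length ss) (λ l → ⟪ 2 ⟫ ^ℚ △-sum (m + i) l m *ℚ oddPowers (s ∷ ss) l) ⟩
  ∑ℚ (upTo (suc (m + i) ∸ m)) (λ l → ∑ℚ (chains (m + l) m (List.length ss)) λ v → ⟪ 2 ⟫ ^ℚ (△ (m + i) (m + l) + △-sum (m + l) v m) *ℚ (p l *ℚ oddPowers ss v))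
    ≡⟨ ∑ℚ.∑-cong (upTo (suc (m + i) ∸ m)) (λ l →
         trans (∑ℚ.∑-cong (chains (m + l) m (List.length ss)) (regroup l))
               (∑ℚ.∑-*ˡ (chains (m + l) m (List.length ss)) (⟪ 2 ⟫ ^ℚ △ (m + i) (m + l) *ℚ p l) (λ v → ⟪ 2 ⟫ ^ℚ △-sum (m + l) v m *ℚ oddPowers ss v))) ⟩
  ∑ℚ (upTo (suc (m + i) ∸ m)) (λ l → ⟪ 2 ⟫ ^ℚ △ (m + i) (m + l) *ℚ p l *ℚ W (m + l) m ss)
    ≡⟨ cong (λ t → ∑ℚ (upTo t) (λ l → ⟪ 2 ⟫ ^ℚ △ (m + i) (m + l) *ℚ p l *ℚ W (m + l) m ss))
         (trans (cong (_∸ m) (sym (ℕ.+-suc m i))) (ℕ.m+n∸m≡n m (suc i))) ⟩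
  ∑ℚ (upTo (suc i)) (λ l → ⟪ 2 ⟫ ^ℚ △ (m + i) (m + l) *ℚ p l *ℚ W (m + l) m ss) ∎
  where
  open ≡-Reasoning
  open ℚ.+-*-Solver
  p : ℕ → ℚ
  p l = odd (m + l) ^ᶻ (ℤ.- (+ s))
  regroup : ∀ l v → ⟪ 2 ⟫ ^ℚ (△ (m + i) (m + l) + △-sum (m + l) v m) *ℚ (p l *ℚ oddPowers ss v)
    ≡ (⟪ 2 ⟫ ^ℚ △ (m + i) (m + l) *ℚ p l) *ℚ (⟪ 2 ⟫ ^ℚ △-sum (m + l) v m *ℚ oddPowers ss v)
  regroup l v = trans (cong (_*ℚ (p l *ℚ oddPowers ss v)) (ℚ-Exp.^-homo-* ⟪ 2 ⟫ (△ (m + i) (m + l)) (△-sum (m + l) v m)))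
    (solve 4 (λ a b c d → (a :* b) :* (c :* d) := (a :* c) :* (b :* d)) refl
      (⟪ 2 ⟫ ^ℚ △ (m + i) (m + l)) (⟪ 2 ⟫ ^ℚ △-sum (m + l) v m) (p l) (oddPowers ss v))

-- Induction on r. Summing over the outermost k first, by `doubled-sign-bin-sum`, costs a factor
-- 2n-1 and yields a factor 2l₁-1, which cancels the exponent 1 of l₁. What is left is the same sum
-- for an index with one entry fewer.
sign-bin-W-sum : ∀ r n m j → n ≡ suc m + j →
  odd n ^ℚ suc r *ℚ ∑ℚ (upTo (suc j)) (λ i → sign (suc m + i) *ℚ bin n (suc m + i) *ℚ W (suc m + i) (suc m) (replicate r 1))
    ≡ sign (suc m) *ℚ (odd (suc m) *ℚ bin n (suc m))
sign-bin-W-sum zero n m′ j n≡m+j = begin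
  (o *ℚ 1ℚ) *ℚ ∑ℚ (upTo (suc j)) (λ i → sign (m + i) *ℚ bin n (m + i) *ℚ W (m + i) m [])
    ≡⟨ sym (∑ℚ.∑-*ˡ (upTo (suc j)) (o *ℚ 1ℚ) (λ i → sign (m + i) *ℚ bin n (m + i) *ℚ W (m + i) m [])) ⟩
  ∑ℚ (upTo (suc j)) (λ i → (o *ℚ 1ℚ) *ℚ (sign (m + i) *ℚ bin n (m + i) *ℚ W (m + i) m []))
    ≡⟨ ∑ℚ.∑-cong (upTo (suc j)) (λ i → trans (cong (λ t → (o *ℚ 1ℚ) *ℚ (sign (m + i) *ℚ bin n (m + i) *ℚ t)) (W-[] (m + i) m))
         (solve 4 (λ o s b w → (o :* con 1ℚ) :* (s :* b :* w) := w :* (o :* (s :* b))) refl o (sign (m + i)) (bin n (m + i)) (⟪ 2 ⟫ ^ℚ △ (m + i) m))) ⟩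
  ∑ℚ (upTo (suc j)) (λ i → ⟪ 2 ⟫ ^ℚ △ (m + i) m *ℚ (o *ℚ (sign (m + i) *ℚ bin n (m + i))))
    ≡⟨ doubled-sign-bin-sum n m j n≡m+j ⟩
  sign m *ℚ (odd m *ℚ bin n m) ∎
  where
  open ≡-Reasoning
  open ℚ.+-*-Solver
  m = suc m′
  o = odd n
sign-bin-W-sum (suc r) n m′ j n≡m+j = begin
  (o *ℚ O) *ℚ ∑ℚ (upTo (suc j)) (λ i → sb (m + i) *ℚ W (m + i) m (1 ∷ replicate r 1))
    ≡⟨ cong ((o *ℚ O) *ℚ_) (∑ℚ.∑-cong (upTo (suc j)) λ i →
         trans (cong (sb (m + i) *ℚ_) (W-∷ m i 1 (replicate r 1)))
               (sym (∑ℚ.∑-*ˡ (upTo (suc i)) (sb (m + i)) λ l → ⟪ 2 ⟫ ^ℚ △ (m + i) (m + l) *ℚ p l *ℚ w l))) ⟩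
  (o *ℚ O) *ℚ ∑ℚ (upTo (suc j)) (λ i → ∑ℚ (upTo (suc i)) λ l → term i l)
    ≡⟨ cong ((o *ℚ O) *ℚ_) (∑ℚ.∑-triangle (suc j) term) ⟩
  (o *ℚ O) *ℚ ∑ℚ (upTo (suc j)) (λ l → ∑ℚ (upTo (suc j ∸ l)) λ i → term (l + i) l)
    ≡⟨ solve 3 (λ o O s → (o :* O) :* s := O :* (o :* s)) refl o O (∑ℚ (upTo (suc j)) (λ l → ∑ℚ (upTo (suc j ∸ l)) λ i → term (l + i) l)) ⟩
  O *ℚ (o *ℚ ∑ℚ (upTo (suc j)) (λ l → ∑ℚ (upTo (suc j ∸ l)) λ i → term (l + i) l))
    ≡⟨ cong (O *ℚ_) (trans (sym (∑ℚ.∑-*ˡ (upTo (suc j)) o (λ l → ∑ℚ (upTo (suc j ∸ l)) λ i → term (l + i) l)))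
                          (∑ℚ.∑-upTo-cong (suc j) λ l l<1+j → column l (ℕ.≤-pred l<1+j))) ⟩
  O *ℚ ∑ℚ (upTo (suc j)) (λ l → sb (m + l) *ℚ w l)
    ≡⟨ sign-bin-W-sum r n m′ j n≡m+j ⟩
  sign m *ℚ (odd m *ℚ bin n m) ∎
  where
  open ≡-Reasoning
  open ℚ.+-*-Solver
  m = suc m′
  o = odd n
  O = odd n ^ℚ suc r
  sb p w : ℕ → ℚ
  sb k = sign k *ℚ bin n k
  p l = odd (m + l) ^ᶻ (ℤ.- (+ 1))
  w l = W (m + l) m (replicate r 1)
  term : ℕ → ℕ → ℚ
  term i l = sb (m + i) *ℚ (⟪ 2 ⟫ ^ℚ △ (m + i) (m + l) *ℚ p l *ℚ w l)
  column : ∀ l → l ≤ j → o *ℚ ∑ℚ (upTo (suc j ∸ l)) (λ i → term (l + i) l) ≡ sb (m + l) *ℚ w l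
  column l l≤j = begin
    o *ℚ ∑ℚ (upTo (suc j ∸ l)) (λ i → term (l + i) l)
      ≡⟨ cong (λ t → o *ℚ ∑ℚ (upTo t) (λ i → term (l + i) l)) (ℕ.+-∸-assoc 1 l≤j) ⟩
    o *ℚ ∑ℚ (upTo (suc (j ∸ l))) (λ i → term (l + i) l)
      ≡⟨ sym (∑ℚ.∑-*ˡ (upTo (suc (j ∸ l))) o (λ i → term (l + i) l)) ⟩
    ∑ℚ (upTo (suc (j ∸ l))) (λ i → o *ℚ term (l + i) l)
      ≡⟨ ∑ℚ.∑-cong (upTo (suc (j ∸ l))) (λ i → trans
           (cong (λ k → o *ℚ (sb k *ℚ (⟪ 2 ⟫ ^ℚ △ k (m + l) *ℚ p l *ℚ w l))) (sym (ℕ.+-assoc m l i)))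
           (solve 5 (λ o x t p w → o :* (x :* (t :* p :* w)) := (t :* (o :* x)) :* (p :* w)) refl
              o (sb (m + l + i)) (⟪ 2 ⟫ ^ℚ △ (m + l + i) (m + l)) (p l) (w l))) ⟩
    ∑ℚ (upTo (suc (j ∸ l))) (λ i → (⟪ 2 ⟫ ^ℚ △ (m + l + i) (m + l) *ℚ (o *ℚ sb (m + l + i))) *ℚ (p l *ℚ w l))
      ≡⟨ ∑ℚ.∑-*ʳ (upTo (suc (j ∸ l))) (p l *ℚ w l) (λ i → ⟪ 2 ⟫ ^ℚ △ (m + l + i) (m + l) *ℚ (o *ℚ sb (m + l + i))) ⟩
    ∑ℚ (upTo (suc (j ∸ l))) (λ i → ⟪ 2 ⟫ ^ℚ △ (m + l + i) (m + l) *ℚ (o *ℚ sb (m + l + i))) *ℚ (p l *ℚ w l)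
      ≡⟨ cong (_*ℚ (p l *ℚ w l)) (doubled-sign-bin-sum n (m + l) (j ∸ l) n≡) ⟩
    (sign (m + l) *ℚ (odd (m + l) *ℚ bin n (m + l))) *ℚ (p l *ℚ w l)
      ≡⟨ solve 5 (λ s o i b w → (s :* (o :* b)) :* ((i :* con 1ℚ) :* w) := (s :* b :* w) :* (o :* i)) refl
           (sign (m + l)) (odd (m + l)) (odd (m + l) ⁻¹) (bin n (m + l)) (w l) ⟩
    (sb (m + l) *ℚ w l) *ℚ (odd (m + l) *ℚ odd (m + l) ⁻¹)
      ≡⟨ cong ((sb (m + l) *ℚ w l) *ℚ_) (odd-inverse (m′ + l)) ⟩
    (sb (m + l) *ℚ w l) *ℚ 1ℚ
      ≡⟨ ℚ.*-identityʳ (sb (m + l) *ℚ w l) ⟩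
    sb (m + l) *ℚ w l ∎
    where
    n≡ : n ≡ m + l + (j ∸ l)
    n≡ = trans n≡m+j (trans (cong (λ t → m + t) (sym (ℕ.m+[n∸m]≡n l≤j))) (sym (ℕ.+-assoc m l (j ∸ l))))

-- The weight with exponent δᵢ splits into `τ` for cᵢ and `η` for cᵢ₊₁, both taken at kᵢ; the -1 of
-- the exponent δᵢ-1 goes to `η`. Everything that depends on cᵢ₊₁ then couples only kᵢ and kᵢ₊₁.
τ η : ℕ → ℕ → ℚ
τ c k = sign (k * δ c) *ℚ odd k ^ℚ δ c
η c k = τ c k *ℚ odd k ⁻¹

sign² : ∀ k → sign k *ℚ sign k ≡ 1ℚ
sign² zero    = refl
sign² (suc k) = trans (solve 1 (λ s → (con (-ℚ 1ℚ) :* s) :* (con (-ℚ 1ℚ) :* s) := s :* s) refl (sign k)) (sign² k)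
  where open ℚ.+-*-Solver

odd^ᶻ-pred : ∀ k s → odd (suc k) ^ᶻ (+ s -ℤ 1ℤ) ≡ odd (suc k) ^ℚ s *ℚ odd (suc k) ⁻¹
odd^ᶻ-pred k zero    = ℚ.*-comm (odd (suc k) ⁻¹) 1ℚ
odd^ᶻ-pred k (suc s) = sym (begin
  (o *ℚ p) *ℚ o ⁻¹    ≡⟨ solve 3 (λ o p i → (o :* p) :* i := p :* (o :* i)) refl o p (o ⁻¹) ⟩
  p *ℚ (o *ℚ o ⁻¹)    ≡⟨ cong (p *ℚ_) (odd-inverse k) ⟩
  p *ℚ 1ℚ             ≡⟨ ℚ.*-identityʳ p ⟩
  p                   ∎)
  where
  open ≡-Reasoning
  open ℚ.+-*-Solver
  o = odd (suc k)
  p = o ^ℚ s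

τ*η : ∀ p e k′ → let k = suc k′ in
  (-ℚ 1ℚ) ^ℚ (k * (δ p + δ e)) *ℚ odd k ^ᶻ (+ (δ p + δ e) -ℤ 1ℤ) ≡ τ p k *ℚ η e k
τ*η p e k′ = begin
  sign (k * (δ p + δ e)) *ℚ o ^ᶻ (+ (δ p + δ e) -ℤ 1ℤ)
    ≡⟨ cong₂ _*ℚ_ (trans (cong sign (ℕ.*-distribˡ-+ k (δ p) (δ e))) (ℚ-Exp.^-homo-* (-ℚ 1ℚ) (k * δ p) (k * δ e)))
                  (trans (odd^ᶻ-pred k′ (δ p + δ e)) (cong (_*ℚ o ⁻¹) (ℚ-Exp.^-homo-* o (δ p) (δ e)))) ⟩
  (sign (k * δ p) *ℚ sign (k * δ e)) *ℚ ((o ^ℚ δ p *ℚ o ^ℚ δ e) *ℚ o ⁻¹)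
    ≡⟨ solve 5 (λ a b c d i → (a :* b) :* ((c :* d) :* i) := (a :* c) :* ((b :* d) :* i)) refl
         (sign (k * δ p)) (sign (k * δ e)) (o ^ℚ δ p) (o ^ℚ δ e) (o ⁻¹) ⟩
  τ p k *ℚ η e k ∎
  where
  open ≡-Reasoning
  open ℚ.+-*-Solver
  k = suc k′
  o = odd k

τ-1 : ∀ k → τ 1 k ≡ sign k *ℚ odd k
τ-1 k = cong₂ _*ℚ_ (cong sign (ℕ.*-identityʳ k)) (ℚ.*-identityʳ (odd k))

η-0 : ∀ k → η 0 (suc k) ≡ odd (suc k)
η-0 k′ = begin
  sign (k * 2) *ℚ (o *ℚ (o *ℚ 1ℚ)) *ℚ o ⁻¹
    ≡⟨ cong (λ t → t *ℚ (o *ℚ (o *ℚ 1ℚ)) *ℚ o ⁻¹)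
         (trans (cong sign (trans (ℕ.*-comm k 2) (cong (λ t → k + t) (ℕ.+-identityʳ k)))) (trans (ℚ-Exp.^-homo-* (-ℚ 1ℚ) k k) (sign² k))) ⟩
  1ℚ *ℚ (o *ℚ (o *ℚ 1ℚ)) *ℚ o ⁻¹
    ≡⟨ solve 2 (λ o i → con 1ℚ :* (o :* (o :* con 1ℚ)) :* i := o :* (o :* i)) refl o (o ⁻¹) ⟩
  o *ℚ (o *ℚ o ⁻¹)
    ≡⟨ cong (o *ℚ_) (odd-inverse k′) ⟩
  o *ℚ 1ℚ
    ≡⟨ ℚ.*-identityʳ o ⟩
  o ∎
  where
  open ≡-Reasoning
  open ℚ.+-*-Solver
  k = suc k′
  o = odd k

τ-≥3 : ∀ r k → τ (3 + r) k ≡ 1ℚ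
τ-≥3 r k = cong (λ t → sign t *ℚ 1ℚ) (ℕ.*-zeroʳ k)

-- Summing over the outer variable k of V# turns the weight η c k into the power (2n-1)^(2-c).

kernel-sum : ∀ c → 1 ≤ c → c ≢ 2 → ∀ n m j → n ≡ suc m + j →
  τ c (suc m) *ℚ ∑ℚ (upTo (suc j)) (λ i → bin n (suc m + i) *ℚ (sign (suc m + i) *ℚ η c (suc m + i))
                                           *ℚ V# (suc m + i) (suc m) (replicate (c ∸ 3) 1))
    ≡ odd² n *ℚ odd n ^ᶻ (ℤ.- (+ c)) *ℚ (sign (suc m) *ℚ bin n (suc m))
kernel-sum zero () _
kernel-sum (suc (suc zero)) _ c≢2 = contradiction refl c≢2
-- For c = 1 the sign inside `η` cancels the explicit one, so the sum does not alternate and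
-- `doubled-odd-bin-sum` evaluates it.
kernel-sum (suc zero) _ _ n m′ j n≡m+j = begin
  τ 1 m *ℚ ∑ℚ (upTo (suc j)) (λ i → b i *ℚ (sign (m + i) *ℚ η 1 (m + i)) *ℚ V# (m + i) m [])
    ≡⟨ cong₂ _*ℚ_ (τ-1 m) (trans (∑ℚ.∑-cong (upTo (suc j)) term) (∑ℚ.∑-*ʳ (upTo (suc j)) (o ⁻¹) (λ i → d i *ℚ (odd (m + i) *ℚ b i)))) ⟩
  (sign m *ℚ o) *ℚ (∑ℚ (upTo (suc j)) (λ i → d i *ℚ (odd (m + i) *ℚ b i)) *ℚ o ⁻¹)
    ≡⟨ cong (λ t → (sign m *ℚ o) *ℚ (t *ℚ o ⁻¹)) (doubled-odd-bin-sum n m j n≡m+j) ⟩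
  (sign m *ℚ o) *ℚ ((odd n *ℚ bin n m) *ℚ o ⁻¹)
    ≡⟨ solve 5 (λ s o ν b i → (s :* o) :* ((ν :* b) :* i) := (ν :* (s :* b)) :* (o :* i)) refl (sign m) o (odd n) (bin n m) (o ⁻¹) ⟩
  (odd n *ℚ (sign m *ℚ bin n m)) *ℚ (o *ℚ o ⁻¹)
    ≡⟨ cong ((odd n *ℚ (sign m *ℚ bin n m)) *ℚ_) (trans (odd-inverse m′) (sym n-inverse)) ⟩
  (odd n *ℚ (sign m *ℚ bin n m)) *ℚ (odd n *ℚ odd n ⁻¹)
    ≡⟨ solve 3 (λ ν x i → (ν :* x) :* (ν :* i) := (ν :* ν) :* (i :* con 1ℚ) :* x) refl (odd n) (sign m *ℚ bin n m) (odd n ⁻¹) ⟩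
  odd² n *ℚ odd n ^ᶻ (ℤ.- (+ 1)) *ℚ (sign m *ℚ bin n m) ∎
  where
  open ≡-Reasoning
  open ℚ.+-*-Solver
  m = suc m′
  o = odd m
  b d : ℕ → ℚ
  b i = bin n (m + i)
  d i = ⟪ 2 ⟫ ^ℚ △ (m + i) m
  n-inverse : odd n *ℚ odd n ⁻¹ ≡ 1ℚ
  n-inverse = subst (λ t → odd t *ℚ odd t ⁻¹ ≡ 1ℚ) (sym n≡m+j) (odd-inverse (m′ + j))
  term : ∀ i → b i *ℚ (sign (m + i) *ℚ η 1 (m + i)) *ℚ V# (m + i) m [] ≡ (d i *ℚ (odd (m + i) *ℚ b i)) *ℚ o ⁻¹
  term i = begin
    b i *ℚ (s *ℚ η 1 (m + i)) *ℚ V# (m + i) m []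
      ≡⟨ cong₂ (λ t v → b i *ℚ (s *ℚ (t *ℚ ok ⁻¹)) *ℚ v) (τ-1 (m + i))
           (trans (V#≡W m′ i []) (cong (ok *ℚ o ⁻¹ *ℚ_) (W-[] (m + i) m))) ⟩
    b i *ℚ (s *ℚ (s *ℚ ok *ℚ ok ⁻¹)) *ℚ (ok *ℚ o ⁻¹ *ℚ d i)
      ≡⟨ solve 6 (λ b s k l o d → b :* (s :* (s :* k :* l)) :* (k :* o :* d) := (s :* s) :* (k :* l) :* ((d :* (k :* b)) :* o))
           refl (b i) s ok (ok ⁻¹) (o ⁻¹) (d i) ⟩
    (s *ℚ s) *ℚ (ok *ℚ ok ⁻¹) *ℚ ((d i *ℚ (ok *ℚ b i)) *ℚ o ⁻¹)
      ≡⟨ cong₂ (λ t v → t *ℚ v *ℚ ((d i *ℚ (ok *ℚ b i)) *ℚ o ⁻¹)) (sign² (m + i)) (odd-inverse (m′ + i)) ⟩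
    1ℚ *ℚ 1ℚ *ℚ ((d i *ℚ (ok *ℚ b i)) *ℚ o ⁻¹)
      ≡⟨ ℚ.*-identityˡ ((d i *ℚ (ok *ℚ b i)) *ℚ o ⁻¹) ⟩
    (d i *ℚ (ok *ℚ b i)) *ℚ o ⁻¹ ∎
    where
    s = sign (m + i)
    ok = odd (m + i)
-- For c ≥ 3 `η` is 1/(2k-1), which cancels the factor 2k-1 of V#. The sign survives, and
-- `sign-bin-W-sum` applies with r = c-3.
kernel-sum (suc (suc (suc r))) _ _ n m′ j n≡m+j = begin
  τ (3 + r) m *ℚ ∑ℚ (upTo (suc j)) (λ i → b i *ℚ (sign (m + i) *ℚ η (3 + r) (m + i)) *ℚ V# (m + i) m (replicate r 1))
    ≡⟨ cong₂ _*ℚ_ (τ-≥3 r m) (trans (∑ℚ.∑-cong (upTo (suc j)) term) (∑ℚ.∑-*ʳ (upTo (suc j)) (o ⁻¹) (λ i → sign (m + i) *ℚ b i *ℚ w i))) ⟩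
  1ℚ *ℚ (S *ℚ o ⁻¹)
    ≡⟨ ℚ.*-identityˡ (S *ℚ o ⁻¹) ⟩
  S *ℚ o ⁻¹
    ≡⟨ cong (_*ℚ o ⁻¹) (sym (trans (cong (_*ℚ S) (power-inverse (suc r))) (ℚ.*-identityˡ S))) ⟩
  odd n ⁻¹ ^ℚ suc r *ℚ odd n ^ℚ suc r *ℚ S *ℚ o ⁻¹
    ≡⟨ cong (_*ℚ o ⁻¹) (trans (ℚ.*-assoc (odd n ⁻¹ ^ℚ suc r) (odd n ^ℚ suc r) S) (cong (odd n ⁻¹ ^ℚ suc r *ℚ_) (sign-bin-W-sum r n m′ j n≡m+j))) ⟩
  odd n ⁻¹ ^ℚ suc r *ℚ (sign m *ℚ (o *ℚ bin n m)) *ℚ o ⁻¹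
    ≡⟨ solve 5 (λ p s o b i → p :* (s :* (o :* b)) :* i := (o :* i) :* (p :* (s :* b))) refl (odd n ⁻¹ ^ℚ suc r) (sign m) o (bin n m) (o ⁻¹) ⟩
  (o *ℚ o ⁻¹) *ℚ (odd n ⁻¹ ^ℚ suc r *ℚ (sign m *ℚ bin n m))
    -- The factor 1 is traded for (2n-1)^(-2) (2n-1)² to reach the exponent -(3+r) together with the
    -- factor (2n-1)² of the recursion.
    ≡⟨ cong (_*ℚ (odd n ⁻¹ ^ℚ suc r *ℚ (sign m *ℚ bin n m))) (trans (odd-inverse m′) (sym (power-inverse 2))) ⟩
  (odd n ⁻¹ ^ℚ 2 *ℚ odd n ^ℚ 2) *ℚ (odd n ⁻¹ ^ℚ suc r *ℚ (sign m *ℚ bin n m))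
    ≡⟨ solve 4 (λ i ν p x → ((i :* (i :* con 1ℚ)) :* (ν :* (ν :* con 1ℚ))) :* (p :* x) := (ν :* ν) :* (i :* (i :* p)) :* x)
         refl (odd n ⁻¹) (odd n) (odd n ⁻¹ ^ℚ suc r) (sign m *ℚ bin n m) ⟩
  odd² n *ℚ odd n ^ᶻ (ℤ.- (+ (3 + r))) *ℚ (sign m *ℚ bin n m) ∎
  where
  open ≡-Reasoning
  open ℚ.+-*-Solver
  m = suc m′
  o = odd m
  b w : ℕ → ℚ
  b i = bin n (m + i)
  w i = W (m + i) m (replicate r 1)
  S = ∑ℚ (upTo (suc j)) (λ i → sign (m + i) *ℚ b i *ℚ w i)
  power-inverse : ∀ a → odd n ⁻¹ ^ℚ a *ℚ odd n ^ℚ a ≡ 1ℚ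
  power-inverse zero    = refl
  power-inverse (suc a) = begin
    (odd n ⁻¹ *ℚ odd n ⁻¹ ^ℚ a) *ℚ (odd n *ℚ odd n ^ℚ a)
      ≡⟨ solve 4 (λ i x o y → (i :* x) :* (o :* y) := (o :* i) :* (x :* y)) refl (odd n ⁻¹) (odd n ⁻¹ ^ℚ a) (odd n) (odd n ^ℚ a) ⟩
    (odd n *ℚ odd n ⁻¹) *ℚ (odd n ⁻¹ ^ℚ a *ℚ odd n ^ℚ a)
      ≡⟨ cong₂ _*ℚ_ (subst (λ t → odd t *ℚ odd t ⁻¹ ≡ 1ℚ) (sym n≡m+j) (odd-inverse (m′ + j))) (power-inverse a) ⟩
    1ℚ ∎
  term : ∀ i → b i *ℚ (sign (m + i) *ℚ η (3 + r) (m + i)) *ℚ V# (m + i) m (replicate r 1) ≡ (sign (m + i) *ℚ b i *ℚ w i) *ℚ o ⁻¹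
  term i = begin
    b i *ℚ (s *ℚ η (3 + r) (m + i)) *ℚ V# (m + i) m (replicate r 1)
      ≡⟨ cong₂ (λ t v → b i *ℚ (s *ℚ (t *ℚ ok ⁻¹)) *ℚ v) (τ-≥3 r (m + i)) (V#≡W m′ i (replicate r 1)) ⟩
    b i *ℚ (s *ℚ (1ℚ *ℚ ok ⁻¹)) *ℚ (ok *ℚ o ⁻¹ *ℚ w i)
      ≡⟨ solve 6 (λ b s k l o w → b :* (s :* (con 1ℚ :* l)) :* (k :* o :* w) := (k :* l) :* ((s :* b :* w) :* o))
           refl (b i) s ok (ok ⁻¹) (o ⁻¹) (w i) ⟩
    (ok *ℚ ok ⁻¹) *ℚ ((s *ℚ b i *ℚ w i) *ℚ o ⁻¹)
      ≡⟨ cong (_*ℚ ((s *ℚ b i *ℚ w i) *ℚ o ⁻¹)) (odd-inverse (m′ + i)) ⟩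
    1ℚ *ℚ ((s *ℚ b i *ℚ w i) *ℚ o ⁻¹)
      ≡⟨ ℚ.*-identityˡ ((s *ℚ b i *ℚ w i) *ℚ o ⁻¹) ⟩
    (s *ℚ b i *ℚ w i) *ℚ o ⁻¹ ∎
    where
    s = sign (m + i)
    ok = odd (m + i)

-- The closed form over the Gaussian rationals

module ᵍ = IsCommutativeRing ᵍ-isCommutativeRing

pole : ℕ → ℚ[i] → ℚ[i]
pole k z = conj/norm² (fromℚ (odd k ^ℚ 2) -ᵍ z ^ᵍ 2)

-- A hypothesis, since `pole` is total and is not an inverse where its denominator is 0, as may
-- happen for an approximation outside the disc.
Regular : ℚ[i] → Set
Regular z = ∀ k → (fromℚ (odd² k) -ᵍ z *ᵍ z) *ᵍ pole k z ≡ 1ᵍ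

-- The arguments stand for cᵢ, cᵢ₊₁, kᵢ₋₁, kᵢ and zᵢ.
factor : ℕ → ℕ → ℕ → ℕ → ℚ[i] → ℚ[i]
factor p e kp k z =
  fromℚ ((-ℚ 1ℚ) ^ℚ (k * (δ p + δ e)) *ℚ odd k ^ᶻ (+ (δ p + δ e) -ℤ 1ℤ)) *ᵍ pole k z *ᵍ fromℚ (V# kp k (replicate (p ∸ 3) 1))

next : ∀ {d} → Vec ℕ d → ℕ
next []      = 0
next (c ∷ _) = c

inner : ∀ {d} → Vec ℕ d → Vec ℚ[i] d → ℕ → ℚ[i]
inner []       []       k = 1ᵍ
inner (c ∷ cs) (z ∷ zs) k = ∑ᵍ (upTo k) λ i →
  fromℚ (τ c (suc i) *ℚ η (next cs) (suc i) *ℚ V# k (suc i) (replicate (c ∸ 3) 1)) *ᵍ (pole (suc i) z *ᵍ inner cs zs (suc i))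

-- The constant -2 comes from the fictitious k₋₁ = 0: since 2·0 - 1 = -1, `V#` equals -2/(2k₀-1)
-- there, and `τ` for c₀ = 1 cancels the denominator and contributes the explicit sign.
coef : ℕ → ℕ → ℕ → ℚ
coef n e k = prefactor n *ℚ (bin n k *ℚ (-ℚ ⟪ 2 ⟫ *ℚ (sign k *ℚ η e k)))

closed : ∀ {d} → ℕ → Vec ℕ d → Vec ℚ[i] (suc d) → ℚ[i]
closed n c (z ∷ zs) = ∑ᵍ (upTo n) λ i → fromℚ (coef n (next c) (suc i)) *ᵍ (pole (suc i) z *ᵍ inner c zs (suc i))

factor-inner : ∀ p e kp k′ z → let k = suc k′ in
  factor p e kp k z ≡ fromℚ (τ p k *ℚ η e k *ℚ V# kp k (replicate (p ∸ 3) 1)) *ᵍ pole k z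
factor-inner p e kp k′ z = begin
  factor p e kp k z
    ≡⟨ cong (λ t → fromℚ t *ᵍ pole k z *ᵍ fromℚ v) (τ*η p e k′) ⟩
  fromℚ (τ p k *ℚ η e k) *ᵍ pole k z *ᵍ fromℚ v
    ≡⟨ solve 3 (λ a u v → a :* u :* v := (a :* v) :* u) refl (fromℚ (τ p k *ℚ η e k)) (pole k z) (fromℚ v) ⟩
  (fromℚ (τ p k *ℚ η e k) *ᵍ fromℚ v) *ᵍ pole k z
    ≡⟨ cong (_*ᵍ pole k z) (sym (fromℚ-* (τ p k *ℚ η e k) v)) ⟩
  fromℚ (τ p k *ℚ η e k *ℚ v) *ᵍ pole k z ∎
  where
  open ≡-Reasoning
  open ᵍ-Solver
  k = suc k′
  v = V# kp k (replicate (p ∸ 3) 1)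

factor-first : ∀ e k′ z → let k = suc k′ in
  factor 1 e 0 k z ≡ fromℚ (-ℚ ⟪ 2 ⟫ *ℚ (sign k *ℚ η e k)) *ᵍ pole k z
factor-first e k′ z = trans (factor-inner 1 e 0 k′ z) (cong (λ t → fromℚ t *ᵍ pole k z) (begin
  τ 1 k *ℚ η e k *ℚ (⟪ 2 ⟫ *ℚ (-ℚ 1ℚ *ℚ odd k ⁻¹) *ℚ 1ℚ)
    ≡⟨ cong (λ t → t *ℚ η e k *ℚ (⟪ 2 ⟫ *ℚ (-ℚ 1ℚ *ℚ odd k ⁻¹) *ℚ 1ℚ)) (τ-1 k) ⟩
  sign k *ℚ odd k *ℚ η e k *ℚ (⟪ 2 ⟫ *ℚ (-ℚ 1ℚ *ℚ odd k ⁻¹) *ℚ 1ℚ)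
    ≡⟨ solve 4 (λ s o h i → s :* o :* h :* (con ⟪ 2 ⟫ :* (con (-ℚ 1ℚ) :* i) :* con 1ℚ) := (con (-ℚ ⟪ 2 ⟫) :* (s :* h)) :* (o :* i))
         refl (sign k) (odd k) (η e k) (odd k ⁻¹) ⟩
  -ℚ ⟪ 2 ⟫ *ℚ (sign k *ℚ η e k) *ℚ (odd k *ℚ odd k ⁻¹)
    ≡⟨ trans (cong (-ℚ ⟪ 2 ⟫ *ℚ (sign k *ℚ η e k) *ℚ_) (odd-inverse k′)) (ℚ.*-identityʳ (-ℚ ⟪ 2 ⟫ *ℚ (sign k *ℚ η e k))) ⟩
  -ℚ ⟪ 2 ⟫ *ℚ (sign k *ℚ η e k) ∎))
  where
  open ≡-Reasoning
  open ℚ.+-*-Solver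
  k = suc k′

factors : ∀ {d} → ℕ → Vec ℕ d → ℕ → Vec ℕ (suc d) → Vec ℚ[i] (suc d) → ℚ[i]
factors p c kp k z = ∏ᵍ λ i → factor (lookup (p ∷ c) i) (lookup (c ∷ʳ 0) i) (lookup (kp ∷ k) (inject₁ i)) (lookup k i) (lookup z i)

-- `g` carries the weight of the outermost variable. Once that variable is split off, the induction
-- continues with the constant weight 1.
chain-sum : ∀ {d} p (c : Vec ℕ d) kp n z zs (g : ℕ → ℚ[i]) →
  ∑ᵍ (chains n 1 (suc d)) (λ k → g (lookup k zero) *ᵍ factors p c kp k (z ∷ zs))
    ≡ ∑ᵍ (upTo n) (λ i → g (suc i) *ᵍ (factor p (next c) kp (suc i) z *ᵍ inner c zs (suc i)))
chain-sum p [] kp n z [] g = trans (∑ᵍ.∑-chains n 1 0 (λ k → g (lookup k zero) *ᵍ factors p [] kp k (z ∷ [])))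
  (∑ᵍ.∑-cong (upTo n) λ i → ᵍ.+-identityʳ (g (suc i) *ᵍ (factor p 0 kp (suc i) z *ᵍ 1ᵍ)))
chain-sum {suc d} p (c ∷ cs) kp n z (z′ ∷ zs) g = trans (∑ᵍ.∑-chains n 1 (suc d) (λ k → g (lookup k zero) *ᵍ factors p (c ∷ cs) kp k (z ∷ z′ ∷ zs)))
  (∑ᵍ.∑-cong (upTo n) λ i → begin
    ∑ᵍ (chains (suc i) 1 (suc d)) (λ k → g (suc i) *ᵍ (F i *ᵍ factors c cs (suc i) k (z′ ∷ zs)))
      ≡⟨ ∑ᵍ.∑-cong (chains (suc i) 1 (suc d)) (λ k → solve 3 (λ g f r → g :* (f :* r) := (g :* f) :* (con 1ᵍ :* r)) refl
           (g (suc i)) (F i) (factors c cs (suc i) k (z′ ∷ zs))) ⟩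
    ∑ᵍ (chains (suc i) 1 (suc d)) (λ k → (g (suc i) *ᵍ F i) *ᵍ (1ᵍ *ᵍ factors c cs (suc i) k (z′ ∷ zs)))
      ≡⟨ ∑ᵍ.∑-*ˡ (chains (suc i) 1 (suc d)) (g (suc i) *ᵍ F i) (λ k → 1ᵍ *ᵍ factors c cs (suc i) k (z′ ∷ zs)) ⟩
    (g (suc i) *ᵍ F i) *ᵍ ∑ᵍ (chains (suc i) 1 (suc d)) (λ k → 1ᵍ *ᵍ factors c cs (suc i) k (z′ ∷ zs))
      ≡⟨ cong ((g (suc i) *ᵍ F i) *ᵍ_) (trans (chain-sum c cs (suc i) (suc i) z′ zs (λ _ → 1ᵍ)) (∑ᵍ.∑-cong (upTo (suc i)) (simplify i))) ⟩
    (g (suc i) *ᵍ F i) *ᵍ inner (c ∷ cs) (z′ ∷ zs) (suc i)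
      ≡⟨ ᵍ.*-assoc (g (suc i)) (F i) (inner (c ∷ cs) (z′ ∷ zs) (suc i)) ⟩
    g (suc i) *ᵍ (F i *ᵍ inner (c ∷ cs) (z′ ∷ zs) (suc i)) ∎)
  where
  open ≡-Reasoning
  open ᵍ-Solver
  F : ℕ → ℚ[i]
  F i = factor p c kp (suc i) z
  simplify : ∀ i l → 1ᵍ *ᵍ (factor c (next cs) (suc i) (suc l) z′ *ᵍ inner cs zs (suc l))
    ≡ fromℚ (τ c (suc l) *ℚ η (next cs) (suc l) *ℚ V# (suc i) (suc l) (replicate (c ∸ 3) 1)) *ᵍ (pole (suc l) z′ *ᵍ inner cs zs (suc l))
  simplify i l = trans (ᵍ.*-identityˡ (factor c (next cs) (suc i) (suc l) z′ *ᵍ inner cs zs (suc l)))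
    (trans (cong (_*ᵍ inner cs zs (suc l)) (factor-inner c (next cs) (suc i) l z′))
           (ᵍ.*-assoc (fromℚ (τ c (suc l) *ℚ η (next cs) (suc l) *ℚ V# (suc i) (suc l) (replicate (c ∸ 3) 1))) (pole (suc l) z′) (inner cs zs (suc l))))

closed≡ : ∀ {d} n (c : Vec ℕ d) z →
  fromℚ (prefactor n) *ᵍ ∑ᵍ (chains n 1 (suc d)) (λ k → fromℚ (bin n (lookup k zero)) *ᵍ factors 1 c 0 k z) ≡ closed n c z
closed≡ n c (z ∷ zs) = begin
  fromℚ (prefactor n) *ᵍ ∑ᵍ (chains n 1 _) (λ k → fromℚ (bin n (lookup k zero)) *ᵍ factors 1 c 0 k (z ∷ zs))
    ≡⟨ cong (fromℚ (prefactor n) *ᵍ_) (chain-sum 1 c 0 n z zs (λ k → fromℚ (bin n k))) ⟩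
  fromℚ (prefactor n) *ᵍ ∑ᵍ (upTo n) (λ i → fromℚ (bin n (suc i)) *ᵍ (factor 1 (next c) 0 (suc i) z *ᵍ inner c zs (suc i)))
    ≡⟨ sym (∑ᵍ.∑-*ˡ (upTo n) (fromℚ (prefactor n)) (λ i → fromℚ (bin n (suc i)) *ᵍ (factor 1 (next c) 0 (suc i) z *ᵍ inner c zs (suc i)))) ⟩
  ∑ᵍ (upTo n) (λ i → fromℚ (prefactor n) *ᵍ (fromℚ (bin n (suc i)) *ᵍ (factor 1 (next c) 0 (suc i) z *ᵍ inner c zs (suc i))))
    ≡⟨ ∑ᵍ.∑-cong (upTo n) (λ i → let h = -ℚ ⟪ 2 ⟫ *ℚ (sign (suc i) *ℚ η (next c) (suc i)) ; b = bin n (suc i) ; u = pole (suc i) z ; U = inner c zs (suc i) in begin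
         fromℚ (prefactor n) *ᵍ (fromℚ b *ᵍ (factor 1 (next c) 0 (suc i) z *ᵍ U))
           ≡⟨ cong (λ t → fromℚ (prefactor n) *ᵍ (fromℚ b *ᵍ (t *ᵍ U))) (factor-first (next c) i z) ⟩
         fromℚ (prefactor n) *ᵍ (fromℚ b *ᵍ ((fromℚ h *ᵍ u) *ᵍ U))
           ≡⟨ solve 5 (λ w b h u v → w :* (b :* ((h :* u) :* v)) := (w :* (b :* h)) :* (u :* v)) refl (fromℚ (prefactor n)) (fromℚ b) (fromℚ h) u U ⟩
         (fromℚ (prefactor n) *ᵍ (fromℚ b *ᵍ fromℚ h)) *ᵍ (u *ᵍ U)
           ≡⟨ cong (_*ᵍ (u *ᵍ U)) (sym (trans (fromℚ-* (prefactor n) (b *ℚ h)) (cong (fromℚ (prefactor n) *ᵍ_) (fromℚ-* b h)))) ⟩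
         fromℚ (coef n (next c) (suc i)) *ᵍ (u *ᵍ U) ∎) ⟩
  closed n c (z ∷ zs) ∎
  where
  open ≡-Reasoning
  open ᵍ-Solver

-- (2n-1)² - z² = ((2n-1)² - (2k-1)²) + ((2k-1)² - z²): the first part lowers n, the second removes the pole.

unpoled : ∀ {d} → ℕ → Vec ℕ d → Vec ℚ[i] d → ℚ[i]
unpoled n c zs = ∑ᵍ (upTo n) λ i → fromℚ (coef n (next c) (suc i)) *ᵍ inner c zs (suc i)

coef-rec : ∀ N e k → k ≤ suc N →
  (odd² (suc (suc N)) -ℚ odd² k) *ℚ coef (suc (suc N)) e k ≡ odd² (suc (suc N)) *ℚ coef (suc N) e k
coef-rec N e k k≤ = begin
  D *ℚ (w′ *ℚ (b′ *ℚ h))     ≡⟨ solve 4 (λ d w b h → d :* (w :* (b :* h)) := (w :* (d :* b)) :* h) refl D w′ b′ h ⟩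
  (w′ *ℚ (D *ℚ b′)) *ℚ h     ≡⟨ cong (_*ℚ h) (prefactor-bin-rec N k k≤) ⟩
  (o² *ℚ (w *ℚ b)) *ℚ h      ≡⟨ solve 4 (λ o w b h → (o :* (w :* b)) :* h := o :* (w :* (b :* h))) refl o² w b h ⟩
  o² *ℚ (w *ℚ (b *ℚ h))      ∎
  where
  open ≡-Reasoning
  open ℚ.+-*-Solver
  o² = odd² (suc (suc N))
  D = o² -ℚ odd² k
  w′ = prefactor (suc (suc N))
  w = prefactor (suc N)
  b′ = bin (suc (suc N)) k
  b = bin (suc N) k
  h = -ℚ ⟪ 2 ⟫ *ℚ (sign k *ℚ η e k)

closed-shift : ∀ {d} N (c : Vec ℕ d) z zs → Regular z →
  (fromℚ (odd² (suc N)) -ᵍ z *ᵍ z) *ᵍ closed (suc N) c (z ∷ zs)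
    ≡ unpoled (suc N) c zs +ᵍ fromℚ (odd² (suc N)) *ᵍ closed N c (z ∷ zs)
closed-shift N c z zs regular = begin
  (o² -ᵍ z *ᵍ z) *ᵍ closed n c (z ∷ zs)
    ≡⟨ sym (∑ᵍ.∑-*ˡ (upTo n) (o² -ᵍ z *ᵍ z) (λ i → a n i *ᵍ (u i *ᵍ U i))) ⟩
  ∑ᵍ (upTo n) (λ i → (o² -ᵍ z *ᵍ z) *ᵍ (a n i *ᵍ (u i *ᵍ U i)))
    ≡⟨ ∑ᵍ.∑-cong (upTo n) split ⟩
  ∑ᵍ (upTo n) (λ i → a n i *ᵍ U i +ᵍ rest i *ᵍ (u i *ᵍ U i))
    ≡⟨ ∑ᵍ.∑-+ (upTo n) (λ i → a n i *ᵍ U i) (λ i → rest i *ᵍ (u i *ᵍ U i)) ⟩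
  unpoled n c zs +ᵍ ∑ᵍ (upTo n) (λ i → rest i *ᵍ (u i *ᵍ U i))
    ≡⟨ cong (unpoled n c zs +ᵍ_) (begin
         ∑ᵍ (upTo n) (λ i → rest i *ᵍ (u i *ᵍ U i))
           ≡⟨ ∑ᵍ.∑-upTo-last N (λ i → rest i *ᵍ (u i *ᵍ U i)) ⟩
         ∑ᵍ (upTo N) (λ i → rest i *ᵍ (u i *ᵍ U i)) +ᵍ rest N *ᵍ (u N *ᵍ U N)
           ≡⟨ cong₂ _+ᵍ_ (∑ᵍ.∑-upTo-cong N lower) last-vanishes ⟩
         ∑ᵍ (upTo N) (λ i → o² *ᵍ (a N i *ᵍ (u i *ᵍ U i))) +ᵍ 0ᵍ
           ≡⟨ ᵍ.+-identityʳ (∑ᵍ (upTo N) (λ i → o² *ᵍ (a N i *ᵍ (u i *ᵍ U i)))) ⟩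
         ∑ᵍ (upTo N) (λ i → o² *ᵍ (a N i *ᵍ (u i *ᵍ U i)))
           ≡⟨ ∑ᵍ.∑-*ˡ (upTo N) o² (λ i → a N i *ᵍ (u i *ᵍ U i)) ⟩
         o² *ᵍ closed N c (z ∷ zs) ∎) ⟩
  unpoled n c zs +ᵍ o² *ᵍ closed N c (z ∷ zs) ∎
  where
  open ≡-Reasoning
  open ᵍ-Solver
  n = suc N
  o² = fromℚ (odd² n)
  u U rest : ℕ → ℚ[i]
  u i = pole (suc i) z
  U i = inner c zs (suc i)
  rest i = fromℚ ((odd² n -ℚ odd² (suc i)) *ℚ coef n (next c) (suc i))
  a : ℕ → ℕ → ℚ[i]
  a n i = fromℚ (coef n (next c) (suc i))
  split : ∀ i → (o² -ᵍ z *ᵍ z) *ᵍ (a n i *ᵍ (u i *ᵍ U i)) ≡ a n i *ᵍ U i +ᵍ rest i *ᵍ (u i *ᵍ U i)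
  split i = begin
    (o² -ᵍ x) *ᵍ (a n i *ᵍ (u i *ᵍ U i))
      ≡⟨ solve 6 (λ o k x a u v → (o :- x) :* (a :* (u :* v)) := (a :* v) :* ((k :- x) :* u) :+ ((o :- k) :* a) :* (u :* v))
           refl o² k² x (a n i) (u i) (U i) ⟩
    (a n i *ᵍ U i) *ᵍ ((k² -ᵍ x) *ᵍ u i) +ᵍ ((o² -ᵍ k²) *ᵍ a n i) *ᵍ (u i *ᵍ U i)
      ≡⟨ cong₂ (λ s t → (a n i *ᵍ U i) *ᵍ s +ᵍ t *ᵍ (u i *ᵍ U i)) (regular (suc i))
           (sym (fromℚ-* (odd² n -ℚ odd² (suc i)) (coef n (next c) (suc i)))) ⟩
    (a n i *ᵍ U i) *ᵍ 1ᵍ +ᵍ rest i *ᵍ (u i *ᵍ U i)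
      ≡⟨ cong (_+ᵍ rest i *ᵍ (u i *ᵍ U i)) (ᵍ.*-identityʳ (a n i *ᵍ U i)) ⟩
    a n i *ᵍ U i +ᵍ rest i *ᵍ (u i *ᵍ U i) ∎
    where
    x = z *ᵍ z
    k² = fromℚ (odd² (suc i))
  lower : ∀ i → i < N → rest i *ᵍ (u i *ᵍ U i) ≡ o² *ᵍ (a N i *ᵍ (u i *ᵍ U i))
  lower i i<N = trans (cong (_*ᵍ (u i *ᵍ U i)) (trans (cong fromℚ (rational N i<N)) (fromℚ-* (odd² n) (coef N (next c) (suc i)))))
    (ᵍ.*-assoc o² (a N i) (u i *ᵍ U i))
    where
    rational : ∀ N → i < N → (odd² (suc N) -ℚ odd² (suc i)) *ℚ coef (suc N) (next c) (suc i) ≡ odd² (suc N) *ℚ coef N (next c) (suc i)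
    rational (suc N) i<N = coef-rec N (next c) (suc i) i<N
  -- At k = n the difference of squares is 0, which shortens the sum to the range of `closed N`.
  last-vanishes : rest N *ᵍ (u N *ᵍ U N) ≡ 0ᵍ
  last-vanishes = trans (cong (λ t → fromℚ t *ᵍ (u N *ᵍ U N))
      (trans (cong (_*ℚ coef n (next c) n) (ℚ.+-inverseʳ (odd² n))) (ℚ.*-zeroˡ (coef n (next c) n))))
    (ᵍ.zeroˡ (u N *ᵍ U N))

-- The closing weight `η 0` is 2k-1, so this is the alternating sum that vanishes for n ≥ 2.
unpoled-[] : ∀ N → unpoled (suc (suc N)) [] [] ≡ 0ᵍ
unpoled-[] N = begin
  ∑ᵍ (upTo n) (λ i → fromℚ (coef n 0 (suc i)) *ᵍ 1ᵍ)
    ≡⟨ ∑ᵍ.∑-cong (upTo n) (λ i → trans (ᵍ.*-identityʳ (fromℚ (coef n 0 (suc i)))) (cong fromℚ (term i))) ⟩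
  ∑ᵍ (upTo n) (λ i → fromℚ ((-ℚ ⟪ 2 ⟫ *ℚ prefactor n) *ℚ (sign (suc i) *ℚ (odd (suc i) *ℚ bin n (suc i)))))
    ≡⟨ sym (fromℚ-∑ (upTo n) (λ i → (-ℚ ⟪ 2 ⟫ *ℚ prefactor n) *ℚ (sign (suc i) *ℚ (odd (suc i) *ℚ bin n (suc i))))) ⟩
  fromℚ (∑ℚ (upTo n) (λ i → (-ℚ ⟪ 2 ⟫ *ℚ prefactor n) *ℚ (sign (suc i) *ℚ (odd (suc i) *ℚ bin n (suc i)))))
    ≡⟨ cong fromℚ (trans (∑ℚ.∑-*ˡ (upTo n) (-ℚ ⟪ 2 ⟫ *ℚ prefactor n) (λ i → sign (suc i) *ℚ (odd (suc i) *ℚ bin n (suc i))))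
         (trans (cong (-ℚ ⟪ 2 ⟫ *ℚ prefactor n *ℚ_) (alternating-odd-bin-sum N)) (ℚ.*-zeroʳ (-ℚ ⟪ 2 ⟫ *ℚ prefactor n)))) ⟩
  0ᵍ ∎
  where
  open ≡-Reasoning
  open ℚ.+-*-Solver
  n = suc (suc N)
  term : ∀ i → coef n 0 (suc i) ≡ (-ℚ ⟪ 2 ⟫ *ℚ prefactor n) *ℚ (sign (suc i) *ℚ (odd (suc i) *ℚ bin n (suc i)))
  term i = trans (cong (λ t → prefactor n *ℚ (bin n (suc i) *ℚ (-ℚ ⟪ 2 ⟫ *ℚ (sign (suc i) *ℚ t)))) (η-0 i))
    (solve 4 (λ w b s o → w :* (b :* (con (-ℚ ⟪ 2 ⟫) :* (s :* o))) := (con (-ℚ ⟪ 2 ⟫) :* w) :* (s :* (o :* b)))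
       refl (prefactor n) (bin n (suc i)) (sign (suc i)) (odd (suc i)))

column-sum : ∀ c → 1 ≤ c → c ≢ 2 → ∀ e n m j → n ≡ suc m + j →
  ∑ℚ (upTo (suc j)) (λ i → coef n c (suc m + i) *ℚ (τ c (suc m) *ℚ η e (suc m) *ℚ V# (suc m + i) (suc m) (replicate (c ∸ 3) 1)))
    ≡ odd² n *ℚ odd n ^ᶻ (ℤ.- (+ c)) *ℚ coef n e (suc m)
column-sum c 1≤c c≢2 e n m′ j n≡m+j = begin
  ∑ℚ (upTo (suc j)) (λ i → coef n c (m + i) *ℚ (τ c m *ℚ η e m *ℚ V i))
    ≡⟨ ∑ℚ.∑-cong (upTo (suc j)) (λ i →
         solve 7 (λ w b s h t g v → (w :* (b :* (con (-ℚ ⟪ 2 ⟫) :* (s :* h)))) :* (t :* g :* v)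
           := (w :* (con (-ℚ ⟪ 2 ⟫) :* g) :* t) :* (b :* (s :* h) :* v)) refl
           w (bin n (m + i)) (sign (m + i)) (η c (m + i)) (τ c m) (η e m) (V i)) ⟩
  ∑ℚ (upTo (suc j)) (λ i → (w *ℚ (-ℚ ⟪ 2 ⟫ *ℚ η e m) *ℚ τ c m) *ℚ term i)
    ≡⟨ ∑ℚ.∑-*ˡ (upTo (suc j)) (w *ℚ (-ℚ ⟪ 2 ⟫ *ℚ η e m) *ℚ τ c m) term ⟩
  (w *ℚ (-ℚ ⟪ 2 ⟫ *ℚ η e m) *ℚ τ c m) *ℚ ∑ℚ (upTo (suc j)) term
    ≡⟨ ℚ.*-assoc (w *ℚ (-ℚ ⟪ 2 ⟫ *ℚ η e m)) (τ c m) (∑ℚ (upTo (suc j)) term) ⟩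
  (w *ℚ (-ℚ ⟪ 2 ⟫ *ℚ η e m)) *ℚ (τ c m *ℚ ∑ℚ (upTo (suc j)) term)
    ≡⟨ cong ((w *ℚ (-ℚ ⟪ 2 ⟫ *ℚ η e m)) *ℚ_) (kernel-sum c 1≤c c≢2 n m′ j n≡m+j) ⟩
  (w *ℚ (-ℚ ⟪ 2 ⟫ *ℚ η e m)) *ℚ (y *ℚ (sign m *ℚ bin n m))
    ≡⟨ solve 5 (λ w g y s b → (w :* (con (-ℚ ⟪ 2 ⟫) :* g)) :* (y :* (s :* b)) := y :* (w :* (b :* (con (-ℚ ⟪ 2 ⟫) :* (s :* g)))))
         refl w (η e m) y (sign m) (bin n m) ⟩
  y *ℚ coef n e m ∎
  where
  open ≡-Reasoning
  open ℚ.+-*-Solver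
  m = suc m′
  w = prefactor n
  y = odd² n *ℚ odd n ^ᶻ (ℤ.- (+ c))
  V term : ℕ → ℚ
  V i = V# (m + i) m (replicate (c ∸ 3) 1)
  term i = bin n (m + i) *ℚ (sign (m + i) *ℚ η c (m + i)) *ℚ V i

-- Without its denominator, k₀ is coupled to the rest by V# alone. Summing over k₀ first for fixed
-- k₁ gives, by `kernel-sum`, the coefficient of k₁ in the closed form for `cs`: k₁ has become the
-- outermost variable.
unpoled-∷ : ∀ {d} n c (cs : Vec ℕ d) z zs → 1 ≤ c → c ≢ 2 →
  unpoled n (c ∷ cs) (z ∷ zs) ≡ fromℚ (odd² n *ℚ odd n ^ᶻ (ℤ.- (+ c))) *ᵍ closed n cs (z ∷ zs)
unpoled-∷ n c cs z zs 1≤c c≢2 = begin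
  ∑ᵍ (upTo n) (λ k → fromℚ (coef n c (suc k)) *ᵍ ∑ᵍ (upTo (suc k)) (λ l → fromℚ (v k l) *ᵍ X l))
    ≡⟨ ∑ᵍ.∑-cong (upTo n) (λ k → sym (∑ᵍ.∑-*ˡ (upTo (suc k)) (fromℚ (coef n c (suc k))) (λ l → fromℚ (v k l) *ᵍ X l))) ⟩
  ∑ᵍ (upTo n) (λ k → ∑ᵍ (upTo (suc k)) (λ l → fromℚ (coef n c (suc k)) *ᵍ (fromℚ (v k l) *ᵍ X l)))
    ≡⟨ ∑ᵍ.∑-triangle n (λ k l → fromℚ (coef n c (suc k)) *ᵍ (fromℚ (v k l) *ᵍ X l)) ⟩
  ∑ᵍ (upTo n) (λ l → ∑ᵍ (upTo (n ∸ l)) (λ i → fromℚ (coef n c (suc (l + i))) *ᵍ (fromℚ (v (l + i) l) *ᵍ X l)))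
    ≡⟨ ∑ᵍ.∑-upTo-cong n column ⟩
  ∑ᵍ (upTo n) (λ l → fromℚ y *ᵍ (fromℚ (coef n (next cs) (suc l)) *ᵍ X l))
    ≡⟨ ∑ᵍ.∑-*ˡ (upTo n) (fromℚ y) (λ l → fromℚ (coef n (next cs) (suc l)) *ᵍ X l) ⟩
  fromℚ y *ᵍ closed n cs (z ∷ zs) ∎
  where
  open ≡-Reasoning
  y = odd² n *ℚ odd n ^ᶻ (ℤ.- (+ c))
  v : ℕ → ℕ → ℚ
  v k l = τ c (suc l) *ℚ η (next cs) (suc l) *ℚ V# (suc k) (suc l) (replicate (c ∸ 3) 1)
  X : ℕ → ℚ[i]
  X l = pole (suc l) z *ᵍ inner cs zs (suc l)
  column : ∀ l → l < n → ∑ᵍ (upTo (n ∸ l)) (λ i → fromℚ (coef n c (suc (l + i))) *ᵍ (fromℚ (v (l + i) l) *ᵍ X l))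
    ≡ fromℚ y *ᵍ (fromℚ (coef n (next cs) (suc l)) *ᵍ X l)
  column l l<n = begin
    ∑ᵍ (upTo (n ∸ l)) (λ i → fromℚ (coef n c (suc (l + i))) *ᵍ (fromℚ (v (l + i) l) *ᵍ X l))
      ≡⟨ ∑ᵍ.∑-cong (upTo (n ∸ l)) (λ i → trans (sym (ᵍ.*-assoc (fromℚ (coef n c (suc (l + i)))) (fromℚ (v (l + i) l)) (X l)))
           (cong (_*ᵍ X l) (sym (fromℚ-* (coef n c (suc (l + i))) (v (l + i) l))))) ⟩
    ∑ᵍ (upTo (n ∸ l)) (λ i → fromℚ (coef n c (suc (l + i)) *ℚ v (l + i) l) *ᵍ X l)
      ≡⟨ ∑ᵍ.∑-*ʳ (upTo (n ∸ l)) (X l) (λ i → fromℚ (coef n c (suc (l + i)) *ℚ v (l + i) l)) ⟩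
    ∑ᵍ (upTo (n ∸ l)) (λ i → fromℚ (coef n c (suc (l + i)) *ℚ v (l + i) l)) *ᵍ X l
      ≡⟨ cong (_*ᵍ X l) (sym (fromℚ-∑ (upTo (n ∸ l)) (λ i → coef n c (suc (l + i)) *ℚ v (l + i) l))) ⟩
    fromℚ (∑ℚ (upTo (n ∸ l)) (λ i → coef n c (suc (l + i)) *ℚ v (l + i) l)) *ᵍ X l
      ≡⟨ cong (λ t → fromℚ (∑ℚ (upTo t) (λ i → coef n c (suc (l + i)) *ℚ v (l + i) l)) *ᵍ X l) (ℕ.+-∸-assoc 1 l<n) ⟩
    fromℚ (∑ℚ (upTo (suc (n ∸ suc l))) (λ i → coef n c (suc (l + i)) *ℚ v (l + i) l)) *ᵍ X l
      ≡⟨ cong (λ t → fromℚ t *ᵍ X l) (column-sum c 1≤c c≢2 (next cs) n l (n ∸ suc l) (sym (ℕ.m+[n∸m]≡n l<n))) ⟩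
    fromℚ (y *ℚ coef n (next cs) (suc l)) *ᵍ X l
      ≡⟨ cong (_*ᵍ X l) (fromℚ-* y (coef n (next cs) (suc l))) ⟩
    (fromℚ y *ᵍ fromℚ (coef n (next cs) (suc l))) *ᵍ X l
      ≡⟨ ᵍ.*-assoc (fromℚ y) (fromℚ (coef n (next cs) (suc l))) (X l) ⟩
    fromℚ y *ᵍ (fromℚ (coef n (next cs) (suc l)) *ᵍ X l) ∎

-- The closed form, with its generating-function value 1 at n = 0 for empty c (where the formula gives 0).

limit : ∀ {d} → ℕ → Vec ℕ d → Vec ℚ[i] (suc d) → ℚ[i]
limit zero    []      _ = 1ᵍ
limit zero    (_ ∷ _) _ = 0ᵍ
limit (suc N) c       z = closed (suc N) c z

limit-rec-[] : ∀ N z → Regular z →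
  (fromℚ (odd² (suc N)) -ᵍ z *ᵍ z) *ᵍ limit (suc N) [] (z ∷ []) ≡ fromℚ (odd² (suc N)) *ᵍ limit N [] (z ∷ [])
-- At n = 1 the alternating sum does not vanish: `unpoled 1 [] []` evaluates to 1, and this replaces
-- the value 1 at n = 0 that the empty sum `closed 0` lacks.
limit-rec-[] zero    z regular = closed-shift 0 [] z [] regular
limit-rec-[] (suc N) z regular = begin
  (fromℚ (odd² (suc (suc N))) -ᵍ z *ᵍ z) *ᵍ closed (suc (suc N)) [] (z ∷ [])
    ≡⟨ closed-shift (suc N) [] z [] regular ⟩
  unpoled (suc (suc N)) [] [] +ᵍ L
    ≡⟨ cong (_+ᵍ L) (unpoled-[] N) ⟩
  0ᵍ +ᵍ L
    ≡⟨ ᵍ.+-identityˡ L ⟩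
  L ∎
  where
  open ≡-Reasoning
  L = fromℚ (odd² (suc (suc N))) *ᵍ closed (suc N) [] (z ∷ [])

limit-rec-∷ : ∀ {d} N c (cs : Vec ℕ d) z z′ zs → Regular z → 1 ≤ c → c ≢ 2 →
  (fromℚ (odd² (suc N)) -ᵍ z *ᵍ z) *ᵍ limit (suc N) (c ∷ cs) (z ∷ z′ ∷ zs)
    ≡ fromℚ (odd² (suc N)) *ᵍ limit N (c ∷ cs) (z ∷ z′ ∷ zs)
      +ᵍ fromℚ (odd² (suc N)) *ᵍ (fromℚ (odd (suc N) ^ᶻ (ℤ.- (+ c))) *ᵍ limit (suc N) cs (z′ ∷ zs))
limit-rec-∷ N c cs z z′ zs regular 1≤c c≢2 = begin
  (fromℚ (odd² n) -ᵍ z *ᵍ z) *ᵍ closed n (c ∷ cs) (z ∷ z′ ∷ zs)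
    ≡⟨ closed-shift N (c ∷ cs) z (z′ ∷ zs) regular ⟩
  unpoled n (c ∷ cs) (z′ ∷ zs) +ᵍ fromℚ (odd² n) *ᵍ closed N (c ∷ cs) (z ∷ z′ ∷ zs)
    ≡⟨ ᵍ.+-comm (unpoled n (c ∷ cs) (z′ ∷ zs)) (fromℚ (odd² n) *ᵍ closed N (c ∷ cs) (z ∷ z′ ∷ zs)) ⟩
  fromℚ (odd² n) *ᵍ closed N (c ∷ cs) (z ∷ z′ ∷ zs) +ᵍ unpoled n (c ∷ cs) (z′ ∷ zs)
    ≡⟨ cong₂ (λ s t → fromℚ (odd² n) *ᵍ s +ᵍ t) (closed≡limit N)
         (trans (unpoled-∷ n c cs z′ zs 1≤c c≢2)
           (trans (cong (_*ᵍ closed n cs (z′ ∷ zs)) (fromℚ-* (odd² n) (odd n ^ᶻ (ℤ.- (+ c)))))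
             (ᵍ.*-assoc (fromℚ (odd² n)) (fromℚ (odd n ^ᶻ (ℤ.- (+ c)))) (closed n cs (z′ ∷ zs))))) ⟩
  fromℚ (odd² n) *ᵍ limit N (c ∷ cs) (z ∷ z′ ∷ zs)
    +ᵍ fromℚ (odd² n) *ᵍ (fromℚ (odd n ^ᶻ (ℤ.- (+ c))) *ᵍ limit n cs (z′ ∷ zs)) ∎
  where
  open ≡-Reasoning
  n = suc N
  closed≡limit : ∀ N → closed N (c ∷ cs) (z ∷ z′ ∷ zs) ≡ limit N (c ∷ cs) (z ∷ z′ ∷ zs)
  closed≡limit zero    = refl
  closed≡limit (suc N) = refl

-- Coefficients of the generating function

-- Either k₁ ≤ n or k₁ = n+1. In the second case the other variables still range up to n+1, because
-- the inequalities of the star sum are weak.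
t⋆-suc : ∀ n s ss → t⋆ (suc n) (s ∷ ss) ≡ t⋆ n (s ∷ ss) +ℚ odd (suc n) ^ᶻ (ℤ.- (+ s)) *ℚ t⋆ (suc n) ss
t⋆-suc n s ss = begin
  t⋆ (suc n) (s ∷ ss)                     ≡⟨ outer (suc n) ⟩
  ∑ℚ (upTo (suc n)) term                  ≡⟨ ∑ℚ.∑-upTo-last n term ⟩
  ∑ℚ (upTo n) term +ℚ term n              ≡⟨ cong (_+ℚ term n) (sym (outer n)) ⟩
  t⋆ n (s ∷ ss) +ℚ term n                 ∎
  where
  open ≡-Reasoning
  term : ℕ → ℚ
  term i = odd (suc i) ^ᶻ (ℤ.- (+ s)) *ℚ t⋆ (suc i) ss
  outer : ∀ n → t⋆ n (s ∷ ss) ≡ ∑ℚ (upTo n) term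
  outer n = trans (∑ℚ.∑-chains n 1 (List.length ss) (oddPowers (s ∷ ss)))
    (∑ℚ.∑-cong (upTo n) λ i → ∑ℚ.∑-*ˡ (chains (suc i) 1 (List.length ss)) (odd (suc i) ^ᶻ (ℤ.- (+ s))) (oddPowers ss))

0≤odd^ᶻ- : ∀ n s → 0ℚ ≤ℚ odd (suc n) ^ᶻ (ℤ.- (+ s))
0≤odd^ᶻ- n zero    = ℚ.<⇒≤ 0<1
0≤odd^ᶻ- n (suc s) = ℚ.<⇒≤ (0<^ (0<⁻¹ (0<odd n)) (suc s))

0≤t⋆ : ∀ n s → 0ℚ ≤ℚ t⋆ n s
0≤t⋆ n       []       = ℚ.<⇒≤ 0<1
0≤t⋆ zero    (s ∷ ss) = ℚ.≤-refl
0≤t⋆ (suc n) (s ∷ ss) = subst (0ℚ ≤ℚ_) (sym (t⋆-suc n s ss)) (0≤+ (0≤t⋆ n (s ∷ ss)) (0≤* (0≤odd^ᶻ- n s) (0≤t⋆ (suc n) ss)))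

T : ∀ {d} → ℕ → Vec ℕ d → Vec ℕ (suc d) → ℚ
T n c a = t⋆ n (interleave2 c a)

T-suc : ∀ {d} n (c : Vec ℕ d) a as →
  T (suc n) c (suc a ∷ as) ≡ T n c (suc a ∷ as) +ℚ odd (suc n) ^ᶻ (ℤ.- (+ 2)) *ℚ T (suc n) c (a ∷ as)
T-suc n []       a []         = t⋆-suc n 2 (replicate a 2)
T-suc n (c ∷ cs) a as         = t⋆-suc n 2 (replicate a 2 ++ c ∷ interleave2 cs as)

T-zero-∷ : ∀ {d} n c (cs : Vec ℕ d) as →
  T (suc n) (c ∷ cs) (0 ∷ as) ≡ T n (c ∷ cs) (0 ∷ as) +ℚ odd (suc n) ^ᶻ (ℤ.- (+ c)) *ℚ T (suc n) cs as
T-zero-∷ n c cs as = t⋆-suc n c (interleave2 cs as)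

T₀-suc : ∀ {d} (c : Vec ℕ d) a as → T 0 c (suc a ∷ as) ≡ 0ℚ
T₀-suc []      a [] = refl
T₀-suc (_ ∷ _) a as = refl

T₀-∷ : ∀ {d} c (cs : Vec ℕ d) a as → T 0 (c ∷ cs) (a ∷ as) ≡ 0ℚ
T₀-∷ c cs zero    as = refl
T₀-∷ c cs (suc a) as = refl

-- Exponential bounds for the coefficients

weight : ∀ {d} → ℚ → Vec ℕ d → ℚ
weight x []       = 1ℚ
weight x (a ∷ as) = x ^ℚ a *ℚ weight x as

odd⁻²≤1 : ∀ n → odd (suc n) ^ᶻ (ℤ.- (+ 2)) ≤ℚ 1ℚ
odd⁻²≤1 n = subst (odd (suc n) ^ᶻ (ℤ.- (+ 2)) ≤ℚ_) (ℚ.*-identityʳ 1ℚ)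
  (*-mono 0≤i i≤1 (ℚ.<⇒≤ (0<^ (0<⁻¹ (0<odd n)) 1)) (subst (_≤ℚ 1ℚ) (sym (ℚ.*-identityʳ i)) i≤1))
  where
  i = odd (suc n) ⁻¹
  0≤i = ℚ.<⇒≤ (0<⁻¹ (0<odd n))
  i≤1 : i ≤ℚ 1ℚ
  i≤1 = subst₂ _≤ℚ_ (ℚ.*-identityˡ i) (odd-inverse n) (*-mono (ℚ.<⇒≤ 0<1) (1≤odd n) 0≤i ℚ.≤-refl)

module Ratio (t : ℚ) (0<t : 0ℚ <ℚ t) (t<1 : t <ℚ 1ℚ) where

  0≤t : 0ℚ ≤ℚ t
  0≤t = ℚ.<⇒≤ 0<t

  t≤1 : t ≤ℚ 1ℚ
  t≤1 = ℚ.<⇒≤ t<1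

  0<1-t : 0ℚ <ℚ 1ℚ -ℚ t
  0<1-t = 0<b-a t<1

  Γ : ℚ
  Γ = (1ℚ -ℚ t) ⁻¹

  0<Γ : 0ℚ <ℚ Γ
  0<Γ = 0<⁻¹ 0<1-t

  0≤Γ : 0ℚ ≤ℚ Γ
  0≤Γ = ℚ.<⇒≤ 0<Γ

  Γ-fix : ∀ b → b +ℚ t *ℚ (Γ *ℚ b) ≡ Γ *ℚ b
  Γ-fix b = begin
    b +ℚ t *ℚ (Γ *ℚ b)                                               ≡⟨ solve 3 (λ t g b → b :+ t :* (g :* b)
      := g :* b :+ (:- b) :* ((con 1ℚ :- t) :* g :- con 1ℚ)) refl t Γ b ⟩
    Γ *ℚ b +ℚ (-ℚ b) *ℚ ((1ℚ -ℚ t) *ℚ Γ -ℚ 1ℚ)                       ≡⟨ drop-null (Γ *ℚ b) (-ℚ b) (⁻¹-inverse (1ℚ -ℚ t) 0<1-t) ⟩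
    Γ *ℚ b                                                           ∎
    where
    open ≡-Reasoning
    open ℚ.+-*-Solver

  -- Γ b is the fixed point of u ↦ b + t u.

  Γ-bound : ∀ {b} (u : ℕ → ℚ) → 0ℚ ≤ℚ b → u 0 ≤ℚ b → (∀ a → u (suc a) ≤ℚ b +ℚ t *ℚ u a) → ∀ a → u a ≤ℚ Γ *ℚ b
  Γ-bound {b} u 0≤b u₀ step zero    = ℚ.≤-trans u₀ (≤-by (t *ℚ (Γ *ℚ b)) (0≤* 0≤t (0≤* 0≤Γ 0≤b)) (sym (Γ-fix b)))
  Γ-bound {b} u 0≤b u₀ step (suc a) = ℚ.≤-trans (step a) (ℚ.≤-trans
    (ℚ.+-monoʳ-≤ b (*-mono′ (Γ-bound u 0≤b u₀ step a))) (ℚ.≤-reflexive (Γ-fix b)))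
    where
    *-mono′ : ∀ {x y} → x ≤ℚ y → t *ℚ x ≤ℚ t *ℚ y
    *-mono′ = ℚ.*-monoˡ-≤-nonNeg t {{ℚ.nonNegative 0≤t}}

  0≤^ : ∀ a → 0ℚ ≤ℚ t ^ℚ a
  0≤^ a = ℚ.<⇒≤ (0<^ 0<t a)

  ^≤1 : ∀ a → t ^ℚ a ≤ℚ 1ℚ
  ^≤1 zero    = ℚ.≤-refl
  ^≤1 (suc a) = subst (t *ℚ t ^ℚ a ≤ℚ_) (ℚ.*-identityʳ 1ℚ) (*-mono 0≤t t≤1 (0≤^ a) (^≤1 a))

  0≤weight : ∀ {d} (a : Vec ℕ d) → 0ℚ ≤ℚ weight t a
  0≤weight []       = ℚ.<⇒≤ 0<1
  0≤weight (a ∷ as) = 0≤* (0≤^ a) (0≤weight as)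

  weight≤1 : ∀ {d} (a : Vec ℕ d) → weight t a ≤ℚ 1ℚ
  weight≤1 []       = ℚ.≤-refl
  weight≤1 (a ∷ as) = subst (t ^ℚ a *ℚ weight t as ≤ℚ_) (ℚ.*-identityʳ 1ℚ) (*-mono (0≤^ a) (^≤1 a) (0≤weight as) (weight≤1 as))

  -- Raising a₀ costs only a factor 1/(2n+1)², estimated by 1 and equal to 1 for n = 0. The factor t
  -- of the weight is what turns the recursion into a contraction.
  T-step : ∀ {d} n (c : Vec ℕ d) a as {b} → T n c (suc a ∷ as) *ℚ weight t (suc a ∷ as) ≤ℚ b →
    T (suc n) c (suc a ∷ as) *ℚ weight t (suc a ∷ as) ≤ℚ b +ℚ t *ℚ (T (suc n) c (a ∷ as) *ℚ weight t (a ∷ as))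
  T-step n c a as {b} hyp = begin
    T (suc n) c (suc a ∷ as) *ℚ (t *ℚ p *ℚ w)
      ≡⟨ cong (_*ℚ (t *ℚ p *ℚ w)) (T-suc n c a as) ⟩
    (T n c (suc a ∷ as) +ℚ y *ℚ T′) *ℚ (t *ℚ p *ℚ w)
      ≡⟨ solve 6 (λ x y u t p w → (x :+ y :* u) :* (t :* p :* w) := x :* (t :* p :* w) :+ y :* (t :* (u :* (p :* w))))
           refl (T n c (suc a ∷ as)) y T′ t p w ⟩
    T n c (suc a ∷ as) *ℚ (t *ℚ p *ℚ w) +ℚ y *ℚ (t *ℚ (T′ *ℚ (p *ℚ w)))
      ≤⟨ ℚ.+-mono-≤ hyp (*-mono (0≤odd^ᶻ- n 2) (odd⁻²≤1 n) 0≤r ℚ.≤-refl) ⟩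
    b +ℚ 1ℚ *ℚ (t *ℚ (T′ *ℚ (p *ℚ w)))
      ≡⟨ cong (b +ℚ_) (ℚ.*-identityˡ (t *ℚ (T′ *ℚ (p *ℚ w)))) ⟩
    b +ℚ t *ℚ (T′ *ℚ (p *ℚ w)) ∎
    where
    open ℚ.≤-Reasoning
    open ℚ.+-*-Solver
    y = odd (suc n) ^ᶻ (ℤ.- (+ 2))
    T′ = T (suc n) c (a ∷ as)
    p = t ^ℚ a
    w = weight t as
    0≤r = 0≤* 0≤t (0≤* (0≤t⋆ (suc n) (interleave2 c (a ∷ as))) (0≤weight (a ∷ as)))

  T-bound : ∀ {d} n (c : Vec ℕ d) → ∃ λ K → 0ℚ ≤ℚ K × (∀ a → T n c a *ℚ weight t a ≤ℚ K)
  T-bound zero c = 1ℚ , ℚ.<⇒≤ 0<1 , bound c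
    where
    vanishing : ∀ {q} w → q ≡ 0ℚ → q *ℚ w ≤ℚ 1ℚ
    vanishing w refl = subst (_≤ℚ 1ℚ) (sym (ℚ.*-zeroˡ w)) (ℚ.<⇒≤ 0<1)
    bound : ∀ {d} (c : Vec ℕ d) a → T 0 c a *ℚ weight t a ≤ℚ 1ℚ
    bound []       (zero ∷ [])  = ℚ.≤-refl
    bound []       (suc a ∷ []) = vanishing (weight t (suc a ∷ [])) (T₀-suc [] a [])
    bound (c ∷ cs) (a ∷ as)     = vanishing (weight t (a ∷ as)) (T₀-∷ c cs a as)
  T-bound (suc n) [] with T-bound n []
  ... | K , 0≤K , T≤K = Γ *ℚ b , 0≤* 0≤Γ 0≤b , λ { (a ∷ []) →
      Γ-bound (λ a → T (suc n) [] (a ∷ []) *ℚ weight t (a ∷ [])) 0≤b (≤-by K 0≤K refl)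
        (λ a → T-step n [] a [] (ℚ.≤-trans (T≤K (suc a ∷ [])) (≤-by 1ℚ (ℚ.<⇒≤ 0<1) (ℚ.+-comm 1ℚ K)))) a }
    where
    -- The summand 1 covers a = 0, where the index is empty and t⋆ is 1.
    b = 1ℚ +ℚ K
    0≤b = 0≤+ (ℚ.<⇒≤ 0<1) 0≤K
  T-bound (suc n) (c ∷ cs) with T-bound n (c ∷ cs) | T-bound (suc n) cs
  ... | K , 0≤K , T≤K | K′ , 0≤K′ , T≤K′ = Γ *ℚ b , 0≤* 0≤Γ 0≤b , λ { (a ∷ as) →
      Γ-bound (λ a → T (suc n) (c ∷ cs) (a ∷ as) *ℚ weight t (a ∷ as)) 0≤b (initial as)
        (λ a → T-step n (c ∷ cs) a as (ℚ.≤-trans (T≤K (suc a ∷ as)) (≤-by (y *ℚ K′) 0≤yK′ refl))) a }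
    where
    open ℚ.≤-Reasoning
    open ℚ.+-*-Solver
    y = odd (suc n) ^ᶻ (ℤ.- (+ c))
    0≤yK′ = 0≤* (0≤odd^ᶻ- n c) 0≤K′
    b = K +ℚ y *ℚ K′
    0≤b = 0≤+ 0≤K 0≤yK′
    initial : ∀ as → T (suc n) (c ∷ cs) (0 ∷ as) *ℚ weight t (0 ∷ as) ≤ℚ b
    initial as = begin
      T (suc n) (c ∷ cs) (0 ∷ as) *ℚ (1ℚ *ℚ w)
        ≡⟨ cong (_*ℚ (1ℚ *ℚ w)) (T-zero-∷ n c cs as) ⟩
      (T n (c ∷ cs) (0 ∷ as) +ℚ y *ℚ T (suc n) cs as) *ℚ (1ℚ *ℚ w)
        ≡⟨ solve 4 (λ x y u w → (x :+ y :* u) :* (con 1ℚ :* w) := x :* (con 1ℚ :* w) :+ y :* (u :* w))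
             refl (T n (c ∷ cs) (0 ∷ as)) y (T (suc n) cs as) w ⟩
      T n (c ∷ cs) (0 ∷ as) *ℚ (1ℚ *ℚ w) +ℚ y *ℚ (T (suc n) cs as *ℚ w)
        ≤⟨ ℚ.+-mono-≤ (T≤K (0 ∷ as)) (ℚ.*-monoˡ-≤-nonNeg y {{ℚ.nonNegative (0≤odd^ᶻ- n c)}} (T≤K′ as)) ⟩
      b ∎
      where w = weight t as

-- Absolute values of Gaussian rationals, compared by their squares

infix 4 _⊑_

record _⊑_ (w : ℚ[i]) (b : ℚ) : Set where
  constructor _,_
  field
    0≤bound : 0ℚ ≤ℚ b
    norm²≤  : norm² w ≤ℚ b *ℚ b

square-cancel-≤ : ∀ {x b} → 0ℚ ≤ℚ b → x *ℚ x ≤ℚ b *ℚ b → x ≤ℚ b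
square-cancel-≤ {x} {b} 0≤b x²≤b² with x ℚ.≤? b
... | yes x≤b = x≤b
... | no  x≰b = contradiction (ℚ.<-≤-trans b²<x² x²≤b²) (ℚ.<-irrefl refl)
  where
  b<x = ℚ.≰⇒> x≰b
  b²<x² : b *ℚ b <ℚ x *ℚ x
  b²<x² = ℚ.≤-<-trans (ℚ.*-monoˡ-≤-nonNeg b {{ℚ.nonNegative 0≤b}} (ℚ.<⇒≤ b<x))
                      (ℚ.*-monoˡ-<-pos x {{ℚ.positive (ℚ.≤-<-trans 0≤b b<x)}} b<x)

0≤norm² : ∀ w → 0ℚ ≤ℚ norm² w
0≤norm² w = 0≤+ (0≤p*p (ℜ w)) (0≤p*p (ℑ w))

norm²-* : ∀ w z → norm² (w *ᵍ z) ≡ norm² w *ℚ norm² z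
norm²-* (a +i* b) (c +i* d) = solve 4 (λ a b c d →
  (a :* c :+ :- (b :* d)) :* (a :* c :+ :- (b :* d)) :+ (a :* d :+ b :* c) :* (a :* d :+ b :* c)
    := (a :* a :+ b :* b) :* (c :* c :+ d :* d)) refl a b c d
  where open ℚ.+-*-Solver

⊑-weaken : ∀ {w b c} → w ⊑ b → b ≤ℚ c → w ⊑ c
⊑-weaken (0≤b , w≤) b≤c = ℚ.≤-trans 0≤b b≤c , ℚ.≤-trans w≤ (*-mono 0≤b b≤c 0≤b b≤c)

⊑-fromℚ : ∀ {q} → 0ℚ ≤ℚ q → fromℚ q ⊑ q
⊑-fromℚ {q} 0≤q = 0≤q , ℚ.≤-reflexive (solve 1 (λ q → q :* q :+ con 0ℚ :* con 0ℚ := q :* q) refl q)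
  where open ℚ.+-*-Solver

⊑-* : ∀ {w z b c} → w ⊑ b → z ⊑ c → w *ᵍ z ⊑ b *ℚ c
⊑-* {w} {z} {b} {c} (0≤b , w≤) (0≤c , z≤) = 0≤* 0≤b 0≤c , (begin
  norm² (w *ᵍ z)            ≡⟨ norm²-* w z ⟩
  norm² w *ℚ norm² z        ≤⟨ *-mono (0≤norm² w) w≤ (0≤norm² z) z≤ ⟩
  (b *ℚ b) *ℚ (c *ℚ c)      ≡⟨ solve 2 (λ b c → (b :* b) :* (c :* c) := (b :* c) :* (b :* c)) refl b c ⟩
  (b *ℚ c) *ℚ (b *ℚ c)      ∎)
  where
  open ℚ.≤-Reasoning
  open ℚ.+-*-Solver

-- The triangle inequality without square roots. The mixed term p is bounded by Cauchy-Schwarz,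
-- which follows from the Lagrange identity norm² w · norm² z = p² + q².
⊑-+ : ∀ {w z b c} → w ⊑ b → z ⊑ c → w +ᵍ z ⊑ b +ℚ c
⊑-+ {w@(x +i* y)} {z@(u +i* v)} {b} {c} (0≤b , w≤) (0≤c , z≤) = 0≤+ 0≤b 0≤c , (begin
  (x +ℚ u) *ℚ (x +ℚ u) +ℚ (y +ℚ v) *ℚ (y +ℚ v)
    ≡⟨ solve 4 (λ x y u v → (x :+ u) :* (x :+ u) :+ (y :+ v) :* (y :+ v)
         := (x :* x :+ y :* y) :+ (u :* u :+ v :* v) :+ con ⟪ 2 ⟫ :* (x :* u :+ y :* v)) refl x y u v ⟩
  norm² w +ℚ norm² z +ℚ ⟪ 2 ⟫ *ℚ p
    ≤⟨ ℚ.+-mono-≤ (ℚ.+-mono-≤ w≤ z≤) (ℚ.*-monoˡ-≤-nonNeg ⟪ 2 ⟫ p≤bc) ⟩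
  b *ℚ b +ℚ c *ℚ c +ℚ ⟪ 2 ⟫ *ℚ (b *ℚ c)
    ≡⟨ solve 2 (λ b c → b :* b :+ c :* c :+ con ⟪ 2 ⟫ :* (b :* c) := (b :+ c) :* (b :+ c)) refl b c ⟩
  (b +ℚ c) *ℚ (b +ℚ c) ∎)
  where
  open ℚ.≤-Reasoning
  open ℚ.+-*-Solver
  p = x *ℚ u +ℚ y *ℚ v
  q = x *ℚ v -ℚ y *ℚ u
  p≤bc : p ≤ℚ b *ℚ c
  p≤bc = square-cancel-≤ (0≤* 0≤b 0≤c) (begin
    p *ℚ p                  ≤⟨ ≤-by (q *ℚ q) (0≤p*p q) (solve 4 (λ x y u v → (x :* x :+ y :* y) :* (u :* u :+ v :* v)
                                 := (x :* u :+ y :* v) :* (x :* u :+ y :* v) :+ (x :* v :- y :* u) :* (x :* v :- y :* u)) refl x y u v) ⟩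
    norm² w *ℚ norm² z      ≤⟨ *-mono (0≤norm² w) w≤ (0≤norm² z) z≤ ⟩
    (b *ℚ b) *ℚ (c *ℚ c)    ≡⟨ solve 2 (λ b c → (b :* b) :* (c :* c) := (b :* c) :* (b :* c)) refl b c ⟩
    (b *ℚ c) *ℚ (b *ℚ c)    ∎)

⊑-∑ : {I : Set} (xs : List I) {f : I → ℚ[i]} {g : I → ℚ} → (∀ {x} → x ∈ xs → f x ⊑ g x) → ∑ᵍ xs f ⊑ ∑ℚ xs g
⊑-∑ []       f⊑g = ⊑-fromℚ ℚ.≤-refl
⊑-∑ (x ∷ xs) f⊑g = ⊑-+ (f⊑g (here refl)) (⊑-∑ xs (f⊑g ∘ there))

-- Estimates the quotient x/a through the equation for a w alone. It serves for a = (2n-1)² - z²,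
-- where the recursions give only products.
⊑-÷ : ∀ {a w x b g} → 0ℚ <ℚ g → g *ℚ g ≤ℚ norm² a → a *ᵍ w ≡ x → x ⊑ b → w ⊑ g ⁻¹ *ℚ b
⊑-÷ {a} {w} {x} {b} {g} 0<g g²≤ aw≡x (0≤b , x≤) = 0≤* (ℚ.<⇒≤ (0<⁻¹ 0<g)) 0≤b , (begin
  norm² w
    ≡⟨ sym (ℚ.*-identityˡ (norm² w)) ⟩
  1ℚ *ℚ 1ℚ *ℚ norm² w
    ≡⟨ cong (λ u → u *ℚ u *ℚ norm² w) (sym (⁻¹-inverse g 0<g)) ⟩
  (g *ℚ i) *ℚ (g *ℚ i) *ℚ norm² w
    ≡⟨ solve 3 (λ g i n → (g :* i) :* (g :* i) :* n := (i :* i) :* ((g :* g) :* n)) refl g i (norm² w) ⟩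
  (i *ℚ i) *ℚ ((g *ℚ g) *ℚ norm² w)
    ≤⟨ ℚ.*-monoˡ-≤-nonNeg (i *ℚ i) {{ℚ.nonNegative (0≤p*p i)}} (begin
         (g *ℚ g) *ℚ norm² w       ≤⟨ ℚ.*-monoʳ-≤-nonNeg (norm² w) {{ℚ.nonNegative (0≤norm² w)}} g²≤ ⟩
         norm² a *ℚ norm² w        ≡⟨ sym (norm²-* a w) ⟩
         norm² (a *ᵍ w)            ≡⟨ cong norm² aw≡x ⟩
         norm² x                   ≤⟨ x≤ ⟩
         b *ℚ b                    ∎) ⟩
  (i *ℚ i) *ℚ (b *ℚ b)
    ≡⟨ solve 2 (λ i b → (i :* i) :* (b :* b) := (i :* b) :* (i :* b)) refl i b ⟩
  (i *ℚ b) *ℚ (i *ℚ b) ∎)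
  where
  open ℚ.≤-Reasoning
  open ℚ.+-*-Solver
  i = g ⁻¹

⊑⇒ℜ≤ : ∀ {w b} → w ⊑ b → ℜ w ≤ℚ b
⊑⇒ℜ≤ {w} (0≤b , w≤) = square-cancel-≤ 0≤b (ℚ.≤-trans (≤-by (ℑ w *ℚ ℑ w) (0≤p*p (ℑ w)) refl) w≤)

-- The terms of the series and its partial sums over boxes

monomial : ∀ {d} → Vec ℚ[i] d → Vec ℕ d → ℚ[i]
monomial z a = ∏ᵍ λ j → lookup z j ^ᵍ (2 * lookup a j)

term : ∀ {d} → ℕ → Vec ℕ d → Vec ℚ[i] (suc d) → Vec ℕ (suc d) → ℚ[i]
term n c z a = fromℚ (T n c a) *ᵍ monomial z a

slab : ∀ {d} → ℕ → Vec ℕ d → Vec ℚ[i] (suc d) → ℕ → ℕ → ℚ[i]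
slab {d} n c z M a = ∑ᵍ (box M d) λ as → term n c z (a ∷ as)

partial : ∀ {d} → ℕ → Vec ℕ d → Vec ℚ[i] (suc d) → ℕ → ℚ[i]
partial {d} n c z M = ∑ᵍ (box M (suc d)) (term n c z)

^-2*suc : ∀ z a → z ^ᵍ (2 * suc a) ≡ (z *ᵍ z) *ᵍ z ^ᵍ (2 * a)
^-2*suc z a = trans (cong (z ^ᵍ_) (ℕ.*-suc 2 a)) (sym (ᵍ.*-assoc z z (z ^ᵍ (2 * a))))

slab-suc : ∀ {d} n (c : Vec ℕ d) z zs M a → slab (suc n) c (z ∷ zs) M (suc a)
  ≡ slab n c (z ∷ zs) M (suc a) +ᵍ (fromℚ (odd (suc n) ^ᶻ (ℤ.- (+ 2))) *ᵍ (z *ᵍ z)) *ᵍ slab (suc n) c (z ∷ zs) M a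
slab-suc {d} n c z zs M a = begin
  ∑ᵍ (box M d) (λ as → term (suc n) c (z ∷ zs) (suc a ∷ as))
    ≡⟨ ∑ᵍ.∑-cong (box M d) split ⟩
  ∑ᵍ (box M d) (λ as → term n c (z ∷ zs) (suc a ∷ as) +ᵍ k *ᵍ term (suc n) c (z ∷ zs) (a ∷ as))
    ≡⟨ ∑ᵍ.∑-+ (box M d) (λ as → term n c (z ∷ zs) (suc a ∷ as)) (λ as → k *ᵍ term (suc n) c (z ∷ zs) (a ∷ as)) ⟩
  slab n c (z ∷ zs) M (suc a) +ᵍ ∑ᵍ (box M d) (λ as → k *ᵍ term (suc n) c (z ∷ zs) (a ∷ as))
    ≡⟨ cong (slab n c (z ∷ zs) M (suc a) +ᵍ_) (∑ᵍ.∑-*ˡ (box M d) k (λ as → term (suc n) c (z ∷ zs) (a ∷ as))) ⟩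
  slab n c (z ∷ zs) M (suc a) +ᵍ k *ᵍ slab (suc n) c (z ∷ zs) M a ∎
  where
  open ≡-Reasoning
  open ᵍ-Solver
  y = odd (suc n) ^ᶻ (ℤ.- (+ 2))
  k = fromℚ y *ᵍ (z *ᵍ z)
  split : ∀ as → term (suc n) c (z ∷ zs) (suc a ∷ as) ≡ term n c (z ∷ zs) (suc a ∷ as) +ᵍ k *ᵍ term (suc n) c (z ∷ zs) (a ∷ as)
  split as = begin
    fromℚ (T (suc n) c (suc a ∷ as)) *ᵍ (z ^ᵍ (2 * suc a) *ᵍ m)
      ≡⟨ cong (_*ᵍ (z ^ᵍ (2 * suc a) *ᵍ m)) (trans (cong fromℚ (T-suc n c a as))
           (trans (fromℚ-+ T₁ (y *ℚ T₂)) (cong (fromℚ T₁ +ᵍ_) (fromℚ-* y T₂)))) ⟩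
    (fromℚ T₁ +ᵍ fromℚ y *ᵍ fromℚ T₂) *ᵍ (z ^ᵍ (2 * suc a) *ᵍ m)
      ≡⟨ solve 5 (λ s y u p m → (s :+ y :* u) :* (p :* m) := s :* (p :* m) :+ (y :* u) :* (p :* m)) refl
           (fromℚ T₁) (fromℚ y) (fromℚ T₂) (z ^ᵍ (2 * suc a)) m ⟩
    fromℚ T₁ *ᵍ (z ^ᵍ (2 * suc a) *ᵍ m) +ᵍ (fromℚ y *ᵍ fromℚ T₂) *ᵍ (z ^ᵍ (2 * suc a) *ᵍ m)
      ≡⟨ cong (λ p → fromℚ T₁ *ᵍ (z ^ᵍ (2 * suc a) *ᵍ m) +ᵍ (fromℚ y *ᵍ fromℚ T₂) *ᵍ (p *ᵍ m)) (^-2*suc z a) ⟩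
    fromℚ T₁ *ᵍ (z ^ᵍ (2 * suc a) *ᵍ m) +ᵍ (fromℚ y *ᵍ fromℚ T₂) *ᵍ (((z *ᵍ z) *ᵍ z ^ᵍ (2 * a)) *ᵍ m)
      ≡⟨ cong (fromℚ T₁ *ᵍ (z ^ᵍ (2 * suc a) *ᵍ m) +ᵍ_)
           (solve 5 (λ y u x p m → (y :* u) :* ((x :* p) :* m) := (y :* x) :* (u :* (p :* m))) refl
             (fromℚ y) (fromℚ T₂) (z *ᵍ z) (z ^ᵍ (2 * a)) m) ⟩
    term n c (z ∷ zs) (suc a ∷ as) +ᵍ k *ᵍ term (suc n) c (z ∷ zs) (a ∷ as) ∎
    where
    m = monomial zs as
    T₁ = T n c (suc a ∷ as)
    T₂ = T (suc n) c (a ∷ as)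

slab-zero-∷ : ∀ {d} n c (cs : Vec ℕ d) z z′ zs M → slab (suc n) (c ∷ cs) (z ∷ z′ ∷ zs) M 0
  ≡ slab n (c ∷ cs) (z ∷ z′ ∷ zs) M 0 +ᵍ fromℚ (odd (suc n) ^ᶻ (ℤ.- (+ c))) *ᵍ partial (suc n) cs (z′ ∷ zs) M
slab-zero-∷ {d} n c cs z z′ zs M = begin
  ∑ᵍ (box M (suc d)) (λ as → term (suc n) (c ∷ cs) (z ∷ z′ ∷ zs) (0 ∷ as))
    ≡⟨ ∑ᵍ.∑-cong (box M (suc d)) split ⟩
  ∑ᵍ (box M (suc d)) (λ as → term n (c ∷ cs) (z ∷ z′ ∷ zs) (0 ∷ as) +ᵍ fromℚ y *ᵍ term (suc n) cs (z′ ∷ zs) as)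
    ≡⟨ ∑ᵍ.∑-+ (box M (suc d)) (λ as → term n (c ∷ cs) (z ∷ z′ ∷ zs) (0 ∷ as)) (λ as → fromℚ y *ᵍ term (suc n) cs (z′ ∷ zs) as) ⟩
  slab n (c ∷ cs) (z ∷ z′ ∷ zs) M 0 +ᵍ ∑ᵍ (box M (suc d)) (λ as → fromℚ y *ᵍ term (suc n) cs (z′ ∷ zs) as)
    ≡⟨ cong (slab n (c ∷ cs) (z ∷ z′ ∷ zs) M 0 +ᵍ_) (∑ᵍ.∑-*ˡ (box M (suc d)) (fromℚ y) (term (suc n) cs (z′ ∷ zs))) ⟩
  slab n (c ∷ cs) (z ∷ z′ ∷ zs) M 0 +ᵍ fromℚ y *ᵍ partial (suc n) cs (z′ ∷ zs) M ∎
  where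
  open ≡-Reasoning
  open ᵍ-Solver
  y = odd (suc n) ^ᶻ (ℤ.- (+ c))
  split : ∀ as → term (suc n) (c ∷ cs) (z ∷ z′ ∷ zs) (0 ∷ as)
    ≡ term n (c ∷ cs) (z ∷ z′ ∷ zs) (0 ∷ as) +ᵍ fromℚ y *ᵍ term (suc n) cs (z′ ∷ zs) as
  split as = trans
    (cong (_*ᵍ (1ᵍ *ᵍ m)) (trans (cong fromℚ (T-zero-∷ n c cs as)) (trans (fromℚ-+ T₁ (y *ℚ T₂)) (cong (fromℚ T₁ +ᵍ_) (fromℚ-* y T₂)))))
    (solve 4 (λ s y u m → (s :+ y :* u) :* (con 1ᵍ :* m) := s :* (con 1ᵍ :* m) :+ y :* (u :* m)) refl (fromℚ T₁) (fromℚ y) (fromℚ T₂) m)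
    where
    m = monomial (z′ ∷ zs) as
    T₁ = T n (c ∷ cs) (0 ∷ as)
    T₂ = T (suc n) cs as

-- Multiplication by z² shifts a₀ by one, so a partial sum obeys the recursion of the series up to
-- its last layer a₀ = M, which leaves the box. `extra` is what the layer a₀ = 0 adds: 0 for empty
-- c, otherwise the partial sum for the tail of c times a negative power of 2n+1.
partial-rec : ∀ {d} n (c : Vec ℕ d) z zs M extra →
  slab (suc n) c (z ∷ zs) (suc M) 0 ≡ slab n c (z ∷ zs) (suc M) 0 +ᵍ extra →
  (fromℚ (odd² (suc n)) -ᵍ z *ᵍ z) *ᵍ partial (suc n) c (z ∷ zs) (suc M)
    ≡ fromℚ (odd² (suc n)) *ᵍ partial n c (z ∷ zs) (suc M) +ᵍ fromℚ (odd² (suc n)) *ᵍ extra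
      -ᵍ (z *ᵍ z) *ᵍ slab (suc n) c (z ∷ zs) (suc M) M
partial-rec {d} n c z zs M extra zeroth = begin
  (o² -ᵍ x) *ᵍ P′
    ≡⟨ solve 3 (λ o x p → (o :- x) :* p := o :* p :- x :* p) refl o² x P′ ⟩
  o² *ᵍ P′ -ᵍ x *ᵍ P′
    ≡⟨ cong (λ t → o² *ᵍ t -ᵍ x *ᵍ P′) P′≡ ⟩
  o² *ᵍ (P +ᵍ extra +ᵍ (fromℚ y *ᵍ x) *ᵍ Q) -ᵍ x *ᵍ P′
    ≡⟨ solve 7 (λ o p e y x q r → o :* (p :+ e :+ (y :* x) :* q) :- x :* r := o :* p :+ o :* e :+ (o :* y) :* (x :* q) :- x :* r)
         refl o² P extra (fromℚ y) x Q P′ ⟩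
  o² *ᵍ P +ᵍ o² *ᵍ extra +ᵍ (o² *ᵍ fromℚ y) *ᵍ (x *ᵍ Q) -ᵍ x *ᵍ P′
    ≡⟨ cong₂ (λ s t → o² *ᵍ P +ᵍ o² *ᵍ extra +ᵍ s *ᵍ (x *ᵍ Q) -ᵍ x *ᵍ t) o²y≡1 P′≡Q+L ⟩
  o² *ᵍ P +ᵍ o² *ᵍ extra +ᵍ 1ᵍ *ᵍ (x *ᵍ Q) -ᵍ x *ᵍ (Q +ᵍ L)
    ≡⟨ solve 6 (λ o p e x q l → o :* p :+ o :* e :+ con 1ᵍ :* (x :* q) :- x :* (q :+ l) := o :* p :+ o :* e :- x :* l)
         refl o² P extra x Q L ⟩
  o² *ᵍ P +ᵍ o² *ᵍ extra -ᵍ x *ᵍ L ∎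
  where
  open ≡-Reasoning
  open ᵍ-Solver
  o = odd (suc n)
  o² = fromℚ (odd² (suc n))
  y = o ^ᶻ (ℤ.- (+ 2))
  x = z *ᵍ z
  S S′ : ℕ → ℚ[i]
  S = slab n c (z ∷ zs) (suc M)
  S′ = slab (suc n) c (z ∷ zs) (suc M)
  P = partial n c (z ∷ zs) (suc M)
  P′ = partial (suc n) c (z ∷ zs) (suc M)
  L = S′ M
  Q = ∑ᵍ (upTo M) S′
  -- The same sum is split at its last layer here and at its first layer in `P′≡`. Since (2n+1)² y =
  -- 1, comparing the two makes `Q` cancel.
  P′≡Q+L : P′ ≡ Q +ᵍ L
  P′≡Q+L = trans (∑ᵍ.∑-box (suc M) d (term (suc n) c (z ∷ zs))) (∑ᵍ.∑-upTo-last M S′)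
  P′≡ : P′ ≡ P +ᵍ extra +ᵍ (fromℚ y *ᵍ x) *ᵍ Q
  P′≡ = begin
    P′
      ≡⟨ trans (∑ᵍ.∑-box (suc M) d (term (suc n) c (z ∷ zs))) (∑ᵍ.∑-upTo-first M S′) ⟩
    S′ 0 +ᵍ ∑ᵍ (upTo M) (λ a → S′ (suc a))
      ≡⟨ cong₂ _+ᵍ_ zeroth (trans (∑ᵍ.∑-cong (upTo M) (slab-suc n c z zs (suc M)))
           (trans (∑ᵍ.∑-+ (upTo M) (λ a → S (suc a)) (λ a → (fromℚ y *ᵍ x) *ᵍ S′ a))
             (cong (∑ᵍ (upTo M) (λ a → S (suc a)) +ᵍ_) (∑ᵍ.∑-*ˡ (upTo M) (fromℚ y *ᵍ x) S′)))) ⟩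
    (S 0 +ᵍ extra) +ᵍ (R +ᵍ (fromℚ y *ᵍ x) *ᵍ Q)
      ≡⟨ solve 4 (λ s e r q → (s :+ e) :+ (r :+ q) := (s :+ r) :+ e :+ q) refl (S 0) extra R ((fromℚ y *ᵍ x) *ᵍ Q) ⟩
    (S 0 +ᵍ R) +ᵍ extra +ᵍ (fromℚ y *ᵍ x) *ᵍ Q
      ≡⟨ cong (λ t → t +ᵍ extra +ᵍ (fromℚ y *ᵍ x) *ᵍ Q) (sym (trans (∑ᵍ.∑-box (suc M) d (term n c (z ∷ zs))) (∑ᵍ.∑-upTo-first M S))) ⟩
    P +ᵍ extra +ᵍ (fromℚ y *ᵍ x) *ᵍ Q ∎
    where R = ∑ᵍ (upTo M) (λ a → S (suc a))
  o²y≡1 : o² *ᵍ fromℚ y ≡ 1ᵍ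
  o²y≡1 = trans (sym (fromℚ-* (odd² (suc n)) y)) (cong fromℚ
    (trans (rearrange o (o ⁻¹)) (cong (λ t → t *ℚ t) (odd-inverse n))))
    where
    rearrange : ∀ o i → (o *ℚ o) *ℚ (i *ℚ (i *ℚ 1ℚ)) ≡ (o *ℚ i) *ℚ (o *ℚ i)
    rearrange = ℚS.solve 2 (λ o i → (o ℚS.:* o) ℚS.:* (i ℚS.:* (i ℚS.:* ℚS.con 1ℚ)) ℚS.:= (o ℚS.:* i) ℚS.:* (o ℚS.:* i)) refl
      where module ℚS = ℚ.+-*-Solver

weight-* : ∀ {d} x y (a : Vec ℕ d) → weight (x *ℚ y) a ≡ weight x a *ℚ weight y a
weight-* x y []       = refl
weight-* x y (a ∷ as) = begin
  (x *ℚ y) ^ℚ a *ℚ weight (x *ℚ y) as                        ≡⟨ cong₂ _*ℚ_ (^-* a) (weight-* x y as) ⟩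
  (x ^ℚ a *ℚ y ^ℚ a) *ℚ (weight x as *ℚ weight y as)         ≡⟨ interchange (x ^ℚ a) (y ^ℚ a) (weight x as) (weight y as) ⟩
  (x ^ℚ a *ℚ weight x as) *ℚ (y ^ℚ a *ℚ weight y as)         ∎
  where
  open ≡-Reasoning
  open ℚ.+-*-Solver
  interchange : ∀ a b c d → (a *ℚ b) *ℚ (c *ℚ d) ≡ (a *ℚ c) *ℚ (b *ℚ d)
  interchange = solve 4 (λ a b c d → (a :* b) :* (c :* d) := (a :* c) :* (b :* d)) refl
  ^-* : ∀ a → (x *ℚ y) ^ℚ a ≡ x ^ℚ a *ℚ y ^ℚ a
  ^-* zero    = refl
  ^-* (suc a) = trans (cong (x *ℚ y *ℚ_) (^-* a)) (interchange x y (x ^ℚ a) (y ^ℚ a))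

partial₀-[] : ∀ z M → partial 0 [] (z ∷ []) (suc M) ≡ 1ᵍ
partial₀-[] z M = trans (∑ᵍ.∑-box (suc M) 0 (term 0 [] (z ∷ [])))
  (trans (∑ᵍ.∑-upTo-first M (slab 0 [] (z ∷ []) (suc M)))
    (cong (1ᵍ +ᵍ_) (∑ᵍ.∑-zero (upTo M) λ a → trans (ᵍ.+-identityʳ (0ᵍ *ᵍ monomial (z ∷ []) (suc a ∷ []))) (ᵍ.zeroˡ (monomial (z ∷ []) (suc a ∷ []))))))

partial₀-∷ : ∀ {d} c (cs : Vec ℕ d) z M → partial 0 (c ∷ cs) z M ≡ 0ᵍ
partial₀-∷ {d} c cs z M = ∑ᵍ.∑-zero (box M (suc (suc d))) {f = term 0 (c ∷ cs) z} λ { (a ∷ as) →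
  trans (cong (λ q → fromℚ q *ᵍ monomial z (a ∷ as)) (T₀-∷ c cs a as)) (ᵍ.zeroˡ (monomial z (a ∷ as))) }

-- Finite sets of exponents

box-unique : ∀ M d → Unique (box M d)
box-unique M zero    = All.[] ∷ []
box-unique M (suc d) = cartesianProductWith⁺ _∷_ ∷-injective (upTo⁺ M) (box-unique M d)

∈-box : ∀ {d} (a : Vec ℕ d) → ∃ λ B → ∀ {M} → B ≤ M → a ∈ box M d
∈-box []       = 0 , λ _ → here refl
∈-box (a ∷ as) with ∈-box as
... | B , as∈ = suc a ⊔ B , λ ≤M →
  ∈-cartesianProductWith⁺ _∷_ (∈-upTo⁺ (ℕ.m⊔n≤o⇒m≤o (suc a) B ≤M)) (as∈ (ℕ.m⊔n≤o⇒n≤o (suc a) B ≤M))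

⊆-box : ∀ {d} (F : List (Vec ℕ d)) → ∃ λ B → ∀ {M} → B ≤ M → ∀ {a} → a ∈ F → a ∈ box M d
⊆-box []      = 0 , λ _ ()
⊆-box (a ∷ F) with ∈-box a | ⊆-box F
... | B , a∈ | B′ , F⊆ = B ⊔ B′ , λ ≤M → λ
  { (here refl) → a∈ (ℕ.m⊔n≤o⇒m≤o B B′ ≤M)
  ; (there x∈F) → F⊆ (ℕ.m⊔n≤o⇒n≤o B B′ ≤M) x∈F }

-- `HasSum` ranges over all duplicate-free lists. One that contains a box is, up to order, the box
-- followed by a tail, and the tail can be estimated separately.
complement : {A : Set} {xs ys : List A} → Unique xs → (∀ {x} → x ∈ xs → x ∈ ys) → ∃ λ zs → ys ↭ xs ++ zs
complement {xs = []} {ys} _ _ = ys , ↭-refl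
complement {xs = x ∷ xs} (x∉xs ∷ unique) xs⊆ys with ∈-∃++ (xs⊆ys (here refl))
... | ys₁ , ys₂ , refl with complement unique xs⊆ys₁++ys₂
  where
  xs⊆ys₁++ys₂ : ∀ {y} → y ∈ xs → y ∈ ys₁ ++ ys₂
  xs⊆ys₁++ys₂ y∈xs with ∈-++⁻ ys₁ (xs⊆ys (there y∈xs))
  ... | inj₁ y∈ys₁         = ∈-++⁺ˡ y∈ys₁
  ... | inj₂ (here refl)   = contradiction refl (All.lookup x∉xs y∈xs)
  ... | inj₂ (there y∈ys₂) = ∈-++⁺ʳ ys₁ y∈ys₂
... | zs , p = zs , ↭-trans (shift x ys₁ ys₂) (prep x p)

unique-++⁻ : {A : Set} (xs : List A) {ys : List A} → Unique (xs ++ ys) → Unique ys × (∀ {y} → y ∈ xs → ¬ (y ∈ ys))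
unique-++⁻ []       unique = unique , λ ()
unique-++⁻ (x ∷ xs) (x∉ ∷ unique) with unique-++⁻ xs unique
... | unique-ys , disjoint = unique-ys , λ
  { (here refl) y∈ys → All.lookup x∉ (∈-++⁺ʳ xs y∈ys) refl
  ; (there y∈xs)     → disjoint y∈xs }

⊑-neg : ∀ {w b} → w ⊑ b → -ᵍ w ⊑ b
⊑-neg {w} {b} (0≤b , w≤) = 0≤b , subst (_≤ℚ b *ℚ b)
  (solve 2 (λ x y → x :* x :+ y :* y := (:- x) :* (:- x) :+ (:- y) :* (:- y)) refl (ℜ w) (ℑ w)) w≤
  where open ℚ.+-*-Solver

-- Convergence on a polydisc with a geometric rate

module Convergence (t : ℚ) (0<t : 0ℚ <ℚ t) (t<1 : t <ℚ 1ℚ) where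
  open Ratio t 0<t t<1

  -- The bound for |z²| when |z| ≤ t², with one factor t for each of three tasks: absorbing the
  -- bound on the coefficients, keeping the sum over the exponents finite, and making the tail
  -- small.
  t³ : ℚ
  t³ = t *ℚ (t *ℚ t)

  Small : ℚ[i] → Set
  Small z = z ⊑ t *ℚ t

  *t≤ : ∀ {q} → 0ℚ ≤ℚ q → t *ℚ q ≤ℚ q
  *t≤ {q} 0≤q = subst (t *ℚ q ≤ℚ_) (ℚ.*-identityˡ q) (*-mono 0≤t t≤1 0≤q ℚ.≤-refl)

  square-⊑ : ∀ {z} → Small z → z *ᵍ z ⊑ t³
  square-⊑ small = ⊑-weaken (⊑-* small small) (ℚ.≤-trans (ℚ.≤-reflexive (ℚ.*-assoc t t (t *ℚ t))) (*t≤ (0≤* 0≤t (0≤* 0≤t 0≤t))))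

  t³≤t : t³ ≤ℚ t
  t³≤t = subst (t³ ≤ℚ_) (ℚ.*-identityʳ t) (ℚ.*-monoˡ-≤-nonNeg t {{ℚ.nonNegative 0≤t}} (ℚ.≤-trans (*t≤ 0≤t) t≤1))

  -- The real part suffices: it is at least 1 - |z²|, hence at least 1 - t.
  denominator-≥ : ∀ {z} → Small z → ∀ {q} → 1ℚ ≤ℚ q → (1ℚ -ℚ t) *ℚ (1ℚ -ℚ t) ≤ℚ norm² (fromℚ q -ᵍ z *ᵍ z)
  denominator-≥ {z} small {q} 1≤q = ℚ.≤-trans (*-mono (ℚ.<⇒≤ 0<1-t) lower (ℚ.<⇒≤ 0<1-t) lower)
    (≤-by (ℑ w *ℚ ℑ w) (0≤p*p (ℑ w)) refl)
    where
    w = fromℚ q -ᵍ z *ᵍ z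
    lower : 1ℚ -ℚ t ≤ℚ ℜ w
    lower = ℚ.+-mono-≤ 1≤q (ℚ.neg-antimono-≤ (ℚ.≤-trans (⊑⇒ℜ≤ (square-⊑ small)) t³≤t))

  Small⇒Regular : ∀ {z} → Small z → Regular z
  Small⇒Regular {z} small k = subst (λ w → w *ᵍ pole k z ≡ 1ᵍ) same (*-conj/norm² w′
    (ℚ.<-≤-trans (0<* 0<1-t 0<1-t) (subst (λ w → (1ℚ -ℚ t) *ℚ (1ℚ -ℚ t) ≤ℚ norm² w) (sym same) (denominator-≥ small 1≤))))
    where
    w′ = fromℚ (odd k ^ℚ 2) -ᵍ z ^ᵍ 2
    same : w′ ≡ fromℚ (odd² k) -ᵍ z *ᵍ z
    same = cong₂ (λ q y → fromℚ q -ᵍ y) (cong (odd k *ℚ_) (ℚ.*-identityʳ (odd k))) (cong (z *ᵍ_) (ᵍ.*-identityʳ z))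
    1≤ : 1ℚ ≤ℚ odd² k
    1≤ = subst (1ℚ ≤ℚ_) (cong (odd k *ℚ_) (ℚ.*-identityʳ (odd k))) (OddLemmas.1≤odd² k)

  monomial-⊑ : ∀ {d} (z : Vec ℚ[i] d) → (∀ j → Small (lookup z j)) → ∀ a → monomial z a ⊑ weight t³ a
  monomial-⊑ []       small []       = ⊑-fromℚ (ℚ.<⇒≤ 0<1)
  monomial-⊑ (z ∷ zs) small (a ∷ as) = ⊑-* (power a) (monomial-⊑ zs (small ∘ suc) as)
    where
    power : ∀ a → z ^ᵍ (2 * a) ⊑ t³ ^ℚ a
    power zero    = ⊑-fromℚ (ℚ.<⇒≤ 0<1)
    power (suc a) = subst (_⊑ t³ ^ℚ suc a) (sym (^-2*suc z a)) (⊑-* (square-⊑ (small zero)) (power a))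

  term-⊑ : ∀ {d} n (c : Vec ℕ d) {K} → (∀ a → T n c a *ℚ weight t a ≤ℚ K) →
    ∀ z → (∀ j → Small (lookup z j)) → ∀ a → term n c z a ⊑ K *ℚ (weight t a *ℚ weight t a)
  term-⊑ n c {K} T≤K z small a = ⊑-weaken (⊑-* (⊑-fromℚ (0≤t⋆ n (interleave2 c a))) (monomial-⊑ z small a)) (begin
    T n c a *ℚ weight t³ a                       ≡⟨ cong (T n c a *ℚ_) (trans (weight-* t (t *ℚ t) a) (cong (w *ℚ_) (weight-* t t a))) ⟩
    T n c a *ℚ (w *ℚ (w *ℚ w))                   ≡⟨ ℚ.*-assoc (T n c a) w (w *ℚ w) ⟨
    (T n c a *ℚ w) *ℚ (w *ℚ w)                   ≤⟨ ℚ.*-monoʳ-≤-nonNeg (w *ℚ w) {{ℚ.nonNegative (0≤p*p w)}} (T≤K a) ⟩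
    K *ℚ (w *ℚ w)                                ∎)
    where
    open ℚ.≤-Reasoning
    w = weight t a

  geometric : ∀ M → ∑ℚ (upTo M) (t ^ℚ_) ≤ℚ Γ
  geometric M = subst (∑ℚ (upTo M) (t ^ℚ_) ≤ℚ_) (ℚ.*-identityʳ Γ)
    (Γ-bound (λ M → ∑ℚ (upTo M) (t ^ℚ_)) (ℚ.<⇒≤ 0<1) (ℚ.<⇒≤ 0<1) (λ M → ℚ.≤-reflexive (trans (∑ℚ.∑-upTo-first M (t ^ℚ_))
      (cong (1ℚ +ℚ_) (∑ℚ.∑-*ˡ (upTo M) t (t ^ℚ_))))) M)

  0≤∑ : {I : Set} (xs : List I) {f : I → ℚ} → (∀ x → 0ℚ ≤ℚ f x) → 0ℚ ≤ℚ ∑ℚ xs f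
  0≤∑ []       0≤f = ℚ.≤-refl
  0≤∑ (x ∷ xs) 0≤f = 0≤+ (0≤f x) (0≤∑ xs 0≤f)

  box-weight : ∀ M d → ∑ℚ (box M d) (weight t) ≤ℚ Γ ^ℚ d
  box-weight M zero    = ℚ.≤-refl
  box-weight M (suc d) = begin
    ∑ℚ (box M (suc d)) (weight t)
      ≡⟨ ∑ℚ.∑-box M d (weight t) ⟩
    ∑ℚ (upTo M) (λ a → ∑ℚ (box M d) λ as → t ^ℚ a *ℚ weight t as)
      ≡⟨ ∑ℚ.∑-cong (upTo M) (λ a → ∑ℚ.∑-*ˡ (box M d) (t ^ℚ a) (weight t)) ⟩
    ∑ℚ (upTo M) (λ a → t ^ℚ a *ℚ ∑ℚ (box M d) (weight t))
      ≡⟨ ∑ℚ.∑-*ʳ (upTo M) (∑ℚ (box M d) (weight t)) (t ^ℚ_) ⟩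
    ∑ℚ (upTo M) (t ^ℚ_) *ℚ ∑ℚ (box M d) (weight t)
      ≤⟨ *-mono (0≤∑ (upTo M) 0≤^) (geometric M) (0≤∑ (box M d) 0≤weight) (box-weight M d) ⟩
    Γ *ℚ Γ ^ℚ d ∎
    where open ℚ.≤-Reasoning

  slab-⊑ : ∀ {d} n (c : Vec ℕ d) {K} → 0ℚ ≤ℚ K → (∀ a → T n c a *ℚ weight t a ≤ℚ K) →
    ∀ z → (∀ j → Small (lookup z j)) → ∀ M a → slab n c z M a ⊑ K *ℚ Γ ^ℚ d *ℚ t ^ℚ a
  slab-⊑ {d} n c {K} 0≤K T≤K z small M a = ⊑-weaken
    (⊑-∑ (box M d) {g = λ as → (K *ℚ t ^ℚ a) *ℚ weight t as} λ {as} _ → ⊑-weaken (term-⊑ n c T≤K z small (a ∷ as)) (square-weight as)) (begin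
    ∑ℚ (box M d) (λ as → (K *ℚ t ^ℚ a) *ℚ weight t as)
      ≡⟨ ∑ℚ.∑-*ˡ (box M d) (K *ℚ t ^ℚ a) (weight t) ⟩
    (K *ℚ t ^ℚ a) *ℚ ∑ℚ (box M d) (weight t)
      ≤⟨ ℚ.*-monoˡ-≤-nonNeg (K *ℚ t ^ℚ a) {{ℚ.nonNegative (0≤* 0≤K (0≤^ a))}} (box-weight M d) ⟩
    (K *ℚ t ^ℚ a) *ℚ Γ ^ℚ d
      ≡⟨ solve 3 (λ k p g → (k :* p) :* g := k :* g :* p) refl K (t ^ℚ a) (Γ ^ℚ d) ⟩
    K *ℚ Γ ^ℚ d *ℚ t ^ℚ a ∎)
    where
    open ℚ.≤-Reasoning
    open ℚ.+-*-Solver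
    -- One of the two weights is estimated by 1; the other splits into t^a and the weight of the
    -- remaining exponents, over which the box is summed.
    square-weight : ∀ as → K *ℚ (weight t (a ∷ as) *ℚ weight t (a ∷ as)) ≤ℚ (K *ℚ t ^ℚ a) *ℚ weight t as
    square-weight as = begin
      K *ℚ (w *ℚ w)                         ≤⟨ ℚ.*-monoˡ-≤-nonNeg K {{ℚ.nonNegative 0≤K}}
                                                 (*-mono (0≤weight (a ∷ as)) ℚ.≤-refl (0≤weight (a ∷ as)) (weight≤1 (a ∷ as))) ⟩
      K *ℚ (w *ℚ 1ℚ)                        ≡⟨ solve 3 (λ k p v → k :* ((p :* v) :* con 1ℚ) := (k :* p) :* v) refl K (t ^ℚ a) (weight t as) ⟩
      (K *ℚ t ^ℚ a) *ℚ weight t as          ∎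
      where w = weight t (a ∷ as)

  Admissible : ∀ {d} → Vec ℕ d → Set
  Admissible c = ∀ j → 1 ≤ lookup c j × lookup c j ≢ 2

  -- The side of the box is `suc M`, so that its last layer exists and is a₀ = M.
  error : ∀ {d} → ℕ → Vec ℕ d → Vec ℚ[i] (suc d) → ℕ → ℚ[i]
  error n c z M = limit n c z -ᵍ partial n c z (suc M)

  -- The error obeys the recursion of the series, up to the outermost slab; dividing by
  -- (2n-1)² - z², of absolute value at least 1 - t, costs a factor Γ.

  error-step : ∀ {d} n (c : Vec ℕ d) z zs M extraₗ extraₚ {α β ℓ} → Small z →
    (fromℚ (odd² (suc n)) -ᵍ z *ᵍ z) *ᵍ limit (suc n) c (z ∷ zs) ≡ fromℚ (odd² (suc n)) *ᵍ limit n c (z ∷ zs) +ᵍ fromℚ (odd² (suc n)) *ᵍ extraₗ →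
    slab (suc n) c (z ∷ zs) (suc M) 0 ≡ slab n c (z ∷ zs) (suc M) 0 +ᵍ extraₚ →
    error n c (z ∷ zs) M ⊑ α → extraₗ -ᵍ extraₚ ⊑ β → slab (suc n) c (z ∷ zs) (suc M) M ⊑ ℓ →
    error (suc n) c (z ∷ zs) M ⊑ Γ *ℚ (odd² (suc n) *ℚ α +ℚ odd² (suc n) *ℚ β +ℚ ℓ)
  error-step n c z zs M extraₗ extraₚ {α} {β} {ℓ} small limit-rec zeroth error⊑ extra⊑ slab⊑ =
    ⊑-÷ {a = o² -ᵍ x} {w = A′ -ᵍ P′} 0<1-t (denominator-≥ small 1≤o²) identity
      (⊑-+ (⊑-+ (⊑-* (⊑-fromℚ 0≤o²) error⊑) (⊑-* (⊑-fromℚ 0≤o²) extra⊑))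
           (⊑-weaken (⊑-* (⊑-weaken (square-⊑ small) (ℚ.≤-trans t³≤t t≤1)) slab⊑) (ℚ.≤-reflexive (ℚ.*-identityˡ ℓ))))
    where
    open ≡-Reasoning
    open ᵍ-Solver
    o² = fromℚ (odd² (suc n))
    x = z *ᵍ z
    A = limit n c (z ∷ zs)
    A′ = limit (suc n) c (z ∷ zs)
    P = partial n c (z ∷ zs) (suc M)
    P′ = partial (suc n) c (z ∷ zs) (suc M)
    L = slab (suc n) c (z ∷ zs) (suc M) M
    1≤o² : 1ℚ ≤ℚ odd² (suc n)
    1≤o² = *-mono (ℚ.<⇒≤ 0<1) (1≤odd n) (ℚ.<⇒≤ 0<1) (1≤odd n)
    0≤o² : 0ℚ ≤ℚ odd² (suc n)
    0≤o² = 0≤p*p (odd (suc n))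
    identity : (o² -ᵍ x) *ᵍ (A′ -ᵍ P′) ≡ o² *ᵍ (A -ᵍ P) +ᵍ o² *ᵍ (extraₗ -ᵍ extraₚ) +ᵍ x *ᵍ L
    identity = begin
      (o² -ᵍ x) *ᵍ (A′ -ᵍ P′)
        ≡⟨ solve 3 (λ w a p → w :* (a :- p) := w :* a :- w :* p) refl (o² -ᵍ x) A′ P′ ⟩
      (o² -ᵍ x) *ᵍ A′ -ᵍ (o² -ᵍ x) *ᵍ P′
        ≡⟨ cong₂ _-ᵍ_ limit-rec (partial-rec n c z zs M extraₚ zeroth) ⟩
      (o² *ᵍ A +ᵍ o² *ᵍ extraₗ) -ᵍ (o² *ᵍ P +ᵍ o² *ᵍ extraₚ -ᵍ x *ᵍ L)
        ≡⟨ solve 7 (λ o a e p f x l → (o :* a :+ o :* e) :- (o :* p :+ o :* f :- x :* l) := o :* (a :- p) :+ o :* (e :- f) :+ x :* l)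
             refl o² A extraₗ P extraₚ x L ⟩
      o² *ᵍ (A -ᵍ P) +ᵍ o² *ᵍ (extraₗ -ᵍ extraₚ) +ᵍ x *ᵍ L ∎

  -- The induction descends in n and in c. B is chosen before z and M, so one constant serves the
  -- approximations of z at all large indices.
  error-bound : ∀ {d} n (c : Vec ℕ d) → Admissible c →
    ∃ λ B → 0ℚ ≤ℚ B × (∀ z → (∀ j → Small (lookup z j)) → ∀ M → error n c z M ⊑ B *ℚ t ^ℚ M)
  error-bound zero [] adm = 0ℚ , ℚ.≤-refl , λ { (z ∷ []) small M →
    subst₂ _⊑_ (sym (cong (λ w → 1ᵍ -ᵍ w) (partial₀-[] z M))) (sym (ℚ.*-zeroˡ (t ^ℚ M))) (⊑-fromℚ ℚ.≤-refl) }
  error-bound zero (c ∷ cs) adm = 0ℚ , ℚ.≤-refl , λ z small M →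
    subst₂ _⊑_ (sym (cong (λ w → 0ᵍ -ᵍ w) (partial₀-∷ c cs z (suc M)))) (sym (ℚ.*-zeroˡ (t ^ℚ M))) (⊑-fromℚ ℚ.≤-refl)
  error-bound (suc n) [] adm with error-bound n [] adm | T-bound (suc n) []
  ... | B , 0≤B , E⊑ | K , 0≤K , T≤K = B′ , 0≤* 0≤Γ (0≤+ (0≤+ (0≤* 0≤o² 0≤B) (0≤* 0≤o² ℚ.≤-refl)) (0≤* 0≤K (0≤^Γ 0))) ,
    λ { (z ∷ []) small M → ⊑-weaken
      (error-step n [] z [] M 0ᵍ 0ᵍ (small zero) (limit-rec z (small zero)) (zeroth z M)
        (E⊑ (z ∷ []) small M) (⊑-fromℚ ℚ.≤-refl) (slab-⊑ (suc n) [] 0≤K T≤K (z ∷ []) small (suc M) M))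
      (ℚ.≤-reflexive (solve 5 (λ g o c k p → g :* (o :* (c :* p) :+ o :* con 0ℚ :+ k :* p) := g :* (o :* c :+ o :* con 0ℚ :+ k) :* p)
        refl Γ (odd² (suc n)) B (K *ℚ Γ ^ℚ 0) (t ^ℚ M))) }
    where
    open ℚ.+-*-Solver
    B′ = Γ *ℚ (odd² (suc n) *ℚ B +ℚ odd² (suc n) *ℚ 0ℚ +ℚ K *ℚ Γ ^ℚ 0)
    0≤o² = 0≤p*p (odd (suc n))
    0≤^Γ : ∀ d → 0ℚ ≤ℚ Γ ^ℚ d
    0≤^Γ d = ℚ.<⇒≤ (0<^ 0<Γ d)
    limit-rec : ∀ z → Small z → (fromℚ (odd² (suc n)) -ᵍ z *ᵍ z) *ᵍ limit (suc n) [] (z ∷ [])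
      ≡ fromℚ (odd² (suc n)) *ᵍ limit n [] (z ∷ []) +ᵍ fromℚ (odd² (suc n)) *ᵍ 0ᵍ
    limit-rec z small = trans (limit-rec-[] n z (Small⇒Regular small))
      (trans (sym (ᵍ.+-identityʳ (fromℚ (odd² (suc n)) *ᵍ limit n [] (z ∷ []))))
             (cong (fromℚ (odd² (suc n)) *ᵍ limit n [] (z ∷ []) +ᵍ_) (sym (ᵍ.zeroʳ (fromℚ (odd² (suc n)))))))
    zeroth : ∀ z M → slab (suc n) [] (z ∷ []) (suc M) 0 ≡ slab n [] (z ∷ []) (suc M) 0 +ᵍ 0ᵍ
    zeroth z M = refl
  error-bound {suc d} (suc n) (c ∷ cs) adm with error-bound n (c ∷ cs) adm | error-bound (suc n) cs (adm ∘ suc) | T-bound (suc n) (c ∷ cs)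
  ... | B , 0≤B , E⊑ | D , 0≤D , F⊑ | K , 0≤K , T≤K = B′ ,
    0≤* 0≤Γ (0≤+ (0≤+ (0≤* 0≤o² 0≤B) (0≤* 0≤o² (0≤* (0≤odd^ᶻ- n c) 0≤D))) (0≤* 0≤K (ℚ.<⇒≤ (0<^ 0<Γ (suc d))))) ,
    λ { (z ∷ z′ ∷ zs) small M → ⊑-weaken
      (error-step n (c ∷ cs) z (z′ ∷ zs) M
        (fromℚ y *ᵍ limit (suc n) cs (z′ ∷ zs)) (fromℚ y *ᵍ partial (suc n) cs (z′ ∷ zs) (suc M)) (small zero)
        (limit-rec-∷ n c cs z z′ zs (Small⇒Regular (small zero)) (proj₁ (adm zero)) (proj₂ (adm zero)))
        (slab-zero-∷ n c cs z z′ zs (suc M))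
        (E⊑ (z ∷ z′ ∷ zs) small M)
        -- The two extra terms differ by y times the error for `cs` at the same `suc n`, hence the
        -- second induction hypothesis.
        (subst (_⊑ y *ℚ (D *ℚ t ^ℚ M)) (factor-out (limit (suc n) cs (z′ ∷ zs)) (partial (suc n) cs (z′ ∷ zs) (suc M)))
          (⊑-* (⊑-fromℚ (0≤odd^ᶻ- n c)) (F⊑ (z′ ∷ zs) (small ∘ suc) M)))
        (slab-⊑ (suc n) (c ∷ cs) 0≤K T≤K (z ∷ z′ ∷ zs) small (suc M) M))
      (ℚ.≤-reflexive (solve 7 (λ g o c y d k p → g :* (o :* (c :* p) :+ o :* (y :* (d :* p)) :+ k :* p) := g :* (o :* c :+ o :* (y :* d) :+ k) :* p)
        refl Γ (odd² (suc n)) B y D (K *ℚ Γ ^ℚ suc d) (t ^ℚ M))) }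
    where
    open ℚ.+-*-Solver
    y = odd (suc n) ^ᶻ (ℤ.- (+ c))
    B′ = Γ *ℚ (odd² (suc n) *ℚ B +ℚ odd² (suc n) *ℚ (y *ℚ D) +ℚ K *ℚ Γ ^ℚ suc d)
    0≤o² = 0≤p*p (odd (suc n))
    factor-out : ∀ a b → fromℚ y *ᵍ (a -ᵍ b) ≡ fromℚ y *ᵍ a -ᵍ fromℚ y *ᵍ b
    factor-out a b = S.solve 3 (λ y a b → y S.:* (a S.:- b) S.:= y S.:* a S.:- y S.:* b) refl (fromℚ y) a b
      where module S = ᵍ-Solver

  ^-antitone : ∀ {M a} → M ≤ a → t ^ℚ a ≤ℚ t ^ℚ M
  ^-antitone {a = a} z≤n = ^≤1 a
  ^-antitone (s≤s M≤a)   = ℚ.*-monoˡ-≤-nonNeg t {{ℚ.nonNegative 0≤t}} (^-antitone M≤a)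

  -- Outside the box some exponent is at least M. Its factor is at most t^M, and the other factors
  -- are at most 1.
  box-or-light : ∀ M {d} (a : Vec ℕ d) → a ∈ box M d ⊎ weight t a ≤ℚ t ^ℚ M
  box-or-light M []       = inj₁ (here refl)
  box-or-light M (a ∷ as) with a ℕ.<? M | box-or-light M as
  ... | yes a<M | inj₁ as∈    = inj₁ (∈-cartesianProductWith⁺ _∷_ (∈-upTo⁺ a<M) as∈)
  ... | yes a<M | inj₂ light  = inj₂ (subst (t ^ℚ a *ℚ weight t as ≤ℚ_) (ℚ.*-identityˡ (t ^ℚ M))
                                  (*-mono (0≤^ a) (^≤1 a) (0≤weight as) light))
  ... | no  a≮M | _           = inj₂ (subst (t ^ℚ a *ℚ weight t as ≤ℚ_) (ℚ.*-identityʳ (t ^ℚ M))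
                                  (*-mono (0≤^ a) (^-antitone (ℕ.≮⇒≥ a≮M)) (0≤weight as) (weight≤1 as)))

  unique-weight : ∀ {d} {F : List (Vec ℕ d)} → Unique F → ∑ℚ F (weight t) ≤ℚ Γ ^ℚ d
  unique-weight {d} {F} unique with ⊆-box F
  ... | B , F⊆ with complement unique (F⊆ ℕ.≤-refl)
  ... | F′ , p = ℚ.≤-trans
    (≤-by (∑ℚ F′ (weight t)) (0≤∑ F′ 0≤weight) (trans (∑ℚ.∑-↭ (weight t) p) (∑ℚ.∑-++ F F′ (weight t))))
    (box-weight B d)

  -- The part of F inside the box is governed by `error-bound`. On the rest the weight occurs twice:
  -- one copy is at most t^M, the other is summed by `unique-weight`, with a bound that does not
  -- depend on F.
  series-close : ∀ {d} n (c : Vec ℕ d) → Admissible c →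
    ∃ λ B → 0ℚ ≤ℚ B × (∀ M F → Unique F → (∀ {a} → a ∈ box (suc M) (suc d) → a ∈ F) →
      ∀ z → (∀ j → Small (lookup z j)) → ∑ᵍ F (term n c z) -ᵍ limit n c z ⊑ B *ℚ t ^ℚ M)
  series-close {d} n c adm with error-bound n c adm | T-bound n c
  ... | B , 0≤B , E⊑ | K , 0≤K , T≤K = B +ℚ K *ℚ G , 0≤+ 0≤B (0≤* 0≤K (ℚ.<⇒≤ (0<^ 0<Γ (suc d)))) , close
    where
    G = Γ ^ℚ suc d
    close : ∀ M F → Unique F → (∀ {a} → a ∈ box (suc M) (suc d) → a ∈ F) →
      ∀ z → (∀ j → Small (lookup z j)) → ∑ᵍ F (term n c z) -ᵍ limit n c z ⊑ (B +ℚ K *ℚ G) *ℚ t ^ℚ M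
    close M F unique box⊆F z small with complement (box-unique (suc M) (suc d)) box⊆F
    ... | F′ , p with unique-++⁻ (box (suc M) (suc d)) (Permutationₛ.Unique-resp-↭ (≡.setoid _) (↭⇒↭ₛ p) unique)
    ... | unique′ , disjoint = subst₂ _⊑_ (sym split) bound≡ (⊑-+ (⊑-neg (E⊑ z small M)) tail⊑)
      where
      f = term n c z
      P = partial n c z (suc M)
      L = limit n c z
      split : ∑ᵍ F f -ᵍ L ≡ -ᵍ (L -ᵍ P) +ᵍ ∑ᵍ F′ f
      split = trans (cong (_-ᵍ L) (trans (∑ᵍ.∑-↭ f p) (∑ᵍ.∑-++ (box (suc M) (suc d)) F′ f)))
        (solve 3 (λ p q l → (p :+ q) :- l := :- (l :- p) :+ q) refl P (∑ᵍ F′ f) L)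
        where open ᵍ-Solver
      bound≡ : B *ℚ t ^ℚ M +ℚ (K *ℚ t ^ℚ M) *ℚ G ≡ (B +ℚ K *ℚ G) *ℚ t ^ℚ M
      bound≡ = solve 4 (λ b k g p → b :* p :+ (k :* p) :* g := (b :+ k :* g) :* p) refl B K G (t ^ℚ M)
        where open ℚ.+-*-Solver
      0≤Kt : 0ℚ ≤ℚ K *ℚ t ^ℚ M
      0≤Kt = 0≤* 0≤K (0≤^ M)
      light : ∀ {a} → a ∈ F′ → weight t a ≤ℚ t ^ℚ M
      light {a} a∈F′ with box-or-light (suc M) a
      ... | inj₁ a∈box = contradiction a∈F′ (disjoint a∈box)
      -- The exponent M+1 is relaxed to M to match the rate on the box.
      ... | inj₂ w≤    = ℚ.≤-trans w≤ (^-antitone (ℕ.n≤1+n M))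
      term⊑ : ∀ {a} → a ∈ F′ → f a ⊑ (K *ℚ t ^ℚ M) *ℚ weight t a
      term⊑ {a} a∈F′ = ⊑-weaken (term-⊑ n c T≤K z small a) (ℚ.≤-trans
        (ℚ.*-monoˡ-≤-nonNeg K {{ℚ.nonNegative 0≤K}} (*-mono (0≤weight a) (light a∈F′) (0≤weight a) ℚ.≤-refl))
        (ℚ.≤-reflexive (sym (ℚ.*-assoc K (t ^ℚ M) (weight t a)))))
      tail⊑ : ∑ᵍ F′ f ⊑ (K *ℚ t ^ℚ M) *ℚ G
      tail⊑ = ⊑-weaken (⊑-∑ F′ {g = λ a → (K *ℚ t ^ℚ M) *ℚ weight t a} term⊑) (ℚ.≤-trans
        (ℚ.≤-reflexive (∑ℚ.∑-*ˡ F′ (K *ℚ t ^ℚ M) (weight t)))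
        (ℚ.*-monoˡ-≤-nonNeg (K *ℚ t ^ℚ M) {{ℚ.nonNegative 0≤Kt}} (unique-weight unique′)))

  -- Bernoulli's inequality for 1/t, with its increment 1/t - 1 lowered to 1 - t. It yields a decay
  -- of order 1/M, which can be compared with `mesh`.
  bernoulli : ∀ M → t ^ℚ M *ℚ (1ℚ +ℚ ⟪ M ⟫ *ℚ (1ℚ -ℚ t)) ≤ℚ 1ℚ
  bernoulli zero    = ℚ.≤-reflexive (solve 1 (λ t → con 1ℚ :* (con 1ℚ :+ con 0ℚ :* (con 1ℚ :- t)) := con 1ℚ) refl t)
    where open ℚ.+-*-Solver
  bernoulli (suc M) = begin
    (t *ℚ p) *ℚ (1ℚ +ℚ ⟪ suc M ⟫ *ℚ h)
      ≡⟨ cong (λ m → (t *ℚ p) *ℚ (1ℚ +ℚ m *ℚ h)) (⟪suc⟫ M) ⟩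
    (t *ℚ p) *ℚ (1ℚ +ℚ (1ℚ +ℚ ⟪ M ⟫) *ℚ h)
      ≤⟨ ≤-by (p *ℚ ((1ℚ +ℚ ⟪ M ⟫) *ℚ (h *ℚ h))) (0≤* (0≤^ M) (0≤* (0≤+ (ℚ.<⇒≤ 0<1) (0≤⟪⟫ M)) (0≤p*p h)))
           (solve 3 (λ t p m → p :* (con 1ℚ :+ m :* (con 1ℚ :- t))
             := (t :* p) :* (con 1ℚ :+ (con 1ℚ :+ m) :* (con 1ℚ :- t)) :+ p :* ((con 1ℚ :+ m) :* ((con 1ℚ :- t) :* (con 1ℚ :- t)))) refl t p ⟪ M ⟫) ⟩
    p *ℚ (1ℚ +ℚ ⟪ M ⟫ *ℚ h)
      ≤⟨ bernoulli M ⟩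
    1ℚ ∎
    where
    open ℚ.≤-Reasoning
    open ℚ.+-*-Solver
    h = 1ℚ -ℚ t
    p = t ^ℚ M

  power≤mesh : ∀ N → t ^ℚ suc N ≤ℚ mesh N *ℚ Γ
  power≤mesh N = begin
    p
      ≡⟨ sym (ℚ.*-identityʳ p) ⟩
    p *ℚ (1ℚ *ℚ 1ℚ)
      ≡⟨ cong₂ (λ u v → p *ℚ (u *ℚ v)) (sym ⟪suc⟫*mesh) (sym (⁻¹-inverse h 0<1-t)) ⟩
    p *ℚ ((⟪ suc N ⟫ *ℚ mesh N) *ℚ (h *ℚ Γ))
      ≡⟨ solve 5 (λ p m e h g → p :* ((m :* e) :* (h :* g)) := (p :* (m :* h)) :* (e :* g)) refl p ⟪ suc N ⟫ (mesh N) h Γ ⟩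
    (p *ℚ (⟪ suc N ⟫ *ℚ h)) *ℚ (mesh N *ℚ Γ)
      ≤⟨ ℚ.*-monoʳ-≤-nonNeg (mesh N *ℚ Γ) {{ℚ.nonNegative 0≤mΓ}} (ℚ.≤-trans
           (ℚ.*-monoˡ-≤-nonNeg p {{ℚ.nonNegative (0≤^ (suc N))}} (≤-by 1ℚ (ℚ.<⇒≤ 0<1) (ℚ.+-comm 1ℚ (⟪ suc N ⟫ *ℚ h))))
           (bernoulli (suc N))) ⟩
    1ℚ *ℚ (mesh N *ℚ Γ)
      ≡⟨ ℚ.*-identityˡ (mesh N *ℚ Γ) ⟩
    mesh N *ℚ Γ ∎
    where
    open ℚ.≤-Reasoning
    open ℚ.+-*-Solver
    h = 1ℚ -ℚ t
    p = t ^ℚ suc N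
    0≤mΓ = 0≤* (ℚ.<⇒≤ (0<mesh N)) 0≤Γ
    ⟪suc⟫*mesh : ⟪ suc N ⟫ *ℚ mesh N ≡ 1ℚ
    ⟪suc⟫*mesh = trans (cong (_*ℚ mesh N) (/1≡ (+ suc N))) (ℚ.*-inverseʳ (fromℕ (suc N)))

  power-small : ∀ {B η} → 0ℚ ≤ℚ B → 0ℚ <ℚ η → ∃ λ M → B *ℚ t ^ℚ M ≤ℚ η
  power-small {B} {η} 0≤B 0<η with mesh-small (η *ℚ D ⁻¹) (0<* 0<η (0<⁻¹ 0<D))
    where
    -- B may be 0; passing to B+1 makes D positive and so invertible.
    D = (B +ℚ 1ℚ) *ℚ Γ
    0<D : 0ℚ <ℚ D
    0<D = 0<* (ℚ.+-mono-≤-< 0≤B 0<1) 0<Γ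
  ... | N , mesh≤ = suc N , (begin
    B *ℚ t ^ℚ suc N
      ≤⟨ *-mono 0≤B (≤-by 1ℚ (ℚ.<⇒≤ 0<1) refl) (0≤^ (suc N)) (power≤mesh N) ⟩
    (B +ℚ 1ℚ) *ℚ (mesh N *ℚ Γ)
      ≡⟨ solve 3 (λ b m g → b :* (m :* g) := (b :* g) :* m) refl (B +ℚ 1ℚ) (mesh N) Γ ⟩
    D *ℚ mesh N
      ≤⟨ ℚ.*-monoˡ-≤-nonNeg D {{ℚ.nonNegative (ℚ.<⇒≤ 0<D)}} (mesh≤ ℕ.≤-refl) ⟩
    D *ℚ (η *ℚ D ⁻¹)
      ≡⟨ solve 3 (λ d e i → d :* (e :* i) := e :* (d :* i)) refl D η (D ⁻¹) ⟩
    η *ℚ (D *ℚ D ⁻¹)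
      ≡⟨ cong (η *ℚ_) (⁻¹-inverse D 0<D) ⟩
    η *ℚ 1ℚ
      ≡⟨ ℚ.*-identityʳ η ⟩
    η ∎)
    where
    open ℚ.≤-Reasoning
    open ℚ.+-*-Solver
    D = (B +ℚ 1ℚ) *ℚ Γ
    0<D : 0ℚ <ℚ D
    0<D = 0<* (ℚ.+-mono-≤-< 0≤B 0<1) 0<Γ

-- Reals are pointwise sequences of rationals, so a complex identity may be read off at each index.

at : ℕ → ℂ → ℚ[i]
at N z = seq (re z) N +i* seq (im z) N

at-+ : ∀ N w z → at N (w +ᶜ z) ≡ at N w +ᵍ at N z
at-+ N w z = refl

at-- : ∀ N w z → at N (w -ᶜ z) ≡ at N w -ᵍ at N z
at-- N w z = refl

at-* : ∀ N w z → at N (w *ᶜ z) ≡ at N w *ᵍ at N z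
at-* N w z = refl

at-∑ : ∀ N {I : Set} (xs : List I) (f : I → ℂ) → at N (∑ᶜ xs f) ≡ ∑ᵍ xs (λ x → at N (f x))
at-∑ N []       f = refl
at-∑ N (x ∷ xs) f = trans (at-+ N (f x) (∑ᶜ xs f)) (cong (at N (f x) +ᵍ_) (at-∑ N xs f))

at-∏ : ∀ N {d} (f : Fin d → ℂ) → at N (∏ᶜ f) ≡ ∏ᵍ (λ j → at N (f j))
at-∏ N {zero}  f = refl
at-∏ N {suc d} f = trans (at-* N (f zero) (∏ᶜ λ j → f (suc j))) (cong (at N (f zero) *ᵍ_) (at-∏ N (λ j → f (suc j))))

at-^ : ∀ N z k → at N (z ^ᶜ k) ≡ at N z ^ᵍ k
at-^ N z zero    = refl
at-^ N z (suc k) = trans (at-* N z (z ^ᶜ k)) (cong (at N z *ᵍ_) (at-^ N z k))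

∏ᵍ-cong : ∀ {d} {f g : Fin d → ℚ[i]} → (∀ j → f j ≡ g j) → ∏ᵍ f ≡ ∏ᵍ g
∏ᵍ-cong {zero}  eq = refl
∏ᵍ-cong {suc d} eq = cong₂ _*ᵍ_ (eq zero) (∏ᵍ-cong (λ j → eq (suc j)))

at-G-term : ∀ N {d} n (c : Vec ℕ d) z a → at N (G-term n c z a) ≡ term n c (Vec.map (at N) z) a
at-G-term N n c z a = trans (at-* N (ℚ⇒ℂ (T n c a)) (∏ᶜ λ j → lookup z j ^ᶜ (2 * lookup a j))) (cong (fromℚ (T n c a) *ᵍ_) (trans (at-∏ N (λ j → lookup z j ^ᶜ (2 * lookup a j)))
  (∏ᵍ-cong λ j → trans (at-^ N (lookup z j) (2 * lookup a j)) (cong (_^ᵍ (2 * lookup a j)) (sym (lookup-map j (at N) z))))))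

-- The proof of apartness enters only the modulus of convergence of the reciprocal, not its
-- sequence.
at-recip : ∀ N z (z#0 : z #0) → at N (recipᶜ z z#0) ≡ conj/norm² (at N z)
at-recip N z z#0 = refl

at-pole : ∀ N k z (w#0 : (ℚ⇒ℂ (odd k ^ℚ 2) -ᶜ z ^ᶜ 2) #0) → at N (recipᶜ (ℚ⇒ℂ (odd k ^ℚ 2) -ᶜ z ^ᶜ 2) w#0) ≡ pole k (at N z)
at-pole N k z w#0 = trans (at-recip N (ℚ⇒ℂ (odd k ^ℚ 2) -ᶜ z ^ᶜ 2) w#0) (cong conj/norm²
  (trans (at-- N (ℚ⇒ℂ (odd k ^ℚ 2)) (z ^ᶜ 2)) (cong (λ w → fromℚ (odd k ^ℚ 2) -ᵍ w) (at-^ N z 2))))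

at-factor : ∀ N p e kp k z (∣z∣<1 : ∣ z ∣ᶜ <ʳ 1ʳ) →
  at N (ℚ⇒ℂ ((-ℚ 1ℚ) ^ℚ (k * (δ p + δ e)) *ℚ odd k ^ᶻ (+ (δ p + δ e) -ℤ 1ℤ))
        *ᶜ recipᶜ (ℚ⇒ℂ (odd k ^ℚ 2) -ᶜ z ^ᶜ 2) (odd²-z²#0 k z ∣z∣<1)
        *ᶜ ℚ⇒ℂ (V# kp k (replicate (p ∸ 3) 1)))
    ≡ factor p e kp k (at N z)
at-factor N p e kp k z ∣z∣<1 = trans (at-* N (a *ᶜ u) (ℚ⇒ℂ v)) (cong (_*ᵍ fromℚ v)
  (trans (at-* N a u) (cong (at N a *ᵍ_) (at-pole N k z (odd²-z²#0 k z ∣z∣<1)))))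
  where
  a = ℚ⇒ℂ ((-ℚ 1ℚ) ^ℚ (k * (δ p + δ e)) *ℚ odd k ^ᶻ (+ (δ p + δ e) -ℤ 1ℤ))
  u = recipᶜ (ℚ⇒ℂ (odd k ^ℚ 2) -ᶜ z ^ᶜ 2) (odd²-z²#0 k z ∣z∣<1)
  v = V# kp k (replicate (p ∸ 3) 1)

at-*-∑ : ∀ N {I : Set} q (xs : List I) (f : I → ℂ) {g : I → ℚ[i]} → (∀ x → at N (f x) ≡ g x) →
  at N (ℚ⇒ℂ q *ᶜ ∑ᶜ xs f) ≡ fromℚ q *ᵍ ∑ᵍ xs g
at-*-∑ N q xs f {g} eq = trans (at-* N (ℚ⇒ℂ q) (∑ᶜ xs f))
  (cong (fromℚ q *ᵍ_) (trans (at-∑ N xs f) (∑ᵍ.∑-cong xs {f = λ x → at N (f x)} {g = g} eq)))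

at-∑-* : ∀ N {I : Set} q (xs : List I) (b : I → ℚ) (p : I → ℂ) {g : I → ℚ[i]} → (∀ k → at N (p k) ≡ g k) →
  at N (ℚ⇒ℂ q *ᶜ ∑ᶜ xs (λ k → ℚ⇒ℂ (b k) *ᶜ p k)) ≡ fromℚ q *ᵍ ∑ᵍ xs (λ k → fromℚ (b k) *ᵍ g k)
at-∑-* N q xs b p {g} eq = at-*-∑ N q xs (λ k → ℚ⇒ℂ (b k) *ᶜ p k) {g = λ k → fromℚ (b k) *ᵍ g k}
  (λ k → trans (at-* N (ℚ⇒ℂ (b k)) (p k)) (cong (fromℚ (b k) *ᵍ_) (eq k)))

-- Moduli of complex numbers at a fixed index

sqrtApprox≤ : ∀ {w b} → w ⊑ b → ∀ n → sqrtApprox (norm² w) n ≤ℚ b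
sqrtApprox≤ {w} {b} (0≤b , w≤) n with SqrtLemmas.sqrtApprox² (norm² w) n
... | inj₁ eq = subst (_≤ℚ b) (sym eq) 0≤b
... | inj₂ ≤w = square-cancel-≤ 0≤b (ℚ.≤-trans ≤w w≤)

-- `sqrtApprox` falls short of the root by less than `mesh n`. Half of the margin ε pays for this
-- defect, the other half remains.
sqrtApprox⇒⊑ : ∀ w n {ε} → sqrtApprox (norm² w) n +ℚ ε ≤ℚ 1ℚ → mesh n ≤ℚ ½ *ℚ ε → w ⊑ 1ℚ -ℚ ½ *ℚ ε
sqrtApprox⇒⊑ w n {ε} s+ε≤1 mesh≤ = ℚ.≤-trans 0≤s′ s′≤ , ℚ.≤-trans
  (ℚ.<⇒≤ (SqrtLemmas.q<[sqrtApprox+mesh]² (norm² w) n)) (*-mono 0≤s′ s′≤ 0≤s′ s′≤)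
  where
  s = sqrtApprox (norm² w) n
  0≤s′ : 0ℚ ≤ℚ s +ℚ mesh n
  0≤s′ = 0≤+ (SqrtLemmas.0≤sqrtApprox (norm² w) n) (ℚ.<⇒≤ (0<mesh n))
  rearrange : ∀ s e → s +ℚ ½ *ℚ e ≡ (s +ℚ e) -ℚ ½ *ℚ e
  rearrange = solve 2 (λ s e → s :+ con ½ :* e := (s :+ e) :- con ½ :* e) refl
    where open ℚ.+-*-Solver
  s′≤ : s +ℚ mesh n ≤ℚ 1ℚ -ℚ ½ *ℚ ε
  s′≤ = ℚ.≤-trans (ℚ.+-monoʳ-≤ s mesh≤) (ℚ.≤-trans (ℚ.≤-reflexive (rearrange s ε)) (ℚ.+-monoˡ-≤ (-ℚ (½ *ℚ ε)) s+ε≤1))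

radius : ∀ z → ∣ z ∣ᶜ <ʳ 1ʳ → ∃ λ r → r <ℚ 1ℚ × ∃ λ N → ∀ {n} → N ≤ n → at n z ⊑ r
radius z (ε , 0<ε , N , ≤1) with mesh-small (½ *ℚ ε) (0<* 0<½ 0<ε)
... | M , mesh≤ = 1ℚ -ℚ ½ *ℚ ε , <-by (½ *ℚ ε) (0<* 0<½ 0<ε) (rearrange (½ *ℚ ε)) , N ⊔ M , λ {n} ≤n →
  sqrtApprox⇒⊑ (at n z) n (≤1 (ℕ.m⊔n≤o⇒m≤o N M ≤n)) (mesh≤ (ℕ.m⊔n≤o⇒n≤o N M ≤n))
  where
  rearrange : ∀ e → 1ℚ ≡ (1ℚ -ℚ e) +ℚ e
  rearrange = solve 1 (λ e → con 1ℚ := (con 1ℚ :- e) :+ e) refl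
    where open ℚ.+-*-Solver

Radius : ∀ {d} → Vec ℂ d → Set
Radius z = ∃ λ r → 0ℚ ≤ℚ r × r <ℚ 1ℚ × ∃ λ N → ∀ {n} → N ≤ n → ∀ j → at n (lookup z j) ⊑ r

radius-∷ : ∀ {d} z {zs : Vec ℂ d} → (∃ λ r → r <ℚ 1ℚ × ∃ λ N → ∀ {n} → N ≤ n → at n z ⊑ r) → Radius zs → Radius (z ∷ zs)
radius-∷ z {zs} (r , r<1 , N , z⊑) (r′ , 0≤r′ , r′<1 , N′ , zs⊑) =
  r ℚ.⊔ r′ , ℚ.≤-trans 0≤r′ (ℚ.p≤q⊔p r r′) , ⊔<1 (ℚ.⊔-sel r r′) , N ⊔ N′ , bound
  where
  ⊔<1 : r ℚ.⊔ r′ ≡ r ⊎ r ℚ.⊔ r′ ≡ r′ → r ℚ.⊔ r′ <ℚ 1ℚ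
  ⊔<1 (inj₁ eq) = subst (_<ℚ 1ℚ) (sym eq) r<1
  ⊔<1 (inj₂ eq) = subst (_<ℚ 1ℚ) (sym eq) r′<1
  bound : ∀ {n} → N ⊔ N′ ≤ n → ∀ j → at n (lookup (z ∷ zs) j) ⊑ r ℚ.⊔ r′
  bound ≤n zero    = ⊑-weaken (z⊑ (ℕ.m⊔n≤o⇒m≤o N N′ ≤n)) (ℚ.p≤p⊔q r r′)
  bound ≤n (suc j) = ⊑-weaken (zs⊑ (ℕ.m⊔n≤o⇒n≤o N N′ ≤n) j) (ℚ.p≤q⊔p r r′)

common-radius : ∀ {d} (z : Vec ℂ d) → (∀ j → ∣ lookup z j ∣ᶜ <ʳ 1ʳ) → Radius z
-- Starting the maximum at 0 makes the common radius nonnegative, as the choice of t in `Root`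
-- requires.
common-radius []       _     = 0ℚ , ℚ.≤-refl , 0<1 , 0 , λ _ ()
common-radius (z ∷ zs) ∣z∣<1 = radius-∷ z (radius z (∣z∣<1 zero)) (common-radius zs (λ j → ∣z∣<1 (suc j)))

-- By AM-GM, t = (1 + r) / 2 satisfies r ≤ t².

module Root (r : ℚ) (0≤r : 0ℚ ≤ℚ r) (r<1 : r <ℚ 1ℚ) where
  open ℚ.+-*-Solver

  t : ℚ
  t = ½ *ℚ (1ℚ +ℚ r)

  0<t : 0ℚ <ℚ t
  0<t = 0<* 0<½ (ℚ.+-mono-<-≤ 0<1 0≤r)

  t<1 : t <ℚ 1ℚ
  t<1 = <-by (½ *ℚ (1ℚ -ℚ r)) (0<* 0<½ (0<b-a r<1))
    (solve 1 (λ r → con 1ℚ := con ½ :* (con 1ℚ :+ r) :+ con ½ :* (con 1ℚ :- r)) refl r)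

  r≤t² : r ≤ℚ t *ℚ t
  r≤t² = ≤-by (s *ℚ s) (0≤p*p s)
    (solve 1 (λ r → (con ½ :* (con 1ℚ :+ r)) :* (con ½ :* (con 1ℚ :+ r))
      := r :+ (con ½ :* (con 1ℚ :- r)) :* (con ½ :* (con 1ℚ :- r))) refl r)
    where s = ½ *ℚ (1ℚ -ℚ r)

difference-⊑ : ∀ {d} N (c : Vec ℕ d) z s n F {b} → at n s ≡ limit N c (Vec.map (at n) z) →
  ∑ᵍ F (term N c (Vec.map (at n) z)) -ᵍ limit N c (Vec.map (at n) z) ⊑ b →
  at n (∑ᶜ F (G-term N c z) -ᶜ s) ⊑ b
difference-⊑ N c z s n F {b} at-s = subst (_⊑ b) (sym (trans (at-- n (∑ᶜ F (G-term N c z)) s)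
  (cong₂ _-ᵍ_ (trans (at-∑ n F (G-term N c z))
                     (∑ᵍ.∑-cong F {f = λ a → at n (G-term N c z a)} {g = term N c (Vec.map (at n) z)} (at-G-term n N c z)))
              at-s)))

-- `<ʳ` demands a margin: one half of δ bounds the modulus and the other half is the margin.
∣∣ᶜ-bound : ∀ w n {δ e} → at n w ⊑ ½ *ℚ δ → 0ℚ +ℚ δ ≤ℚ e → seq ∣ w ∣ᶜ n +ℚ ½ *ℚ δ ≤ℚ e
∣∣ᶜ-bound w n {δ} w⊑ δ≤e = ℚ.≤-trans (ℚ.+-monoˡ-≤ (½ *ℚ δ) (sqrtApprox≤ w⊑ n))
  (ℚ.≤-trans (ℚ.≤-reflexive (trans (half δ) (sym (ℚ.+-identityˡ δ)))) δ≤e)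

Small-at : ∀ {d} t (z : Vec ℂ d) {r n} → r ≤ℚ t *ℚ t → (∀ j → at n (lookup z j) ⊑ r) → ∀ j → lookup (Vec.map (at n) z) j ⊑ t *ℚ t
Small-at t z {n = n} r≤t² z⊑ j = subst (_⊑ t *ℚ t) (sym (lookup-map j (at n) z)) (⊑-weaken (z⊑ j) r≤t²)

-- The order of choices is the point: the radius fixes t, the series fixes B, and B with the lower
-- bound δ of ε fixes the box. Only then does the index N run, from where z is within its radius and
-- ε is above δ.
limit-hasSum : ∀ {d} n (c : Vec ℕ d) (z : Vec ℂ (suc d)) s → (∀ j → 1 ≤ lookup c j × lookup c j ≢ 2) →
  (∀ N → at N s ≡ limit n c (Vec.map (at N) z)) → Radius z → G[ n , c , z ]≡ s
limit-hasSum {d} n c z s adm at-s (r , 0≤r , r<1 , N₀ , z⊑) ε (δ , 0<δ , N₁ , δ≤ε) = choose-bound (series-close n c adm)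
  where
  open Root r 0≤r r<1
  open Convergence t 0<t t<1
  Goal = ∃ λ F₀ → ∀ F → Unique F → (∀ {a} → a ∈ F₀ → a ∈ F) → ∣ ∑ᶜ F (G-term n c z) -ᶜ s ∣ᶜ <ʳ ε
  Close = λ B → ∀ M F → Unique F → (∀ {a} → a ∈ box (suc M) (suc d) → a ∈ F) →
    ∀ z → (∀ j → Small (lookup z j)) → ∑ᵍ F (term n c z) -ᵍ limit n c z ⊑ B *ℚ t ^ℚ M
  choose-box : ∀ {B} → Close B → (∃ λ M → B *ℚ t ^ℚ M ≤ℚ ½ *ℚ δ) → Goal
  choose-box close (M , ≤½δ) = box (suc M) (suc d) , λ F unique box⊆F → ½ *ℚ δ , 0<* 0<½ 0<δ , N₀ ⊔ N₁ , λ {N} ≤N →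
    ∣∣ᶜ-bound (∑ᶜ F (G-term n c z) -ᶜ s) N {δ}
      (difference-⊑ n c z s N F (at-s N) (⊑-weaken
        (close M F unique box⊆F (Vec.map (at N) z) (Small-at t z r≤t² (z⊑ (ℕ.m⊔n≤o⇒m≤o N₀ N₁ ≤N)))) ≤½δ))
      (δ≤ε (ℕ.m⊔n≤o⇒n≤o N₀ N₁ ≤N))
  choose-bound : (∃ λ B → 0ℚ ≤ℚ B × Close B) → Goal
  choose-bound (B , 0≤B , close) = choose-box {B} close (power-small 0≤B (0<* 0<½ 0<δ))

-- The stated right-hand side and the closed form

product-hasSum : ∀ n {d} (c : Vec ℕ d) (z : Vec ℂ (suc d)) (q : ℚ) (b : ℕ → ℚ) (p : Vec ℕ (suc d) → ℂ) →
  1 ≤ n → (∀ j → 1 ≤ lookup c j × lookup c j ≢ 2) → Radius z → q ≡ prefactor n → (∀ k → b k ≡ bin n k) →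
  (∀ N k → at N (p k) ≡ factors 1 c 0 k (Vec.map (at N) z)) →
  G[ n , c , z ]≡ (ℚ⇒ℂ q *ᶜ ∑ᶜ (chains n 1 (suc d)) (λ k → ℚ⇒ℂ (b (lookup k zero)) *ᶜ p k))
-- Matching on `suc` lets `limit n` reduce to `closed n`.
product-hasSum n@(suc _) {d} c z q b p 1≤n adm radius q≡ b≡ at-p =
  limit-hasSum n c z (ℚ⇒ℂ q *ᶜ ∑ᶜ (chains n 1 (suc d)) (λ k → ℚ⇒ℂ (b (lookup k zero)) *ᶜ p k)) adm at-value radius
  where
  at-value : ∀ N → at N (ℚ⇒ℂ q *ᶜ ∑ᶜ (chains n 1 (suc d)) (λ k → ℚ⇒ℂ (b (lookup k zero)) *ᶜ p k)) ≡ closed n c (Vec.map (at N) z)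
  at-value N = begin
    at N (ℚ⇒ℂ q *ᶜ ∑ᶜ (chains n 1 (suc d)) (λ k → ℚ⇒ℂ (b (lookup k zero)) *ᶜ p k))
      ≡⟨ at-∑-* N q (chains n 1 (suc d)) (λ k → b (lookup k zero)) p (at-p N) ⟩
    fromℚ q *ᵍ ∑ᵍ (chains n 1 (suc d)) (λ k → fromℚ (b (lookup k zero)) *ᵍ F k)
      ≡⟨ cong₂ (λ r s → fromℚ r *ᵍ s) q≡ (∑ᵍ.∑-cong (chains n 1 (suc d)) {f = λ k → fromℚ (b (lookup k zero)) *ᵍ F k} {g = λ k → fromℚ (bin n (lookup k zero)) *ᵍ F k}
           λ k → cong (λ r → fromℚ r *ᵍ F k) (b≡ (lookup k zero))) ⟩
    fromℚ (prefactor n) *ᵍ ∑ᵍ (chains n 1 (suc d)) (λ k → fromℚ (bin n (lookup k zero)) *ᵍ F k)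
      ≡⟨ closed≡ n c (Vec.map (at N) z) ⟩
    closed n c (Vec.map (at N) z) ∎
    where
    open ≡-Reasoning
    F : Vec ℕ (suc d) → ℚ[i]
    F k = factors 1 c 0 k (Vec.map (at N) z)

at-factors : ∀ N {d} (c : Vec ℕ d) z (A : Fin (suc d) → ℂ) k →
  (∀ i → at N (A i) ≡ factor (lookup (1 ∷ c) i) (lookup (c ∷ʳ 0) i) (lookup (0 ∷ k) (inject₁ i)) (lookup k i) (at N (lookup z i))) →
  at N (∏ᶜ A) ≡ factors 1 c 0 k (Vec.map (at N) z)
at-factors N c z A k at-A = trans (at-∏ N A) (∏ᵍ-cong {f = λ i → at N (A i)} λ i → trans (at-A i)
  (cong (factor (lookup (1 ∷ c) i) (lookup (c ∷ʳ 0) i) (lookup (0 ∷ k) (inject₁ i)) (lookup k i)) (sym (lookup-map i (at N) z))))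

theorem2p1 :
  ∀ (n d : ℕ) (c : Vec ℕ d) (z : Vec ℂ (suc d)) →
  1 ≤ n →
  (∀ j → 1 ≤ lookup c j × lookup c j ≢ 2) →
  (∣z∣<1 : ∀ j → ∣ lookup z j ∣ᶜ <ʳ 1ʳ) →
  -- c₀ = 1, c_{d+1} = 0 and k₋₁ = 0 are supplied by prepending or appending to c and k
  let δᵢ = λ (i : Fin (suc d)) → δ (lookup (1 ∷ c) i) + δ (lookup (c ∷ʳ 0) i) in
  G[ n , c , z ]≡
    (ℚ⇒ℂ ((+ (n * ((2 * n) C n)) / 1) *ℚ ((+ 2 / 1) ^ℚ (4 * n ∸ 2)) ⁻¹)
    *ᶜ ∑ᶜ (chains n 1 (suc d)) (λ k →
         ℚ⇒ℂ (+ ((2 * n ∸ 1) C (n ∸ lookup k zero)) / 1)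
         *ᶜ ∏ᶜ (λ i →
              ℚ⇒ℂ ((-ℚ 1ℚ) ^ℚ (lookup k i * δᵢ i) *ℚ odd (lookup k i) ^ᶻ (+ δᵢ i -ℤ 1ℤ))
              *ᶜ recipᶜ (ℚ⇒ℂ (odd (lookup k i) ^ℚ 2) -ᶜ lookup z i ^ᶜ 2)
                        (odd²-z²#0 (lookup k i) (lookup z i) (∣z∣<1 i))
              *ᶜ ℚ⇒ℂ (V# (lookup (0 ∷ k) (inject₁ i)) (lookup k i)
                         (replicate (lookup (1 ∷ c) i ∸ 3) 1)))))
theorem2p1 n d c z 1≤n adm ∣z∣<1 = instantiate _ _ _ _ refl refl refl refl
  where
  -- Matching on refl substitutes the terms literally as they occur in the type; writing them out again in
  -- the proof would require comparing complex numbers including their moduli of convergence.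
  instantiate : (q : ℕ → ℚ) (b : ℕ → ℚ) (A : Vec ℕ (suc d) → Fin (suc d) → ℂ) (p : Vec ℕ (suc d) → ℂ) →
    q ≡ (λ n → (+ (n * ((2 * n) C n)) / 1) *ℚ ((+ 2 / 1) ^ℚ (4 * n ∸ 2)) ⁻¹) →
    b ≡ (λ k → + ((2 * n ∸ 1) C (n ∸ k)) / 1) →
    A ≡ (λ k i →
      ℚ⇒ℂ ((-ℚ 1ℚ) ^ℚ (lookup k i * (δ (lookup (1 ∷ c) i) + δ (lookup (c ∷ʳ 0) i)))
           *ℚ odd (lookup k i) ^ᶻ (+ (δ (lookup (1 ∷ c) i) + δ (lookup (c ∷ʳ 0) i)) -ℤ 1ℤ))
      *ᶜ recipᶜ (ℚ⇒ℂ (odd (lookup k i) ^ℚ 2) -ᶜ lookup z i ^ᶜ 2) (odd²-z²#0 (lookup k i) (lookup z i) (∣z∣<1 i))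
      *ᶜ ℚ⇒ℂ (V# (lookup (0 ∷ k) (inject₁ i)) (lookup k i) (replicate (lookup (1 ∷ c) i ∸ 3) 1))) →
    p ≡ (λ k → ∏ᶜ (A k)) →
    let δᵢ = λ (i : Fin (suc d)) → δ (lookup (1 ∷ c) i) + δ (lookup (c ∷ʳ 0) i) in
    G[ n , c , z ]≡
      (ℚ⇒ℂ ((+ (n * ((2 * n) C n)) / 1) *ℚ ((+ 2 / 1) ^ℚ (4 * n ∸ 2)) ⁻¹)
      *ᶜ ∑ᶜ (chains n 1 (suc d)) (λ k →
           ℚ⇒ℂ (+ ((2 * n ∸ 1) C (n ∸ lookup k zero)) / 1)
           *ᶜ ∏ᶜ (λ i →
                ℚ⇒ℂ ((-ℚ 1ℚ) ^ℚ (lookup k i * δᵢ i) *ℚ odd (lookup k i) ^ᶻ (+ δᵢ i -ℤ 1ℤ))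
                *ᶜ recipᶜ (ℚ⇒ℂ (odd (lookup k i) ^ℚ 2) -ᶜ lookup z i ^ᶜ 2)
                          (odd²-z²#0 (lookup k i) (lookup z i) (∣z∣<1 i))
                *ᶜ ℚ⇒ℂ (V# (lookup (0 ∷ k) (inject₁ i)) (lookup k i)
                           (replicate (lookup (1 ∷ c) i ∸ 3) 1)))))
  instantiate q b A p refl refl refl refl = product-hasSum n c z (q n) b p 1≤n adm (common-radius z ∣z∣<1) refl (λ _ → refl)
    (λ N k → at-factors N c z (A k) k λ i →
      at-factor N (lookup (1 ∷ c) i) (lookup (c ∷ʳ 0) i) (lookup (0 ∷ k) (inject₁ i)) (lookup k i) (lookup z i) (∣z∣<1 i))
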